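{- There is an instance of edge-weighted online stochastic matching without free disposal such that every online algorithm, even computationally unbounded, has expected objective less than $0.703$ times the expected weight of the maximum-weight matching of the realized bipartite graph. That is, no algorithm is $0.703$-competitive.
   Context: Online stochastic matching model: $I$ is a finite set of online types and $J$ a finite set of offline vertices, with edges $E\subseteq I\times J$ and weights $w_{ij}>0$. There are $\Lambda$ online vertices (an integer), arriving one at a time. Each independently has type $i$ with probability $\lambda_i/\Lambda$, where $\sum_i\lambda_i=\Lambda$. The asymptotically equivalent Poisson arrival model instead has type $i$ arrive by an independent Poisson process of rate $\lambda_i$ on $[0,1]$. Upon arrival, the algorithm knows $I,J,E,w,\lambda$ and must immediately and irrevocably match the vertex to an unmatched offline neighbor or leave it unmatched. Without free disposal, each offline vertex can be matched at most once. The objective is the total weight of matched edges. -}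

module Defs where

open import Level using (Level; suc; _⊔_)
open import Algebra.Bundles using (CommutativeRing)
open import Algebra.Morphism.Structures using (IsRingMonomorphism)
open import Data.Bool using (Bool; T)
open import Data.Bool.Properties using (T?)
open import Data.Fin using (Fin)
import Data.Fin.Properties as Fin
open import Data.Integer using (+_)
open import Data.List using (List; []; _∷_; map; foldr; filter; allFin; cartesianProductWith)
open import Data.List.Membership.Propositional using (_∈_)
open import Data.Maybe using (Maybe; just; nothing)
import Data.Maybe.Properties as Maybe
open import Data.Nat using (ℕ; NonZero)
open import Data.Product using (_×_; _,_; proj₂)
open import Data.Rational as ℚ using (ℚ; 0ℚ; 1ℚ; _/_)
open import Data.Vec using (Vec; []; _∷_; lookup)
open import Relation.Binary.Core using (Rel)
open import Relation.Binary.PropositionalEquality using (_≡_)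
import Relation.Binary.Construct.NonStrictToStrict as ToStrict
open import Relation.Binary.Structures using (IsTotalOrder)
open import Relation.Nullary using (¬_; Dec; _×-dec_; _→-dec_)

-- Totally ordered commutative rings containing ℚ.  They serve as the domain
-- of the randomisation probabilities of an algorithm; the intended example
-- is ℝ, for which ι is the usual inclusion.
record OrderedExtension (c ℓ₁ ℓ₂ : Level) : Set (suc (c ⊔ ℓ₁ ⊔ ℓ₂)) where
  infix 4 _≤_
  field
    commutativeRing : CommutativeRing c ℓ₁
  open CommutativeRing commutativeRing public
  field
    _≤_          : Rel Carrier ℓ₂
    isTotalOrder : IsTotalOrder _≈_ _≤_
    +-mono-≤     : ∀ {x y} z → x ≤ y → x + z ≤ y + z
    *-nonNeg     : ∀ {x y} → 0# ≤ x → 0# ≤ y → 0# ≤ x * y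
    ι            : ℚ → Carrier
    ι-isRingMono : IsRingMonomorphism ℚ.+-*-rawRing rawRing ι
    ι-mono-≤     : ∀ {p q} → p ℚ.≤ q → ι p ≤ ι q

  -- x < y  is  x ≤ y × ¬ (x ≈ y)
  open ToStrict _≈_ _≤_ public using (_<_)

  sumOver : ∀ {a} {A : Set a} → List A → (A → Carrier) → Carrier
  sumOver xs f = foldr _+_ 0# (map f xs)

sumℚ : ∀ {a} {A : Set a} → List A → (A → ℚ) → ℚ
sumℚ xs f = foldr ℚ._+_ 0ℚ (map f xs)

allVecs : ∀ {a} {A : Set a} → List A → (k : ℕ) → List (Vec A k)
allVecs xs ℕ.zero    = [] ∷ []
allVecs xs (ℕ.suc k) = cartesianProductWith _∷_ xs (allVecs xs k)

record Instance : Set where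
  field
    #I #J       : ℕ
    edge        : Fin #I → Fin #J → Bool
    -- values at non-edges are never used
    weight      : Fin #I → Fin #J → ℚ
    weight-pos  : ∀ i j → T (edge i j) → 0ℚ ℚ.< weight i j
    Λ           : ℕ
    {{Λ-nonZero}} : NonZero Λ
    rate        : Fin #I → ℚ
    rate-nonNeg : ∀ i → 0ℚ ℚ.≤ rate i
    rate-sum    : sumℚ (allFin #I) rate ≡ + Λ / 1

  I J Decision : Set
  I = Fin #I
  J = Fin #J
  -- just j: match the arriving vertex to j;  nothing: leave it unmatched
  Decision = Maybe J

  decisions : List Decision
  decisions = nothing ∷ map just (allFin #J)

  gain : I → Decision → ℚ
  gain i nothing  = 0ℚ
  gain i (just j) = weight i j

  typeProb : I → ℚ
  typeProb i = rate i ℚ.* (+ 1 / Λ)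

  seqProb : ∀ {k} → Vec I k → ℚ
  seqProb []      = 1ℚ
  seqProb (i ∷ t) = typeProb i ℚ.* seqProb t

  arrivals : List (Vec I Λ)
  arrivals = allVecs (allFin #I) Λ

  -- A matching of the graph realised by t, given by the partner (if any) of
  -- each online vertex: only edges are used, and no offline vertex is the
  -- partner of two online vertices.
  IsMatching : ∀ {k} → Vec I k → Vec Decision k → Set
  IsMatching t M =
      (∀ a j → lookup M a ≡ just j → T (edge (lookup t a) j))
    × (∀ a b j → lookup M a ≡ just j → lookup M b ≡ just j → a ≡ b)

  isMatching? : ∀ {k} (t : Vec I k) (M : Vec Decision k) → Dec (IsMatching t M)
  isMatching? t M =
    (Fin.all? λ a → Fin.all? λ j → (lookup M a ≟ just j) →-dec T? (edge (lookup t a) j))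
    ×-dec
    (Fin.all? λ a → Fin.all? λ b → Fin.all? λ j →
      (lookup M a ≟ just j) →-dec ((lookup M b ≟ just j) →-dec (a Fin.≟ b)))
    where _≟_ = Maybe.≡-dec Fin._≟_

  matchingWeight : ∀ {k} → Vec I k → Vec Decision k → ℚ
  matchingWeight {k} t M = sumℚ (allFin k) λ a → gain (lookup t a) (lookup M a)

  -- Starting the fold at 0ℚ adds nothing: the empty matching has weight 0.
  maxMatchingWeight : ∀ {k} → Vec I k → ℚ
  maxMatchingWeight {k} t =
    foldr ℚ._⊔_ 0ℚ (map (matchingWeight t) (filter (isMatching? t) (allVecs decisions k)))

  expectedOPT : ℚ
  expectedOPT = sumℚ arrivals λ t → seqProb t ℚ.* maxMatchingWeight t

  -- earlier arrivals with the decisions taken for them, most recent first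
  History : Set
  History = List (I × Decision)

  Available : History → I → J → Set
  Available h i j = T (edge i j) × ¬ (just j ∈ map proj₂ h)

  -- A randomised online algorithm: choose h i d is the conditional probability
  -- of decision d when, after history h, a vertex of type i arrives.
  record Algorithm {c ℓ₁ ℓ₂} (K : OrderedExtension c ℓ₁ ℓ₂) : Set (c ⊔ ℓ₁ ⊔ ℓ₂) where
    open OrderedExtension K
    field
      choose        : History → I → Decision → Carrier
      choose-nonNeg : ∀ h i d → 0# ≤ choose h i d
      choose-sum    : ∀ h i → sumOver decisions (choose h i) ≈ 1#
      choose-avail  : ∀ h i j → ¬ Available h i j → choose h i (just j) ≈ 0#

    -- expected weight collected from the remaining arrivals t after history h
    rewardFrom : ∀ {k} → History → Vec I k → Carrier
    rewardFrom h []      = 0#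
    rewardFrom h (i ∷ t) =
      sumOver decisions λ d → choose h i d * (ι (gain i d) + rewardFrom ((i , d) ∷ h) t)

    expectedALG : Carrier
    expectedALG = sumOver arrivals λ t → ι (seqProb t) * rewardFrom [] t

{-# OPTIONS --safe #-}
module Submission where

-- The instance.  There are n offline vertices.  Online types: for every offline vertex j a rare type
-- of huge weight adjacent to j only ("heavy", total expected weight 1) and a type of weight 5/4
-- adjacent to j only ("single"); for every triple of offline vertices a type of weight 27/25
-- ("triple"); and a type of weight 1 adjacent to all of J ("global").  For n → ∞ the ratio of this
-- instance tends to about 0.702.
--
-- Algorithms.  While a set S of offline vertices is free, the value of the remaining process is at
-- most |S| A + n B, where A and B depend only on the time left.  A triple can be used with probability
-- 1 − y³ if a fraction y of J is matched; this is concave in 1 − y, so it lies below its tangents, and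
-- the one-step condition for the potential reduces to two recursions for A and B.
--
-- Optimum.  By König's theorem, used at all four weight levels simultaneously, the optimum is at least
-- a positive combination of ranks min_C (|C| + #{hyperedges leaving C}).  The deficiency v(ℓ, m)
-- after ℓ random loops and m random arrivals satisfies v(ℓ, m+1) ≈ v(ℓ, m) − g(−∂v/∂ℓ) with g concave:
-- a new hyperedge raises the rank iff it leaves the largest minimiser C, a random loop does so with
-- probability 1 − |C|/n, and this quantity concentrates.  The affine functions α − h ℓ − m g(h) solve
-- this equation, and a maximum of affine functions that dominates v(·, 0), smoothed by averaging over
-- shifts, dominates v for all m.

-- The weight of an edge depends only on its online end, so the optimum is a maximum-weight
-- independent set of a transversal matroid: one matching is maximum on all four level sets at once,
-- and its weight is the sum of their ranks times the jumps of the weight. The random loops are not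
-- part of the instance. The growth of the rank is governed by the size of C, which the expected
-- rank alone does not determine; the derivative in ℓ supplies it and closes the recursion. The size
-- of C may jump when a single hyperedge changes, so it is replaced by a difference quotient of the
-- rank over a window of w further loops. This quotient changes by at most 2/w and never exceeds the
-- fraction outside C, which is the safe direction because g is increasing. The equation for v is of
-- Hamilton-Jacobi type with the convex initial bound n e^(-ℓ/n), and the maximum of affine
-- solutions is Hopf's formula for it. The envelope of these lines has kinks, where a discrete
-- scheme loses; hence the averaging over shifts. The rate of the globals is chosen so that singles,
-- triples and globals together slightly exceed n on average: the optimum then covers almost all of
-- J.

open import Defs
open import Level using (Level)
open import Algebra.Morphism.Structures using (IsRingMonomorphism)
open import Data.Bool using (Bool; true; false; T; _∧_; _∨_; if_then_else_)
open import Data.Bool.Properties using (T?)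
open import Data.Empty using (⊥-elim)
open import Data.Fin using (Fin; zero; suc; combine; remQuot; toℕ; fromℕ<; _↑ˡ_; _↑ʳ_)
import Data.Fin.Properties as Fin
open import Data.Integer using (+_)
import Data.Integer as ℤ
import Data.Integer.DivMod as ℤ
import Data.Integer.Properties as ℤ
open import Data.List using (List; []; _∷_; _++_; map; foldr; length; replicate; tabulate; allFin; cartesianProductWith)
import Data.List.Membership.DecPropositional as DecMembership
open import Data.List.Membership.Propositional using (_∈_)
import Data.List.Membership.Propositional.Properties as ∈
import Data.List.Properties as List
open import Data.List.Relation.Unary.All using (All; []; _∷_)
import Data.List.Relation.Unary.All.Properties as All
open import Data.List.Relation.Unary.Any using (here; there)
open import Data.Maybe using (Maybe; just; nothing)
import Data.Maybe.Properties as Maybe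
open import Data.Nat using (ℕ; zero; suc; NonZero)
import Data.Nat as ℕ
open import Data.Nat.Divisibility using (n∣m*n)
open import Data.Nat.DivMod using (_%_; m≡m%n+[m/n]*n; m<n*o⇒m/o<n; m%n<n; +-distrib-/-∣ʳ; m<n⇒m/n≡0; m*n/n≡m)
import Data.Nat.Properties as ℕ
open import Data.Nat.Tactic.RingSolver using () renaming (solve-∀ to ℕ-solve-∀)
open import Data.Product using (Σ; ∃; _×_; _,_; proj₁; proj₂)
open import Data.Rational as ℚ using (ℚ; 0ℚ; 1ℚ; _/_; _+_; _*_; _-_; -_; _≤_; _<_)
import Data.Rational.Properties as ℚ
import Data.Rational.Unnormalised as ℚᵘ
import Data.Rational.Unnormalised.Properties as ℚᵘ
open import Data.Sum using (_⊎_; inj₁; inj₂; [_,_]′)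
open import Data.Unit using (tt)
open import Data.Vec using (Vec; []; _∷_; lookup; zipWith; _[_]≔_)
import Data.Vec as Vec
import Data.Vec.Properties as Vec
open import Function using (_∘_; const; id)
open import Relation.Binary.PropositionalEquality using (_≡_; refl; sym; trans; cong; cong₂; subst; subst₂; module ≡-Reasoning)
import Relation.Binary.Reasoning.Setoid as SetoidReasoning
open import Relation.Binary.Structures using (IsTotalOrder)
open import Relation.Nullary using (¬_; Dec; yes; no; _×-dec_; ¬?)
open import Relation.Nullary.Decidable using (⌊_⌋; toWitness; fromWitness)
open import Tactic.RingSolver using (solve-∀)
open import Tactic.RingSolver.Core.AlmostCommutativeRing using (AlmostCommutativeRing; fromCommutativeRing)

-- Rational arithmetic

ℚ-ring : AlmostCommutativeRing _ _
ℚ-ring = fromCommutativeRing ℚ.+-*-commutativeRing isZero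
  where
  isZero : ∀ p → Maybe (0ℚ ≡ p)
  isZero p with 0ℚ ℚ.≟ p
  ... | yes eq = just eq
  ... | no _   = nothing

+-congˡ : ∀ p {q r} → q ≡ r → p + q ≡ p + r
+-congˡ p = cong (λ z → p + z)

+-congʳ : ∀ p {q r} → q ≡ r → q + p ≡ r + p
+-congʳ p = cong (_+ p)

*-congˡ : ∀ p {q r} → q ≡ r → p * q ≡ p * r
*-congˡ p = cong (p *_)

p-p≡0 : ∀ p → p - p ≡ 0ℚ
p-p≡0 = ℚ.+-inverseʳ

p≤q⇒0≤q-p : ∀ {p q} → p ≤ q → 0ℚ ≤ q - p
p≤q⇒0≤q-p {p} {q} le = subst (_≤ q - p) (p-p≡0 p) (ℚ.+-monoˡ-≤ (- p) le)

-- p ≤ q is proved by exhibiting q as p plus a visibly nonnegative d.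
≤-by : ∀ {p q} d → 0ℚ ≤ d → p + d ≡ q → p ≤ q
≤-by {p} {q} d 0≤d eq = subst₂ _≤_ (ℚ.+-identityʳ p) eq (ℚ.+-monoʳ-≤ p 0≤d)

+-cancelʳ : ∀ r {p q} → p + r ≤ q + r → p ≤ q
+-cancelʳ r {p} {q} le = ≤-by ((q + r) - (p + r)) (p≤q⇒0≤q-p le) (lemma p q r)
  where
  lemma : ∀ p q r → p + ((q + r) - (p + r)) ≡ q
  lemma = solve-∀ ℚ-ring

0≤+ : ∀ {p q} → 0ℚ ≤ p → 0ℚ ≤ q → 0ℚ ≤ p + q
0≤+ = ℚ.+-mono-≤

0≤* : ∀ {p q} → 0ℚ ≤ p → 0ℚ ≤ q → 0ℚ ≤ p * q
0≤* {p} {q} 0≤p 0≤q = subst (_≤ p * q) (ℚ.*-zeroˡ q) (ℚ.*-monoʳ-≤-nonNeg q {{ℚ.nonNegative 0≤q}} 0≤p)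

*-monoˡ : ∀ {p q r} → 0ℚ ≤ r → p ≤ q → r * p ≤ r * q
*-monoˡ {r = r} 0≤r = ℚ.*-monoˡ-≤-nonNeg r {{ℚ.nonNegative 0≤r}}

*-monoʳ : ∀ {p q r} → 0ℚ ≤ r → p ≤ q → p * r ≤ q * r
*-monoʳ {r = r} 0≤r = ℚ.*-monoʳ-≤-nonNeg r {{ℚ.nonNegative 0≤r}}

*-cancel-≤ : ∀ {p q r} → 0ℚ < r → r * p ≤ r * q → p ≤ q
*-cancel-≤ {r = r} 0<r = ℚ.*-cancelˡ-≤-pos r {{ℚ.positive 0<r}}

0≤square : ∀ p → 0ℚ ≤ p * p
0≤square p with ℚ.≤-total 0ℚ p
... | inj₁ 0≤p = 0≤* 0≤p 0≤p
... | inj₂ p≤0 = subst (0ℚ ≤_) (neg-square p) (0≤* 0≤-p 0≤-p)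
  where
  0≤-p : 0ℚ ≤ - p
  0≤-p = ℚ.neg-antimono-≤ p≤0
  neg-square : ∀ p → - p * - p ≡ p * p
  neg-square = solve-∀ ℚ-ring

0≤1 : 0ℚ ≤ 1ℚ
0≤1 = ℚ.nonNegative⁻¹ 1ℚ

-- The recursive form of + n / 1, which does not normalise.
fromℕ : ℕ → ℚ
fromℕ zero    = 0ℚ
fromℕ (suc n) = 1ℚ + fromℕ n

0≤fromℕ : ∀ n → 0ℚ ≤ fromℕ n
0≤fromℕ zero    = ℚ.≤-refl
0≤fromℕ (suc n) = 0≤+ 0≤1 (0≤fromℕ n)

fromℕ-+ : ∀ m n → fromℕ (m ℕ.+ n) ≡ fromℕ m + fromℕ n
fromℕ-+ zero    n = sym (ℚ.+-identityˡ (fromℕ n))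
fromℕ-+ (suc m) n = trans (+-congˡ 1ℚ (fromℕ-+ m n)) (sym (ℚ.+-assoc 1ℚ (fromℕ m) (fromℕ n)))

fromℕ-* : ∀ m n → fromℕ (m ℕ.* n) ≡ fromℕ m * fromℕ n
fromℕ-* zero    n = sym (ℚ.*-zeroˡ (fromℕ n))
fromℕ-* (suc m) n = begin
  fromℕ (n ℕ.+ m ℕ.* n)           ≡⟨ fromℕ-+ n (m ℕ.* n) ⟩
  fromℕ n + fromℕ (m ℕ.* n)       ≡⟨ +-congˡ (fromℕ n) (fromℕ-* m n) ⟩
  fromℕ n + fromℕ m * fromℕ n     ≡⟨ lemma (fromℕ m) (fromℕ n) ⟩
  (1ℚ + fromℕ m) * fromℕ n        ∎
  where
  open ≡-Reasoning
  lemma : ∀ p q → q + p * q ≡ (1ℚ + p) * q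
  lemma = solve-∀ ℚ-ring

fromℕ-mono : ∀ {m n} → m ℕ.≤ n → fromℕ m ≤ fromℕ n
fromℕ-mono {n = n} ℕ.z≤n = 0≤fromℕ n
fromℕ-mono (ℕ.s≤s m≤n) = ℚ.+-monoʳ-≤ 1ℚ (fromℕ-mono m≤n)

fromℕ≡/1 : ∀ n → fromℕ n ≡ + n / 1
fromℕ≡/1 n = trans (sym (ℚ.fromℚᵘ-toℚᵘ (fromℕ n))) (ℚ.fromℚᵘ-cong (toℚᵘ-fromℕ n))
  where
  toℚᵘ-fromℕ : ∀ n → ℚ.toℚᵘ (fromℕ n) ℚᵘ.≃ ℚᵘ.mkℚᵘ (+ n) 0
  toℚᵘ-fromℕ zero    = ℚᵘ.≃-refl
  toℚᵘ-fromℕ (suc n) = ℚᵘ.≃-trans (ℚ.toℚᵘ-homo-+ 1ℚ (fromℕ n))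
    (ℚᵘ.≃-trans (ℚᵘ.+-congʳ ℚᵘ.1ℚᵘ (toℚᵘ-fromℕ n))
      (ℚᵘ.*≡* (cong (λ z → (+ 1 ℤ.+ z) ℤ.* + 1) (ℤ.*-identityʳ (+ n)))))

*-inverse-fromℕ : ∀ n .{{_ : NonZero n}} → fromℕ n * (+ 1 / n) ≡ 1ℚ
*-inverse-fromℕ n@(suc k) = trans (cong (_* (+ 1 / n)) (fromℕ≡/1 n))
  (ℚ.toℚᵘ-injective (ℚᵘ.≃-trans (ℚ.toℚᵘ-homo-* (+ n / 1) (+ 1 / n))
    (ℚᵘ.≃-trans (ℚᵘ.*-cong (ℚ.toℚᵘ-fromℚᵘ (ℚᵘ.mkℚᵘ (+ n) 0)) (ℚ.toℚᵘ-fromℚᵘ (ℚᵘ.mkℚᵘ (+ 1) k)))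
      (ℚᵘ.*≡* (cong (λ z → + z) arith)))))
  where
  arith : suc k ℕ.* 1 ℕ.* 1 ≡ 1 ℕ.* (1 ℕ.* suc k)
  arith = trans (ℕ.*-identityʳ _) (trans (ℕ.*-identityʳ _) (sym (trans (ℕ.*-identityˡ _) (ℕ.*-identityˡ _))))

-- Finite sums

private variable
  A B : Set

sum-cong : ∀ (xs : List A) {f g : A → ℚ} → (∀ x → f x ≡ g x) → sumℚ xs f ≡ sumℚ xs g
sum-cong []       eq = refl
sum-cong (x ∷ xs) eq = cong₂ _+_ (eq x) (sum-cong xs eq)

sum-++ : ∀ (xs ys : List A) (f : A → ℚ) → sumℚ (xs ++ ys) f ≡ sumℚ xs f + sumℚ ys f
sum-++ []       ys f = sym (ℚ.+-identityˡ (sumℚ ys f))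
sum-++ (x ∷ xs) ys f = trans (+-congˡ (f x) (sum-++ xs ys f)) (sym (ℚ.+-assoc (f x) (sumℚ xs f) (sumℚ ys f)))

sum-map : ∀ (g : A → B) (xs : List A) (f : B → ℚ) → sumℚ (map g xs) f ≡ sumℚ xs (f ∘ g)
sum-map g []       f = refl
sum-map g (x ∷ xs) f = +-congˡ (f (g x)) (sum-map g xs f)

sum-+ : ∀ (xs : List A) (f g : A → ℚ) → sumℚ xs (λ x → f x + g x) ≡ sumℚ xs f + sumℚ xs g
sum-+ []       f g = refl
sum-+ (x ∷ xs) f g = trans (+-congˡ (f x + g x) (sum-+ xs f g)) (lemma (f x) (g x) (sumℚ xs f) (sumℚ xs g))
  where
  lemma : ∀ a b c d → (a + b) + (c + d) ≡ (a + c) + (b + d)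
  lemma = solve-∀ ℚ-ring

sum-* : ∀ (xs : List A) (c : ℚ) (f : A → ℚ) → sumℚ xs (λ x → c * f x) ≡ c * sumℚ xs f
sum-* []       c f = sym (ℚ.*-zeroʳ c)
sum-* (x ∷ xs) c f = trans (+-congˡ (c * f x) (sum-* xs c f)) (sym (ℚ.*-distribˡ-+ c (f x) (sumℚ xs f)))

sum-0 : ∀ (xs : List A) → sumℚ xs (λ _ → 0ℚ) ≡ 0ℚ
sum-0 []       = refl
sum-0 (x ∷ xs) = trans (ℚ.+-identityˡ _) (sum-0 xs)

sum-const : ∀ (xs : List A) (c : ℚ) → sumℚ xs (λ _ → c) ≡ fromℕ (length xs) * c
sum-const []       c = sym (ℚ.*-zeroˡ c)
sum-const (x ∷ xs) c = trans (+-congˡ c (sum-const xs c)) (lemma c (fromℕ (length xs)))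
  where
  lemma : ∀ c k → c + k * c ≡ (1ℚ + k) * c
  lemma = solve-∀ ℚ-ring

sum-mono : ∀ (xs : List A) {f g : A → ℚ} → (∀ x → f x ≤ g x) → sumℚ xs f ≤ sumℚ xs g
sum-mono []       le = ℚ.≤-refl
sum-mono (x ∷ xs) le = ℚ.+-mono-≤ (le x) (sum-mono xs le)

sum-swap : ∀ (xs : List A) (ys : List B) (f : A → B → ℚ) →
  sumℚ xs (λ x → sumℚ ys (f x)) ≡ sumℚ ys (λ y → sumℚ xs (λ x → f x y))
sum-swap []       ys f = sym (sum-0 ys)
sum-swap (x ∷ xs) ys f = trans (+-congˡ (sumℚ ys (f x)) (sum-swap xs ys f))
  (sym (sum-+ ys (f x) (λ y → sumℚ xs (λ x → f x y))))

sum-product : ∀ {C : Set} (h : A → B → C) (xs : List A) (ys : List B) (f : C → ℚ) →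
  sumℚ (cartesianProductWith h xs ys) f ≡ sumℚ xs (λ x → sumℚ ys (λ y → f (h x y)))
sum-product h []       ys f = refl
sum-product h (x ∷ xs) ys f = trans (sum-++ (map (h x) ys) _ f)
  (cong₂ _+_ (sum-map (h x) ys f) (sum-product h xs ys f))

sum-tabulate : ∀ {n} (g : Fin n → A) (f : A → ℚ) → sumℚ (tabulate g) f ≡ sumℚ (allFin n) (f ∘ g)
sum-tabulate g f = trans (cong (foldr _+_ 0ℚ) (List.map-tabulate g f))
  (sym (cong (foldr _+_ 0ℚ) (List.map-tabulate id (f ∘ g))))

sum-allFin-suc : ∀ n (f : Fin (suc n) → ℚ) → sumℚ (allFin (suc n)) f ≡ f zero + sumℚ (allFin n) (f ∘ suc)
sum-allFin-suc n f = +-congˡ (f zero) (sum-tabulate suc f)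

-- Probability distributions with finite support

-- Weighted lists, in which outcomes may repeat: an expectation is then a finite rational sum, and
-- independent draws are products of lists.
record Mean (A : Set) : Set where
  field
    dist   : List (ℚ × A)
    nonNeg : All (λ px → 0ℚ ≤ proj₁ px) dist
    total  : sumℚ dist proj₁ ≡ 1ℚ

  E : (A → ℚ) → ℚ
  E f = sumℚ dist (λ px → proj₁ px * f (proj₂ px))

open Mean using (E)

module _ (M : Mean A) where
  open Mean M using (dist; nonNeg; total)

  E-cong : ∀ {f g} → (∀ x → f x ≡ g x) → E M f ≡ E M g
  E-cong eq = sum-cong dist (λ px → *-congˡ (proj₁ px) (eq (proj₂ px)))

  E-mono : ∀ {f g} → (∀ x → f x ≤ g x) → E M f ≤ E M g
  E-mono {f} {g} le = go dist nonNeg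
    where
    go : ∀ d → All (λ px → 0ℚ ≤ proj₁ px) d →
         sumℚ d (λ px → proj₁ px * f (proj₂ px)) ≤ sumℚ d (λ px → proj₁ px * g (proj₂ px))
    go []       []         = ℚ.≤-refl
    go (px ∷ d) (0≤p ∷ ps) = ℚ.+-mono-≤ (*-monoˡ 0≤p (le (proj₂ px))) (go d ps)

  E-+ : ∀ f g → E M (λ x → f x + g x) ≡ E M f + E M g
  E-+ f g = trans (sum-cong dist (λ px → ℚ.*-distribˡ-+ (proj₁ px) (f (proj₂ px)) (g (proj₂ px))))
    (sum-+ dist _ _)

  E-* : ∀ c f → E M (λ x → c * f x) ≡ c * E M f
  E-* c f = trans (sum-cong dist (λ px → lemma (proj₁ px) c (f (proj₂ px)))) (sum-* dist c _)
    where
    lemma : ∀ p c y → p * (c * y) ≡ c * (p * y)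
    lemma = solve-∀ ℚ-ring

  E-const : ∀ c → E M (const c) ≡ c
  E-const c = trans (sum-cong dist (λ px → ℚ.*-comm (proj₁ px) c))
    (trans (sum-* dist c proj₁) (trans (*-congˡ c total) (ℚ.*-identityʳ c)))

  E-neg : ∀ f → E M (λ x → - f x) ≡ - E M f
  E-neg f = trans (E-cong (λ x → neg-* (f x))) (trans (E-* (- 1ℚ) f) (sym (neg-* (E M f))))
    where
    neg-* : ∀ p → - p ≡ (- 1ℚ) * p
    neg-* = solve-∀ ℚ-ring

  E-minus : ∀ f g → E M (λ x → f x - g x) ≡ E M f - E M g
  E-minus f g = trans (E-+ f (λ x → - g x)) (+-congˡ (E M f) (E-neg g))

  E-≤-const : ∀ {f} c → (∀ x → f x ≤ c) → E M f ≤ c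
  E-≤-const {f} c le = subst (E M f ≤_) (E-const c) (E-mono le)

  E-≥-const : ∀ {f} c → (∀ x → c ≤ f x) → c ≤ E M f
  E-≥-const {f} c le = subst (_≤ E M f) (E-const c) (E-mono le)

E-swap : ∀ (M : Mean A) (N : Mean B) (f : A → B → ℚ) →
  E M (λ x → E N (f x)) ≡ E N (λ y → E M (λ x → f x y))
E-swap M N f = begin
  sumℚ dM (λ px → proj₁ px * sumℚ dN (λ qy → proj₁ qy * f (proj₂ px) (proj₂ qy)))
    ≡⟨ sum-cong dM (λ px → sym (sum-* dN (proj₁ px) _)) ⟩
  sumℚ dM (λ px → sumℚ dN (λ qy → proj₁ px * (proj₁ qy * f (proj₂ px) (proj₂ qy))))
    ≡⟨ sum-swap dM dN _ ⟩
  sumℚ dN (λ qy → sumℚ dM (λ px → proj₁ px * (proj₁ qy * f (proj₂ px) (proj₂ qy))))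
    ≡⟨ sum-cong dN (λ qy → trans (sum-cong dM (λ px → lemma (proj₁ px) (proj₁ qy) (f (proj₂ px) (proj₂ qy)))) (sum-* dM (proj₁ qy) _)) ⟩
  sumℚ dN (λ qy → proj₁ qy * sumℚ dM (λ px → proj₁ px * f (proj₂ px) (proj₂ qy))) ∎
  where
  open ≡-Reasoning
  dM = Mean.dist M
  dN = Mean.dist N
  lemma : ∀ p q y → p * (q * y) ≡ q * (p * y)
  lemma = solve-∀ ℚ-ring

mapMean : (A → B) → Mean A → Mean B
mapMean g M = record
  { dist   = map (λ px → proj₁ px , g (proj₂ px)) dist
  ; nonNeg = All.map⁺ nonNeg
  ; total  = trans (sum-map _ dist proj₁) total
  }
  where open Mean M

E-mapMean : ∀ (g : A → B) (M : Mean A) f → E (mapMean g M) f ≡ E M (f ∘ g)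
E-mapMean g M f = sum-map _ (Mean.dist M) _

pointMean : A → Mean A
pointMean x = record { dist = (1ℚ , x) ∷ [] ; nonNeg = 0≤1 ∷ [] ; total = refl }

E-pointMean : ∀ (x : A) f → E (pointMean x) f ≡ f x
E-pointMean x f = trans (ℚ.+-identityʳ (1ℚ * f x)) (ℚ.*-identityˡ (f x))

productWith : ∀ {C : Set} → (A → B → C) → Mean A → Mean B → Mean C
productWith {A = A} {B = B} {C = C} h M N = record
  { dist   = cartesianProductWith pair (Mean.dist M) (Mean.dist N)
  ; nonNeg = go (Mean.dist M) (Mean.nonNeg M)
  ; total  = trans (sum-product pair (Mean.dist M) (Mean.dist N) proj₁)
      (trans (sum-cong (Mean.dist M) (λ px → trans (sum-* (Mean.dist N) (proj₁ px) proj₁)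
        (trans (*-congˡ (proj₁ px) (Mean.total N)) (ℚ.*-identityʳ (proj₁ px)))))
        (Mean.total M))
  }
  where
  pair : ℚ × A → ℚ × B → ℚ × C
  pair px qy = proj₁ px * proj₁ qy , h (proj₂ px) (proj₂ qy)
  row : ∀ px → 0ℚ ≤ proj₁ px → ∀ d → All (λ qy → 0ℚ ≤ proj₁ qy) d → All (λ rz → 0ℚ ≤ proj₁ rz) (map (pair px) d)
  row px 0≤p []       []         = []
  row px 0≤p (qy ∷ d) (0≤q ∷ qs) = 0≤* 0≤p 0≤q ∷ row px 0≤p d qs
  go : ∀ d → All (λ px → 0ℚ ≤ proj₁ px) d → All (λ rz → 0ℚ ≤ proj₁ rz) (cartesianProductWith pair d (Mean.dist N))
  go []       []         = []
  go (px ∷ d) (0≤p ∷ ps) = All.++⁺ (row px 0≤p (Mean.dist N) (Mean.nonNeg N)) (go d ps)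

E-productWith : ∀ {C : Set} (h : A → B → C) (M : Mean A) (N : Mean B) f →
  E (productWith h M N) f ≡ E M (λ x → E N (λ y → f (h x y)))
E-productWith h M N f = trans (sum-product _ (Mean.dist M) (Mean.dist N) _)
  (sum-cong (Mean.dist M) (λ px → trans (sum-cong (Mean.dist N) (λ qy → ℚ.*-assoc (proj₁ px) (proj₁ qy) (f (h (proj₂ px) (proj₂ qy)))))
    (sum-* (Mean.dist N) (proj₁ px) _)))

sequence : List (Mean A) → Mean (List A)
sequence []       = pointMean []
sequence (M ∷ Ms) = productWith _∷_ M (sequence Ms)

E-sequence : ∀ (M : Mean A) Ms f → E (sequence (M ∷ Ms)) f ≡ E M (λ x → E (sequence Ms) (λ s → f (x ∷ s)))
E-sequence M Ms f = E-productWith _∷_ M (sequence Ms) f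

E-sequence-++ : ∀ (Ms Ns : List (Mean A)) f →
  E (sequence (Ms ++ Ns)) f ≡ E (sequence Ms) (λ s → E (sequence Ns) (λ t → f (s ++ t)))
E-sequence-++ {A} [] Ns f = sym (E-pointMean {List A} [] (λ s → E (sequence Ns) (λ t → f (s ++ t))))
E-sequence-++ (M ∷ Ms) Ns f = trans (E-sequence M (Ms ++ Ns) f)
  (trans (E-cong M (λ x → E-sequence-++ Ms Ns (λ s → f (x ∷ s)))) (sym (E-sequence M Ms _)))

-- Rank of a list of hyperedges

Subset : ℕ → Set
Subset = Vec Bool

size : ∀ {n} → Subset n → ℕ
size []          = 0
size (true  ∷ C) = suc (size C)
size (false ∷ C) = size C

infixr 6 _∪_
infixr 7 _∩_
_∪_ _∩_ : ∀ {n} → Subset n → Subset n → Subset n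
_∪_ = zipWith _∨_
_∩_ = zipWith _∧_

infix 4 _⊆_
_⊆_ : ∀ {n} → Subset n → Subset n → Set
C ⊆ D = ∀ j → lookup C j ≡ true → lookup D j ≡ true

size-∪-∩ : ∀ {n} (C D : Subset n) → size (C ∪ D) ℕ.+ size (C ∩ D) ≡ size C ℕ.+ size D
size-∪-∩ []          []          = refl
size-∪-∩ (true  ∷ C) (true  ∷ D) = cong suc (trans (ℕ.+-suc _ _) (trans (cong suc (size-∪-∩ C D)) (sym (ℕ.+-suc _ _))))
size-∪-∩ (true  ∷ C) (false ∷ D) = cong suc (size-∪-∩ C D)
size-∪-∩ (false ∷ C) (true  ∷ D) = trans (cong suc (size-∪-∩ C D)) (sym (ℕ.+-suc _ _))
size-∪-∩ (false ∷ C) (false ∷ D) = size-∪-∩ C D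

size≤n : ∀ {n} (C : Subset n) → size C ℕ.≤ n
size≤n []          = ℕ.z≤n
size≤n (true  ∷ C) = ℕ.s≤s (size≤n C)
size≤n (false ∷ C) = ℕ.m≤n⇒m≤1+n (size≤n C)

size-∪-≤⇒⊆ : ∀ {n} (C D : Subset n) → size (C ∪ D) ℕ.≤ size C → D ⊆ C
size-∪-≤⇒⊆ (true  ∷ C) (b     ∷ D) le zero    _  = refl
size-∪-≤⇒⊆ (true  ∷ C) (b     ∷ D) (ℕ.s≤s le) (suc j) eq = size-∪-≤⇒⊆ C D le j eq
size-∪-≤⇒⊆ (false ∷ C) (true  ∷ D) le j       eq = ⊥-elim (ℕ.<-irrefl refl (ℕ.≤-trans le (size≤∪ C D)))
  where
  size≤∪ : ∀ {n} (C D : Subset n) → size C ℕ.≤ size (C ∪ D)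
  size≤∪ []          []          = ℕ.z≤n
  size≤∪ (true  ∷ C) (b     ∷ D) = ℕ.s≤s (size≤∪ C D)
  size≤∪ (false ∷ C) (true  ∷ D) = ℕ.m≤n⇒m≤1+n (size≤∪ C D)
  size≤∪ (false ∷ C) (false ∷ D) = size≤∪ C D
size-∪-≤⇒⊆ (false ∷ C) (false ∷ D) le (suc j) eq = size-∪-≤⇒⊆ C D le j eq

argmin : ∀ {n} (f : Subset n → ℕ) → ∃ λ C → ∀ D → f C ℕ.≤ f D
argmin {zero}  f = [] , λ { [] → ℕ.≤-refl }
argmin {suc n} f with argmin (f ∘ (true ∷_)) | argmin (f ∘ (false ∷_))
... | C , min-C | D , min-D with ℕ.≤-total (f (true ∷ C)) (f (false ∷ D))
... | inj₁ le = true ∷ C , λ { (true ∷ B) → min-C B ; (false ∷ B) → ℕ.≤-trans le (min-D B) }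
... | inj₂ le = false ∷ D , λ { (true ∷ B) → ℕ.≤-trans le (min-C B) ; (false ∷ B) → min-D B }

module Rank (n : ℕ) where

  J : Set
  J = Fin n

  -- The empty hyperedge lies inside every set, so it stands for a vertex to be ignored.
  Hyperedge : Set
  Hyperedge = List J

  inside : Hyperedge → Subset n → Bool
  inside []      C = true
  inside (j ∷ e) C = lookup C j ∧ inside e C

  leaves : Hyperedge → Subset n → ℕ
  leaves e C = if inside e C then 0 else 1

  out : List Hyperedge → Subset n → ℕ
  out []      C = 0
  out (e ∷ s) C = leaves e C ℕ.+ out s C

  -- A vertex cover whose offline part is `C` must contain every hyperedge that leaves `C`. The
  -- least cost is therefore the least size of a vertex cover, by König's theorem the size of a
  -- maximum matching.
  cost : List Hyperedge → Subset n → ℕ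
  cost s C = size C ℕ.+ out s C

  inside-mono : ∀ e {C D} → C ⊆ D → inside e C ≡ true → inside e D ≡ true
  inside-mono []      sub eq = refl
  inside-mono (j ∷ e) {C} {D} sub eq with lookup C j in Cj
  inside-mono (j ∷ e) {C} {D} sub ()  | false
  ... | true rewrite sub j Cj = inside-mono e {C} {D} sub eq

  ∪-⊆ˡ : ∀ (C D : Subset n) → C ⊆ C ∪ D
  ∪-⊆ˡ C D j eq = trans (Vec.lookup-zipWith _∨_ j C D) (cong (_∨ lookup D j) eq)

  ∪-⊆ʳ : ∀ (C D : Subset n) → D ⊆ C ∪ D
  ∪-⊆ʳ C D j eq = trans (Vec.lookup-zipWith _∨_ j C D) (trans (cong (lookup C j ∨_) eq) (∨-true (lookup C j)))
    where
    ∨-true : ∀ b → b ∨ true ≡ true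
    ∨-true true  = refl
    ∨-true false = refl

  inside-∩ : ∀ e C D → inside e C ≡ true → inside e D ≡ true → inside e (C ∩ D) ≡ true
  inside-∩ []      C D eqC eqD = refl
  inside-∩ (j ∷ e) C D eqC eqD with lookup C j in Cj | lookup D j in Dj
  inside-∩ (j ∷ e) C D () eqD  | false | _
  inside-∩ (j ∷ e) C D eqC ()  | true  | false
  ... | true | true rewrite Vec.lookup-zipWith _∧_ j C D | Cj | Dj = inside-∩ e C D eqC eqD

  leaves-≤1 : ∀ e C → leaves e C ℕ.≤ 1
  leaves-≤1 e C with inside e C
  ... | true  = ℕ.z≤n
  ... | false = ℕ.≤-refl

  leaves-antimono : ∀ e {C D} → C ⊆ D → leaves e D ℕ.≤ leaves e C
  leaves-antimono e {C} {D} sub with inside e C in eqC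
  ... | true  rewrite inside-mono e {C} {D} sub eqC = ℕ.z≤n
  ... | false = leaves-≤1 e D

  -- A hyperedge inside one of the sets is inside their union, and one inside both is inside their
  -- intersection.
  leaves-submodular : ∀ e C D → leaves e (C ∪ D) ℕ.+ leaves e (C ∩ D) ℕ.≤ leaves e C ℕ.+ leaves e D
  leaves-submodular e C D with inside e C in eqC | inside e D in eqD
  ... | true  | true  rewrite inside-mono e {C} {C ∪ D} (∪-⊆ˡ C D) eqC | inside-∩ e C D eqC eqD = ℕ.z≤n
  ... | true  | false rewrite inside-mono e {C} {C ∪ D} (∪-⊆ˡ C D) eqC = leaves-≤1 e (C ∩ D)
  ... | false | true  rewrite inside-mono e {D} {C ∪ D} (∪-⊆ʳ C D) eqD = leaves-≤1 e (C ∩ D)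
  ... | false | false = ℕ.+-mono-≤ (leaves-≤1 e (C ∪ D)) (leaves-≤1 e (C ∩ D))

  -- s ⊑ s′: s arises from s′ by ignoring some of its hyperedges.
  infix 4 _⊑_
  data _⊑_ : List Hyperedge → List Hyperedge → Set where
    []   : [] ⊑ []
    keep : ∀ {s s′} e → s ⊑ s′ → (e ∷ s) ⊑ (e ∷ s′)
    drop : ∀ {s s′} e → s ⊑ s′ → ([] ∷ s) ⊑ (e ∷ s′)

  ⊑-refl : ∀ s → s ⊑ s
  ⊑-refl []      = []
  ⊑-refl (e ∷ s) = keep e (⊑-refl s)

  -- The union is charged with the longer list and the intersection with the shorter one; this
  -- asymmetry is what compares the minimisers of two different lists. An ignored hyperedge counts
  -- for `s′` only, where passing from `D` to the union cannot hurt.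
  out-submodular : ∀ {s s′} → s ⊑ s′ → ∀ C D →
    out s′ (C ∪ D) ℕ.+ out s (C ∩ D) ℕ.≤ out s C ℕ.+ out s′ D
  out-submodular []           C D = ℕ.z≤n
  out-submodular (keep {s} {s′} e sub) C D = begin
    (leaves e (C ∪ D) ℕ.+ out s′ (C ∪ D)) ℕ.+ (leaves e (C ∩ D) ℕ.+ out s (C ∩ D))
      ≡⟨ interchange (leaves e (C ∪ D)) (out s′ (C ∪ D)) (leaves e (C ∩ D)) (out s (C ∩ D)) ⟩
    (leaves e (C ∪ D) ℕ.+ leaves e (C ∩ D)) ℕ.+ (out s′ (C ∪ D) ℕ.+ out s (C ∩ D))
      ≤⟨ ℕ.+-mono-≤ (leaves-submodular e C D) (out-submodular sub C D) ⟩
    (leaves e C ℕ.+ leaves e D) ℕ.+ (out s C ℕ.+ out s′ D)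
      ≡⟨ interchange (leaves e C) (leaves e D) (out s C) (out s′ D) ⟩
    (leaves e C ℕ.+ out s C) ℕ.+ (leaves e D ℕ.+ out s′ D) ∎
    where
    open ℕ.≤-Reasoning
    interchange : ∀ a b c d → (a ℕ.+ b) ℕ.+ (c ℕ.+ d) ≡ (a ℕ.+ c) ℕ.+ (b ℕ.+ d)
    interchange = ℕ-solve-∀
  out-submodular (drop {s} {s′} e sub) C D = begin
    (leaves e (C ∪ D) ℕ.+ out s′ (C ∪ D)) ℕ.+ out s (C ∩ D)
      ≡⟨ ℕ.+-assoc (leaves e (C ∪ D)) _ _ ⟩
    leaves e (C ∪ D) ℕ.+ (out s′ (C ∪ D) ℕ.+ out s (C ∩ D))
      ≤⟨ ℕ.+-mono-≤ (leaves-antimono e {D} {C ∪ D} (∪-⊆ʳ C D)) (out-submodular sub C D) ⟩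
    leaves e D ℕ.+ (out s C ℕ.+ out s′ D)
      ≡⟨ exchange (leaves e D) (out s C) (out s′ D) ⟩
    out s C ℕ.+ (leaves e D ℕ.+ out s′ D) ∎
    where
    open ℕ.≤-Reasoning
    exchange : ∀ a b c → a ℕ.+ (b ℕ.+ c) ≡ b ℕ.+ (a ℕ.+ c)
    exchange = ℕ-solve-∀

  cost-submodular : ∀ {s s′} → s ⊑ s′ → ∀ C D →
    cost s′ (C ∪ D) ℕ.+ cost s (C ∩ D) ℕ.≤ cost s C ℕ.+ cost s′ D
  cost-submodular {s} {s′} sub C D = begin
    (size (C ∪ D) ℕ.+ out s′ (C ∪ D)) ℕ.+ (size (C ∩ D) ℕ.+ out s (C ∩ D))
      ≡⟨ interchange (size (C ∪ D)) (out s′ (C ∪ D)) (size (C ∩ D)) (out s (C ∩ D)) ⟩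
    (size (C ∪ D) ℕ.+ size (C ∩ D)) ℕ.+ (out s′ (C ∪ D) ℕ.+ out s (C ∩ D))
      ≤⟨ ℕ.+-mono-≤ (ℕ.≤-reflexive (size-∪-∩ C D)) (out-submodular sub C D) ⟩
    (size C ℕ.+ size D) ℕ.+ (out s C ℕ.+ out s′ D)
      ≡⟨ interchange (size C) (size D) (out s C) (out s′ D) ⟩
    (size C ℕ.+ out s C) ℕ.+ (size D ℕ.+ out s′ D) ∎
    where
    open ℕ.≤-Reasoning
    interchange : ∀ a b c d → (a ℕ.+ b) ℕ.+ (c ℕ.+ d) ≡ (a ℕ.+ c) ℕ.+ (b ℕ.+ d)
    interchange = ℕ-solve-∀

  -- Minimising this weight means minimising the cost first and maximising the size second.
  private
    lexicographic : List Hyperedge → Subset n → ℕ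
    lexicographic s C = cost s C ℕ.* suc n ℕ.+ (n ℕ.∸ size C)

  closed : List Hyperedge → Subset n
  closed s = proj₁ (argmin (lexicographic s))

  rank : List Hyperedge → ℕ
  rank s = cost s (closed s)

  rank≤cost : ∀ s C → rank s ℕ.≤ cost s C
  rank≤cost s C with ℕ.≤-total (rank s) (cost s C)
  ... | inj₁ le = le
  ... | inj₂ ge with ℕ.m≤n⇒m<n∨m≡n ge
  ...   | inj₂ eq = ℕ.≤-reflexive (sym eq)
  -- The tie-breaking term is at most `n`, so it cannot outweigh one unit of cost, which counts
  -- `suc n`.
  ...   | inj₁ lt = ⊥-elim (ℕ.<-irrefl refl (begin-strict
    rank s ℕ.* suc n ≤⟨ ℕ.m≤m+n _ _ ⟩
    lexicographic s (closed s) ≤⟨ proj₂ (argmin (lexicographic s)) C ⟩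
    lexicographic s C ≤⟨ ℕ.+-monoʳ-≤ (cost s C ℕ.* suc n) (ℕ.m∸n≤m n (size C)) ⟩
    cost s C ℕ.* suc n ℕ.+ n <⟨ ℕ.+-monoʳ-< (cost s C ℕ.* suc n) (ℕ.n<1+n n) ⟩
    cost s C ℕ.* suc n ℕ.+ suc n ≡⟨ ℕ.+-comm (cost s C ℕ.* suc n) (suc n) ⟩
    suc (cost s C) ℕ.* suc n ≤⟨ ℕ.*-monoˡ-≤ (suc n) lt ⟩
    rank s ℕ.* suc n ∎))
    where open ℕ.≤-Reasoning

  -- By submodularity the union of two minimisers is again one, so a minimiser of greatest size
  -- contains all others.
  minimiser-⊆-closed : ∀ s D → cost s D ℕ.≤ rank s → D ⊆ closed s
  minimiser-⊆-closed s D le = size-∪-≤⇒⊆ C D (ℕ.∸-cancelʳ-≤ (size≤n (C ∪ D)) n∸-≤)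
    where
    open ℕ.≤-Reasoning
    C = closed s
    union-cost : cost s (C ∪ D) ℕ.≤ cost s C
    union-cost = ℕ.+-cancelʳ-≤ (cost s (C ∩ D)) _ _ (begin
      cost s (C ∪ D) ℕ.+ cost s (C ∩ D) ≤⟨ cost-submodular (⊑-refl s) C D ⟩
      cost s C ℕ.+ cost s D             ≤⟨ ℕ.+-monoʳ-≤ (cost s C) (ℕ.≤-trans le (rank≤cost s (C ∩ D))) ⟩
      cost s C ℕ.+ cost s (C ∩ D)       ∎)
    n∸-≤ : n ℕ.∸ size C ℕ.≤ n ℕ.∸ size (C ∪ D)
    n∸-≤ = ℕ.+-cancelˡ-≤ (cost s C ℕ.* suc n) _ _ (begin
      lexicographic s C        ≤⟨ proj₂ (argmin (lexicographic s)) (C ∪ D) ⟩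
      lexicographic s (C ∪ D)  ≤⟨ ℕ.+-monoˡ-≤ (n ℕ.∸ size (C ∪ D)) (ℕ.*-monoˡ-≤ (suc n) union-cost) ⟩
      cost s C ℕ.* suc n ℕ.+ (n ℕ.∸ size (C ∪ D)) ∎)

  -- The intersection of the two closed sets costs at least `rank s` for `s`; submodularity turns
  -- this into an upper bound for their union, which is thus a minimiser for `s′`.
  closed-mono : ∀ {s s′} → s ⊑ s′ → closed s ⊆ closed s′
  closed-mono {s} {s′} sub j eq = minimiser-⊆-closed s′ (closed s ∪ closed s′)
    (ℕ.+-cancelʳ-≤ (cost s (closed s ∩ closed s′)) _ _ (begin
      cost s′ (closed s ∪ closed s′) ℕ.+ cost s (closed s ∩ closed s′) ≤⟨ cost-submodular sub (closed s) (closed s′) ⟩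
      rank s ℕ.+ rank s′ ≡⟨ ℕ.+-comm (rank s) (rank s′) ⟩
      rank s′ ℕ.+ rank s ≤⟨ ℕ.+-monoʳ-≤ (rank s′) (rank≤cost s _) ⟩
      rank s′ ℕ.+ cost s (closed s ∩ closed s′) ∎))
    j (∪-⊆ˡ (closed s) (closed s′) j eq)
    where open ℕ.≤-Reasoning

  rank-cong : ∀ s s′ → (∀ C → out s C ≡ out s′ C) → rank s ≡ rank s′
  rank-cong s s′ eq = ℕ.≤-antisym
    (ℕ.≤-trans (rank≤cost s (closed s′)) (ℕ.≤-reflexive (cong (size (closed s′) ℕ.+_) (eq (closed s′)))))
    (ℕ.≤-trans (rank≤cost s′ (closed s)) (ℕ.≤-reflexive (cong (size (closed s) ℕ.+_) (sym (eq (closed s))))))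

  rank-∷-≥ : ∀ e s → rank s ℕ.≤ rank (e ∷ s)
  rank-∷-≥ e s = ℕ.≤-trans (rank≤cost s (closed (e ∷ s)))
    (ℕ.+-monoʳ-≤ (size (closed (e ∷ s))) (ℕ.m≤n+m _ (leaves e (closed (e ∷ s)))))

  cost-∷ : ∀ e s C → cost (e ∷ s) C ≡ leaves e C ℕ.+ cost s C
  cost-∷ e s C = lemma (size C) (leaves e C) (out s C)
    where
    lemma : ∀ a b c → a ℕ.+ (b ℕ.+ c) ≡ b ℕ.+ (a ℕ.+ c)
    lemma = ℕ-solve-∀

  rank-∷-≤ : ∀ e s → rank (e ∷ s) ℕ.≤ leaves e (closed s) ℕ.+ rank s
  rank-∷-≤ e s = ℕ.≤-trans (rank≤cost (e ∷ s) (closed s)) (ℕ.≤-reflexive (cost-∷ e s (closed s)))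

  rank-∷-≤1 : ∀ e s → rank (e ∷ s) ℕ.≤ suc (rank s)
  rank-∷-≤1 e s = ℕ.≤-trans (rank-∷-≤ e s) (ℕ.+-monoˡ-≤ (rank s) (leaves-≤1 e (closed s)))

  -- A set of the same cost as closed s is contained in it, and so does not contain e.
  rank<cost-∷ : ∀ e s C → inside e (closed s) ≡ false → rank s ℕ.< cost (e ∷ s) C
  rank<cost-∷ e s C eq with ℕ.m≤n⇒m<n∨m≡n (rank≤cost s C)
  ... | inj₁ lt = ℕ.≤-trans lt (ℕ.≤-trans (ℕ.m≤n+m _ (leaves e C)) (ℕ.≤-reflexive (sym (cost-∷ e s C))))
  ... | inj₂ eq′ with inside e C in eqC
  ...   | true with () ← trans (sym eq) (inside-mono e {C} {closed s} (minimiser-⊆-closed s C (ℕ.≤-reflexive (sym eq′))) eqC)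
  ...   | false = ℕ.≤-trans (ℕ.≤-reflexive (cong suc eq′)) (ℕ.≤-reflexive (sym (ℕ.+-suc (size C) (out s C))))

  rank-∷ : ∀ e s → leaves e (closed s) ℕ.+ rank s ℕ.≤ rank (e ∷ s)
  rank-∷ e s with inside e (closed s) in eq
  ... | true  = rank-∷-≥ e s
  ... | false = rank<cost-∷ e s (closed (e ∷ s)) eq

  size-closed≤rank : ∀ s → size (closed s) ℕ.≤ rank s
  size-closed≤rank s = ℕ.m≤m+n _ _

  out-++ : ∀ s t C → out (s ++ t) C ≡ out s C ℕ.+ out t C
  out-++ []      t C = refl
  out-++ (e ∷ s) t C = trans (cong (leaves e C ℕ.+_) (out-++ s t C)) (sym (ℕ.+-assoc (leaves e C) _ _))

  rank-shift : ∀ r e s → rank (r ++ e ∷ s) ≡ rank (e ∷ r ++ s)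
  rank-shift r e s = rank-cong (r ++ e ∷ s) (e ∷ r ++ s) λ C → begin
    out (r ++ e ∷ s) C                        ≡⟨ out-++ r (e ∷ s) C ⟩
    out r C ℕ.+ (leaves e C ℕ.+ out s C)      ≡⟨ exchange (out r C) (leaves e C) (out s C) ⟩
    leaves e C ℕ.+ (out r C ℕ.+ out s C)      ≡⟨ cong (leaves e C ℕ.+_) (sym (out-++ r s C)) ⟩
    leaves e C ℕ.+ out (r ++ s) C             ∎
    where
    open ≡-Reasoning
    exchange : ∀ a b c → a ℕ.+ (b ℕ.+ c) ≡ b ℕ.+ (a ℕ.+ c)
    exchange = ℕ-solve-∀

-- Matchings that are maximum at every level

least-failure : ∀ (P : ℕ → Bool) L →
  (∀ l → l ℕ.≤ L → P l ≡ true) ⊎ (∃ λ k → k ℕ.≤ L × P k ≡ false × (∀ l → l ℕ.< k → P l ≡ true))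
least-failure P zero with P 0 in eq
... | true  = inj₁ λ { zero _ → eq }
... | false = inj₂ (0 , ℕ.z≤n , eq , λ _ ())
least-failure P (suc L) with least-failure P L
... | inj₂ (k , k≤L , fails , below) = inj₂ (k , ℕ.m≤n⇒m≤1+n k≤L , fails , below)
... | inj₁ holds with P (suc L) in eq
...   | false = inj₂ (suc L , ℕ.≤-refl , eq , λ l l<k → holds l (ℕ.≤-pred l<k))
...   | true  = inj₁ λ l l≤ → case l≤
  where
  case : ∀ {l} → l ℕ.≤ suc L → P l ≡ true
  case {l} l≤ with ℕ.m≤n⇒m<n∨m≡n l≤
  ... | inj₁ (ℕ.s≤s l≤L) = holds l l≤L
  ... | inj₂ refl        = eq

≤ᵇ-true : ∀ {l m} → (l ℕ.≤ᵇ m) ≡ true → l ℕ.≤ m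
≤ᵇ-true {l} {m} eq = ℕ.≤ᵇ⇒≤ l m (subst T (sym eq) tt)

≤ᵇ-false : ∀ {l m} → (l ℕ.≤ᵇ m) ≡ false → ¬ (l ℕ.≤ m)
≤ᵇ-false eq l≤m = subst T eq (ℕ.≤⇒≤ᵇ l≤m)

module Levels (n : ℕ) {I : Set} (nb : I → List (Fin n)) (lev : I → ℕ) where
  open Rank n

  atLevel : ℕ → I → Hyperedge
  atLevel l i = if l ℕ.≤ᵇ lev i then nb i else []

  hyperedges : ∀ {k} → ℕ → Vec I k → List Hyperedge
  hyperedges l []      = []
  hyperedges l (i ∷ t) = atLevel l i ∷ hyperedges l t

  loops : List J → List Hyperedge
  loops = map (_∷ [])

  matched : ∀ {k} → ℕ → Vec I k → Vec (Maybe J) k → ℕ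
  matched l []      []            = 0
  matched l (i ∷ t) (nothing ∷ M) = matched l t M
  matched l (i ∷ t) (just _  ∷ M) = (if l ℕ.≤ᵇ lev i then 1 else 0) ℕ.+ matched l t M

  hyperedges-⊑ : ∀ {k l l′} → l ℕ.≤ l′ → (t : Vec I k) → hyperedges l′ t ⊑ hyperedges l t
  hyperedges-⊑ l≤l′ []      = []
  hyperedges-⊑ {l = l} {l′} l≤l′ (i ∷ t) with l′ ℕ.≤ᵇ lev i in p | l ℕ.≤ᵇ lev i in q
  ... | true  | true  = keep (nb i) (hyperedges-⊑ l≤l′ t)
  ... | true  | false = ⊥-elim (≤ᵇ-false q (ℕ.≤-trans l≤l′ (≤ᵇ-true p)))
  ... | false | true  = drop (nb i) (hyperedges-⊑ l≤l′ t)
  ... | false | false = keep [] (hyperedges-⊑ l≤l′ t)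

  ++-⊑ : ∀ r {s s′} → s ⊑ s′ → (r ++ s) ⊑ (r ++ s′)
  ++-⊑ []      sub = sub
  ++-⊑ (e ∷ r) sub = keep e (++-⊑ r sub)

  rank-loops : ∀ Y → rank (loops Y ++ []) ℕ.≤ length Y
  rank-loops []      = ℕ.≤-trans (rank≤cost [] (Vec.replicate n false)) (ℕ.≤-reflexive (trans (ℕ.+-identityʳ _) (size-∅ n)))
    where
    size-∅ : ∀ m → size (Vec.replicate m false) ≡ 0
    size-∅ zero    = refl
    size-∅ (suc m) = size-∅ m
  rank-loops (v ∷ Y) = ℕ.≤-trans (rank-∷-≤1 (v ∷ []) (loops Y ++ [])) (ℕ.s≤s (rank-loops Y))

  size-set : ∀ {m} (C : Subset m) v → size (C [ v ]≔ true) ℕ.≤ suc (size C)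
  size-set (true  ∷ C) zero    = ℕ.n≤1+n _
  size-set (false ∷ C) zero    = ℕ.≤-refl
  size-set (true  ∷ C) (suc v) = ℕ.s≤s (size-set C v)
  size-set (false ∷ C) (suc v) = size-set C v

  ⊆-set : ∀ {m} (C : Subset m) v → C ⊆ C [ v ]≔ true
  ⊆-set (b ∷ C) zero    zero    eq = refl
  ⊆-set (b ∷ C) zero    (suc j) eq = eq
  ⊆-set (b ∷ C) (suc v) zero    eq = eq
  ⊆-set (b ∷ C) (suc v) (suc j) eq = ⊆-set C v j eq

  out-antimono : ∀ s {C D} → C ⊆ D → out s D ℕ.≤ out s C
  out-antimono []      sub = ℕ.z≤n
  out-antimono (e ∷ s) {C} {D} sub = ℕ.+-mono-≤ (leaves-antimono e {C} {D} sub) (out-antimono s {C} {D} sub)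

  out-set : ∀ s C v → (v ∷ []) ∈ s → lookup C v ≡ false → suc (out s (C [ v ]≔ true)) ℕ.≤ out s C
  out-set (_ ∷ s) C v (here refl) eq rewrite eq | Vec.lookup∘update v C true =
    ℕ.s≤s (out-antimono s {C} {C [ v ]≔ true} (⊆-set C v))
  out-set (e ∷ s) C v (there p) eq = ℕ.≤-trans (ℕ.≤-reflexive (sym (ℕ.+-suc _ _)))
    (ℕ.+-mono-≤ (leaves-antimono e {C} {C [ v ]≔ true} (⊆-set C v)) (out-set s C v p eq))

  -- Adding `v` to a set costs one for the size and saves the loop at `v`, so the largest minimiser
  -- contains `v`. Hence a vertex outside the closed set is automatically outside `Y` in `matching`.
  loop⇒closed : ∀ s v → (v ∷ []) ∈ s → lookup (closed s) v ≡ true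
  loop⇒closed s v p with lookup (closed s) v in eq
  ... | true  = refl
  ... | false = trans (sym eq) (minimiser-⊆-closed s (closed s [ v ]≔ true) (begin
    size (closed s [ v ]≔ true) ℕ.+ out s (closed s [ v ]≔ true)  ≤⟨ ℕ.+-monoˡ-≤ _ (size-set (closed s) v) ⟩
    suc (size (closed s)) ℕ.+ out s (closed s [ v ]≔ true)        ≡⟨ ℕ.+-suc (size (closed s)) _ ⟨
    size (closed s) ℕ.+ suc (out s (closed s [ v ]≔ true))        ≤⟨ ℕ.+-monoʳ-≤ (size (closed s)) (out-set s (closed s) v p eq) ⟩
    rank s ∎) v (Vec.lookup∘update v (closed s) true))
    where open ℕ.≤-Reasoning

  -- `Y` lists the offline vertices already given to vertices ahead of `t`. As loops they occupy
  -- their places in the rank, so `maximum` speaks about what `t` can add; for empty `Y` it is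
  -- maximality at every level.
  record Matching {k} (t : Vec I k) (Y : List J) : Set where
    field
      partner   : Vec (Maybe J) k
      edges     : ∀ a j → lookup partner a ≡ just j → j ∈ nb (lookup t a)
      injective : ∀ a b j → lookup partner a ≡ just j → lookup partner b ≡ just j → a ≡ b
      avoids    : ∀ a j → lookup partner a ≡ just j → ¬ (j ∈ Y)
      maximum   : ∀ l → rank (loops Y ++ hyperedges l t) ℕ.≤ length Y ℕ.+ matched l t partner

  outside-vertex : ∀ e C → inside e C ≡ false → ∃ λ v → v ∈ e × lookup C v ≡ false
  outside-vertex (j ∷ e) C eq with lookup C j in Cj
  ... | false = j , here refl , Cj
  ... | true  with outside-vertex e C eq
  ...   | v , v∈e , Cv = v , there v∈e , Cv

  leaves-inside : ∀ e C → inside e C ≡ true → leaves e C ≡ 0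
  leaves-inside e C eq rewrite eq = refl

  rank-∷-inside : ∀ e s → inside e (closed s) ≡ true → rank (e ∷ s) ℕ.≤ rank s
  rank-∷-inside e s eq = ℕ.≤-trans (rank-∷-≤ e s) (ℕ.≤-reflexive (cong (ℕ._+ rank s) (leaves-inside e (closed s) eq)))

  rank-loop : ∀ v s → lookup (closed s) v ≡ false → suc (rank s) ℕ.≤ rank ((v ∷ []) ∷ s)
  rank-loop v s eq = rank<cost-∷ (v ∷ []) s (closed ((v ∷ []) ∷ s)) (cong (_∧ true) eq)

  -- A new vertex i is matched only if this increases the rank at some level; if k is
  -- the least such level, any neighbour of i outside the closed set of level k lies
  -- outside the closed sets of all higher levels, which are smaller.
  matching : ∀ {k} (t : Vec I k) (Y : List J) → Matching t Y
  matching [] Y = record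
    { partner = [] ; edges = λ () ; injective = λ () ; avoids = λ ()
    ; maximum = λ l → ℕ.≤-trans (rank-loops Y) (ℕ.≤-reflexive (sym (ℕ.+-identityʳ _))) }
  matching (i ∷ t) Y with least-failure (λ l → inside (nb i) (closed (loops Y ++ hyperedges l t))) (lev i)
  ... | inj₁ holds = record
    { partner   = nothing ∷ partner
    ; edges     = λ { (suc a) → edges a }
    ; injective = λ { (suc a) (suc b) j p q → cong suc (injective a b j p q) }
    ; avoids    = λ { (suc a) → avoids a }
    ; maximum   = λ l → ℕ.≤-trans (skip l) (maximum l)
    }
    where
    open Matching (matching t Y)
    skip : ∀ l → rank (loops Y ++ hyperedges l (i ∷ t)) ℕ.≤ rank (loops Y ++ hyperedges l t)
    skip l = ℕ.≤-trans (ℕ.≤-reflexive (rank-shift (loops Y) (atLevel l i) (hyperedges l t)))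
                       (rank-∷-inside (atLevel l i) (loops Y ++ hyperedges l t) (in-closed l))
      where
      in-closed : ∀ l → inside (atLevel l i) (closed (loops Y ++ hyperedges l t)) ≡ true
      in-closed l with l ℕ.≤ᵇ lev i in eq
      ... | true  = holds l (≤ᵇ-true eq)
      ... | false = refl
  ... | inj₂ (k , k≤ , fails , below) with outside-vertex (nb i) (closed (loops Y ++ hyperedges k t)) fails
  ...   | v , v∈nb , outside = record
    { partner   = just v ∷ partner
    ; edges     = λ { zero j refl → v∈nb ; (suc a) → edges a }
    ; injective = inj
    ; avoids    = λ { zero j refl v∈Y → v∉Y v∈Y ; (suc a) j p j∈Y → avoids a j p (there j∈Y) }
    ; maximum   = λ l → ℕ.≤-trans (ℕ.≤-reflexive (rank-shift (loops Y) (atLevel l i) (hyperedges l t))) (extend l)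
    }
    where
    open Matching (matching t (v ∷ Y))
    open ℕ.≤-Reasoning
    inj : ∀ a b j → lookup (just v ∷ partner) a ≡ just j → lookup (just v ∷ partner) b ≡ just j → a ≡ b
    inj zero    zero    j p q = refl
    inj zero    (suc b) j refl q = ⊥-elim (avoids b v q (here refl))
    inj (suc a) zero    j p refl = ⊥-elim (avoids a v p (here refl))
    inj (suc a) (suc b) j p q = cong suc (injective a b j p q)
    true≢false : ¬ (true ≡ false)
    true≢false ()
    v∉Y : ¬ (v ∈ Y)
    v∉Y v∈Y = true≢false (trans (sym (loop⇒closed (loops Y ++ hyperedges k t) v (∈.∈-++⁺ˡ (∈.∈-map⁺ (_∷ []) v∈Y)))) outside)
    S : ℕ → List Hyperedge
    S l = loops Y ++ hyperedges l t
    v∉closed : ∀ l → k ℕ.≤ l → lookup (closed (S l)) v ≡ false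
    v∉closed l k≤l with lookup (closed (S l)) v in eq
    ... | false = refl
    ... | true  = ⊥-elim (true≢false (trans (sym (closed-mono (++-⊑ (loops Y) (hyperedges-⊑ k≤l t)) v eq)) outside))
    add : ∀ l → l ℕ.≤ lev i → rank (nb i ∷ S l) ℕ.≤ rank ((v ∷ []) ∷ S l)
    add l l≤ with k ℕ.≤? l
    -- From level `k` on, `v` is outside the closed set, so its loop alone brings the full unit that
    -- `nb i` could add.
    ... | yes k≤l = ℕ.≤-trans (rank-∷-≤1 (nb i) (S l)) (rank-loop v (S l) (v∉closed l k≤l))
    ... | no  k≰l = ℕ.≤-trans (rank-∷-inside (nb i) (S l) (below l (ℕ.≰⇒> k≰l))) (rank-∷-≥ (v ∷ []) (S l))
    extend : ∀ l → rank (atLevel l i ∷ S l) ℕ.≤ length Y ℕ.+ matched l (i ∷ t) (just v ∷ partner)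
    extend l with l ℕ.≤ᵇ lev i in eq
    ... | true = begin
      rank (nb i ∷ S l)                        ≤⟨ add l (≤ᵇ-true eq) ⟩
      rank ((v ∷ []) ∷ S l)                    ≤⟨ maximum l ⟩
      suc (length Y ℕ.+ matched l t partner)   ≡⟨ ℕ.+-suc (length Y) _ ⟨
      length Y ℕ.+ suc (matched l t partner)   ∎
    -- At levels above that of `i` the new pair does not count in `matched`, while `v ∷ Y` is longer
    -- by one; the loop at `v` raises the rank there too, and the two units cancel.
    ... | false = ℕ.≤-pred (begin
      suc (rank ([] ∷ S l))                    ≤⟨ ℕ.s≤s (rank-∷-inside [] (S l) refl) ⟩
      suc (rank (S l))                         ≤⟨ rank-loop v (S l) (v∉closed l (ℕ.≤-trans k≤ (ℕ.<⇒≤ (ℕ.≰⇒> (≤ᵇ-false eq))))) ⟩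
      rank ((v ∷ []) ∷ S l)                    ≤⟨ maximum l ⟩
      suc (length Y ℕ.+ matched l t partner)   ∎)

-- Variance of a function with bounded differences

square-mono : ∀ {p c} → p ≤ c → - c ≤ p → p * p ≤ c * c
square-mono {p} {c} p≤c -c≤p = ≤-by ((c - p) * (p - - c)) (0≤* (p≤q⇒0≤q-p p≤c) (p≤q⇒0≤q-p -c≤p)) (lemma p c)
  where
  lemma : ∀ p c → p * p + (c - p) * (p - - c) ≡ c * c
  lemma = solve-∀ ℚ-ring

-- Splits a mean square into variance and squared bias; the cross term vanishes because the
-- deviation from the mean has mean zero.
E-square-shift : ∀ (M : Mean A) f c →
  E M (λ x → (f x - c) * (f x - c)) ≡ E M (λ x → (f x - E M f) * (f x - E M f)) + (E M f - c) * (E M f - c)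
E-square-shift M f c = begin
  E M (λ x → (f x - c) * (f x - c))
    ≡⟨ E-cong M (λ x → expand (f x) c μ) ⟩
  E M (λ x → (f x - μ) * (f x - μ) + ((μ - c) * (μ - c) + twice (μ - c) * (f x - μ)))
    ≡⟨ E-+ M _ _ ⟩
  V + E M (λ x → (μ - c) * (μ - c) + twice (μ - c) * (f x - μ))
    ≡⟨ +-congˡ V (E-+ M _ _) ⟩
  V + (E M (λ x → (μ - c) * (μ - c)) + E M (λ x → twice (μ - c) * (f x - μ)))
    ≡⟨ +-congˡ V (cong₂ _+_ (E-const M _) (trans (E-* M (twice (μ - c)) _) (*-congˡ (twice (μ - c)) centred))) ⟩
  V + ((μ - c) * (μ - c) + twice (μ - c) * 0ℚ)
    ≡⟨ +-congˡ V (trans (+-congˡ ((μ - c) * (μ - c)) (ℚ.*-zeroʳ (twice (μ - c)))) (ℚ.+-identityʳ _)) ⟩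
  V + (μ - c) * (μ - c) ∎
  where
  open ≡-Reasoning
  μ V : ℚ
  μ = E M f
  V = E M (λ x → (f x - μ) * (f x - μ))
  twice : ℚ → ℚ
  twice p = p + p
  centred : E M (λ x → f x - μ) ≡ 0ℚ
  centred = trans (E-minus M f (const μ)) (trans (cong (λ z → μ - z) (E-const M μ)) (p-p≡0 μ))
  expand : ∀ p c μ → (p - c) * (p - c) ≡ (p - μ) * (p - μ) + ((μ - c) * (μ - c) + ((μ - c) + (μ - c)) * (p - μ))
  expand = solve-∀ ℚ-ring

-- Since `x` and `y` may be exchanged, the one-sided inequality bounds the absolute difference.
BoundedDifferences : ℚ → (List A → ℚ) → Set
BoundedDifferences c f = ∀ r x y s → f (r ++ x ∷ s) - f (r ++ y ∷ s) ≤ c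

-- Efron–Stein with a crude constant: the coordinates are integrated out one after the other.
variance-≤ : ∀ (Ms : List (Mean A)) {c f} → BoundedDifferences c f →
  E (sequence Ms) (λ s → (f s - E (sequence Ms) f) * (f s - E (sequence Ms) f)) ≤ fromℕ (length Ms) * (c * c)
variance-≤ [] {c} {f} bd = ℚ.≤-reflexive (begin
  E (sequence []) (λ s → (f s - μ) * (f s - μ))  ≡⟨ E-pointMean [] (λ s → (f s - μ) * (f s - μ)) ⟩
  (f [] - μ) * (f [] - μ)                        ≡⟨ cong (λ z → (f [] - z) * (f [] - z)) (E-pointMean [] f) ⟩
  (f [] - f []) * (f [] - f [])                  ≡⟨ lemma (f []) (c * c) ⟩
  0ℚ * (c * c)                                   ∎)
  where
  open ≡-Reasoning
  μ = E (sequence []) f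
  lemma : ∀ p q → (p - p) * (p - p) ≡ 0ℚ * q
  lemma = solve-∀ ℚ-ring
variance-≤ (M ∷ Ms) {c} {f} bd = begin
  E (sequence (M ∷ Ms)) (λ s → (f s - μ) * (f s - μ))
    ≡⟨ E-sequence M Ms _ ⟩
  E M (λ x → E N (λ s → (f (x ∷ s) - μ) * (f (x ∷ s) - μ)))
    ≡⟨ E-cong M (λ x → E-square-shift N (λ s → f (x ∷ s)) μ) ⟩
  E M (λ x → E N (λ s → (f (x ∷ s) - F x) * (f (x ∷ s) - F x)) + (F x - μ) * (F x - μ))
    -- Induction treats the remaining coordinates; their average `F x` still varies by at most `c`
    -- in `x`, so it stays within `c` of its own mean.
    ≤⟨ E-mono M (λ x → ℚ.+-mono-≤ (variance-≤ Ms {c} {λ s → f (x ∷ s)} (λ r y z s → bd (x ∷ r) y z s)) (square-mono (upper x) (lower x))) ⟩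
  E M (λ x → fromℕ (length Ms) * (c * c) + c * c)
    ≡⟨ E-const M _ ⟩
  fromℕ (length Ms) * (c * c) + c * c
    ≡⟨ lemma (fromℕ (length Ms)) (c * c) ⟩
  (1ℚ + fromℕ (length Ms)) * (c * c) ∎
  where
  open ℚ.≤-Reasoning
  N = sequence Ms
  μ = E (sequence (M ∷ Ms)) f
  F : _ → ℚ
  F x = E N (λ s → f (x ∷ s))
  μ≡ : μ ≡ E M F
  μ≡ = E-sequence M Ms f
  F-diff : ∀ x y → F x - F y ≤ c
  F-diff x y = subst (_≤ c) (E-minus N _ _) (E-≤-const N c (λ s → bd [] x y s))
  upper : ∀ x → F x - μ ≤ c
  upper x = begin
    F x - μ                  ≡⟨ cong₂ _-_ (sym (E-const M (F x))) μ≡ ⟩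
    E M (const (F x)) - E M F ≡⟨ E-minus M _ _ ⟨
    E M (λ y → F x - F y)    ≤⟨ E-≤-const M c (F-diff x) ⟩
    c                        ∎
  lower : ∀ x → - c ≤ F x - μ
  lower x = ≤-by (c - (μ - F x)) (p≤q⇒0≤q-p (begin
    μ - F x                   ≡⟨ cong₂ _-_ μ≡ (sym (E-const M (F x))) ⟩
    E M F - E M (const (F x)) ≡⟨ E-minus M _ _ ⟨
    E M (λ y → F y - F x)     ≤⟨ E-≤-const M c (λ y → F-diff y x) ⟩
    c                         ∎)) (flip c μ (F x))
    where
    flip : ∀ c μ y → - c + (c - (μ - y)) ≡ y - μ
    flip = solve-∀ ℚ-ring
  lemma : ∀ k d → k * d + d ≡ (1ℚ + k) * d
  lemma = solve-∀ ℚ-ring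

Symmetric : (List A → ℚ) → Set
Symmetric f = ∀ r x y s → f (r ++ x ∷ y ∷ s) ≡ f (r ++ y ∷ x ∷ s)

-- Adjacent independent draws are exchanged one at a time. This lets a fresh arrival be placed
-- behind the loops although lists grow at the front.
E-sequence-shift : ∀ (M : Mean A) Ns Ps {f} → Symmetric f →
  E (sequence (M ∷ Ns ++ Ps)) f ≡ E (sequence (Ns ++ M ∷ Ps)) f
E-sequence-shift M []       Ps sy = refl
E-sequence-shift M (N ∷ Ns) Ps {f} sy = begin
  E (sequence (M ∷ N ∷ Ns ++ Ps)) f
    ≡⟨ trans (E-sequence M (N ∷ Ns ++ Ps) f) (E-cong M (λ x → E-sequence N (Ns ++ Ps) (λ s → f (x ∷ s)))) ⟩
  E M (λ x → E N (λ y → E (sequence (Ns ++ Ps)) (λ s → f (x ∷ y ∷ s))))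
    ≡⟨ E-swap M N _ ⟩
  E N (λ y → E M (λ x → E (sequence (Ns ++ Ps)) (λ s → f (x ∷ y ∷ s))))
    ≡⟨ E-cong N (λ y → E-cong M (λ x → E-cong (sequence (Ns ++ Ps)) (λ s → sy [] x y s))) ⟩
  E N (λ y → E M (λ x → E (sequence (Ns ++ Ps)) (λ s → f (y ∷ x ∷ s))))
    ≡⟨ E-cong N (λ y → sym (E-sequence M (Ns ++ Ps) (λ s → f (y ∷ s)))) ⟩
  E N (λ y → E (sequence (M ∷ Ns ++ Ps)) (λ s → f (y ∷ s)))
    ≡⟨ E-cong N (λ y → E-sequence-shift M Ns Ps (λ r → sy (y ∷ r))) ⟩
  E N (λ y → E (sequence (Ns ++ M ∷ Ps)) (λ s → f (y ∷ s)))
    ≡⟨ E-sequence N (Ns ++ M ∷ Ps) f ⟨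
  E (sequence (N ∷ Ns ++ M ∷ Ps)) f ∎
  where open ≡-Reasoning

infixr 8 _^_
_^_ : ℚ → ℕ → ℚ
p ^ zero  = 1ℚ
p ^ suc k = p * p ^ k

0≤^ : ∀ {p} → 0ℚ ≤ p → ∀ k → 0ℚ ≤ p ^ k
0≤^ 0≤p zero    = 0≤1
0≤^ 0≤p (suc k) = 0≤* 0≤p (0≤^ 0≤p k)

-- Growth of the rank under random hyperedges

-- The probability that an arrival leaves a set missing a fraction `h` of the vertices, if it is a
-- loop with probability `a` and three independent uniform vertices with probability `b`.
cubic-gain : ℚ → ℚ → ℚ → ℚ
cubic-gain a b h = a * h + b * (1ℚ - (1ℚ - h) * (1ℚ - h) * (1ℚ - h))

module _ {a b} (0≤a : 0ℚ ≤ a) (0≤b : 0ℚ ≤ b) where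

  gain-mono : ∀ {h k} → h ≤ k → k ≤ 1ℚ → cubic-gain a b h ≤ cubic-gain a b k
  gain-mono {h} {k} h≤k k≤1 = ≤-by
    ((k - h) * (a + b * ((1ℚ - h) * (1ℚ - h) + (1ℚ - h) * (1ℚ - k) + (1ℚ - k) * (1ℚ - k))))
    (0≤* (p≤q⇒0≤q-p h≤k) (0≤+ 0≤a (0≤* 0≤b (0≤+ (0≤+ (0≤square (1ℚ - h)) (0≤* 0≤1-h 0≤1-k)) (0≤square (1ℚ - k))))))
    (lemma a b h k)
    where
    0≤1-k = p≤q⇒0≤q-p k≤1
    0≤1-h = p≤q⇒0≤q-p (ℚ.≤-trans h≤k k≤1)
    lemma : ∀ a b h k → (a * h + b * (1ℚ - (1ℚ - h) * (1ℚ - h) * (1ℚ - h))) +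
      (k - h) * (a + b * ((1ℚ - h) * (1ℚ - h) + (1ℚ - h) * (1ℚ - k) + (1ℚ - k) * (1ℚ - k)))
      ≡ a * k + b * (1ℚ - (1ℚ - k) * (1ℚ - k) * (1ℚ - k))
    lemma = solve-∀ ℚ-ring

  gain-slope : ℚ → ℚ
  gain-slope k = a + b * ((1ℚ + 1ℚ + 1ℚ) * ((1ℚ - k) * (1ℚ - k)))

  gain-≤-tangent : ∀ h k → h ≤ 1ℚ → k ≤ 1ℚ → cubic-gain a b h ≤ cubic-gain a b k + gain-slope k * (h - k)
  gain-≤-tangent h k h≤1 k≤1 = ≤-by
    -- With x = 1 - h and y = 1 - k this is x³ - y³ - 3y²(x - y) = (x - y)²(x + 2y).
    (b * ((h - k) * (h - k) * ((1ℚ - h) + (1ℚ + 1ℚ) * (1ℚ - k))))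
    (0≤* 0≤b (0≤* (0≤square (h - k)) (0≤+ (p≤q⇒0≤q-p h≤1) (0≤* (0≤+ 0≤1 0≤1) (p≤q⇒0≤q-p k≤1)))))
    (lemma a b h k)
    where
    lemma : ∀ a b h k → (a * h + b * (1ℚ - (1ℚ - h) * (1ℚ - h) * (1ℚ - h))) +
      b * ((h - k) * (h - k) * ((1ℚ - h) + (1ℚ + 1ℚ) * (1ℚ - k)))
      ≡ (a * k + b * (1ℚ - (1ℚ - k) * (1ℚ - k) * (1ℚ - k))) + (a + b * ((1ℚ + 1ℚ + 1ℚ) * ((1ℚ - k) * (1ℚ - k)))) * (h - k)
    lemma = solve-∀ ℚ-ring

  -- The second derivative of the gain is at least -6b for nonnegative arguments, whence the
  -- constant 3b. This is the price for replacing a random slope by its mean.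
  gain-≥-tangent : ∀ h k → 0ℚ ≤ h → 0ℚ ≤ k →
    cubic-gain a b k + gain-slope k * (h - k) ≤ cubic-gain a b h + (b + b + b) * ((h - k) * (h - k))
  gain-≥-tangent h k 0≤h 0≤k = ≤-by
    (b * ((h - k) * (h - k) * (h + (1ℚ + 1ℚ) * k)))
    (0≤* 0≤b (0≤* (0≤square (h - k)) (0≤+ 0≤h (0≤* (0≤+ 0≤1 0≤1) 0≤k))))
    (lemma a b h k)
    where
    lemma : ∀ a b h k → (a * k + b * (1ℚ - (1ℚ - k) * (1ℚ - k) * (1ℚ - k))) + (a + b * ((1ℚ + 1ℚ + 1ℚ) * ((1ℚ - k) * (1ℚ - k)))) * (h - k)
      + b * ((h - k) * (h - k) * (h + (1ℚ + 1ℚ) * k))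
      ≡ (a * h + b * (1ℚ - (1ℚ - h) * (1ℚ - h) * (1ℚ - h))) + (b + b + b) * ((h - k) * (h - k))
    lemma = solve-∀ ℚ-ring

module Process (n : ℕ) {{_ : NonZero n}} where
  open Rank n

  coverage : Subset n → ℚ
  coverage C = fromℕ (size C) * (+ 1 / n)

  rankℚ : List Hyperedge → ℚ
  rankℚ s = fromℕ (rank s)

  0≤1/n : 0ℚ ≤ + 1 / n
  0≤1/n = ℚ.nonNegative⁻¹ (+ 1 / n) {{ℚ.normalize-nonNeg 1 n}}

  coverage≤1 : ∀ C → coverage C ≤ 1ℚ
  coverage≤1 C = subst (coverage C ≤_) (*-inverse-fromℕ n) (*-monoʳ 0≤1/n (fromℕ-mono (size≤n C)))

  0≤coverage : ∀ C → 0ℚ ≤ coverage C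
  0≤coverage C = 0≤* (0≤fromℕ (size C)) 0≤1/n

  rankℚ-∷ : ∀ e s → fromℕ (leaves e (closed s)) + rankℚ s ≤ rankℚ (e ∷ s)
  rankℚ-∷ e s = subst (_≤ rankℚ (e ∷ s)) (fromℕ-+ (leaves e (closed s)) (rank s)) (fromℕ-mono (rank-∷ e s))

  rank-symmetric : Symmetric rankℚ
  rank-symmetric r x y s = cong fromℕ (trans (rank-shift r x (y ∷ s))
    (rank-cong (x ∷ r ++ y ∷ s) (r ++ y ∷ x ∷ s) λ C → sym (trans (out-++ r (y ∷ x ∷ s) C)
      (trans (lemma (out r C) (leaves y C) (leaves x C) (out s C)) (cong (leaves x C ℕ.+_) (sym (out-++ r (y ∷ s) C)))))))
    where
    lemma : ∀ a b c d → a ℕ.+ (b ℕ.+ (c ℕ.+ d)) ≡ c ℕ.+ (a ℕ.+ (b ℕ.+ d))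
    lemma = ℕ-solve-∀

  rank-insert-≥ : ∀ r x s → rankℚ (r ++ s) ≤ rankℚ (r ++ x ∷ s)
  rank-insert-≥ r x s = fromℕ-mono (ℕ.≤-trans (rank-∷-≥ x (r ++ s)) (ℕ.≤-reflexive (sym (rank-shift r x s))))

  rank-insert-≤ : ∀ r x s → rankℚ (r ++ x ∷ s) ≤ 1ℚ + rankℚ (r ++ s)
  rank-insert-≤ r x s = fromℕ-mono (ℕ.≤-trans (ℕ.≤-reflexive (rank-shift r x s)) (rank-∷-≤1 x (r ++ s)))

  deficiency : List Hyperedge → ℚ
  deficiency s = fromℕ n - rankℚ s

  -- closed s has at most rank s elements, so hyperedges leaving it are not rare while the deficiency is large.
  deficiency-decay : ∀ (M : Mean Hyperedge) {p} → 0ℚ ≤ p → p * (+ 1 / n) ≤ 1ℚ →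
    (∀ C → p * (1ℚ - coverage C) ≤ E M (λ e → fromℕ (leaves e C))) →
    ∀ k → E (sequence (replicate k M)) deficiency ≤ fromℕ n * (1ℚ - p * (+ 1 / n)) ^ k
  deficiency-decay M {p} 0≤p p/n≤1 hits zero = begin
    E (sequence []) deficiency ≡⟨ E-pointMean [] deficiency ⟩
    fromℕ n - rankℚ []         ≤⟨ ≤-by (rankℚ []) (0≤fromℕ (rank [])) (lemma (fromℕ n) (rankℚ [])) ⟩
    fromℕ n * 1ℚ               ∎
    where
    open ℚ.≤-Reasoning
    lemma : ∀ n r → (n - r) + r ≡ n * 1ℚ
    lemma = solve-∀ ℚ-ring
  deficiency-decay M {p} 0≤p p/n≤1 hits (suc k) = begin
    E (sequence (M ∷ Ms)) deficiency
      ≡⟨ E-sequence M Ms deficiency ⟩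
    E M (λ e → E (sequence Ms) (λ s → deficiency (e ∷ s)))
      ≡⟨ E-swap M (sequence Ms) _ ⟩
    E (sequence Ms) (λ s → E M (λ e → deficiency (e ∷ s)))
      ≤⟨ E-mono (sequence Ms) step ⟩
    E (sequence Ms) (λ s → q * deficiency s)
      ≡⟨ E-* (sequence Ms) q deficiency ⟩
    q * E (sequence Ms) deficiency
      ≤⟨ *-monoˡ (p≤q⇒0≤q-p p/n≤1) (deficiency-decay M 0≤p p/n≤1 hits k) ⟩
    q * (fromℕ n * q ^ k)
      ≡⟨ comm q (fromℕ n) (q ^ k) ⟩
    fromℕ n * (q * q ^ k) ∎
    where
    open ℚ.≤-Reasoning
    Ms = replicate k M
    1/n = + 1 / n
    q = 1ℚ - p * 1/n
    comm : ∀ q n r → q * (n * r) ≡ n * (q * r)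
    comm = solve-∀ ℚ-ring
    step : ∀ s → E M (λ e → deficiency (e ∷ s)) ≤ q * deficiency s
    step s = begin
      E M (λ e → fromℕ n - rankℚ (e ∷ s))
        ≤⟨ E-mono M (λ e → ℚ.+-monoʳ-≤ (fromℕ n) (ℚ.neg-antimono-≤ (rankℚ-∷ e s))) ⟩
      E M (λ e → fromℕ n - (fromℕ (leaves e C) + rankℚ s))
        ≡⟨ trans (E-minus M _ _) (cong₂ _-_ (E-const M (fromℕ n)) (trans (E-+ M (λ e → fromℕ (leaves e C)) (const (rankℚ s))) (+-congˡ (E M (λ e → fromℕ (leaves e C))) (E-const M (rankℚ s))))) ⟩
      fromℕ n - (E M (λ e → fromℕ (leaves e C)) + rankℚ s)
        ≤⟨ ℚ.+-monoʳ-≤ (fromℕ n) (ℚ.neg-antimono-≤ (ℚ.+-monoˡ-≤ (rankℚ s) (hits C))) ⟩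
      fromℕ n - (p * (1ℚ - coverage C) + rankℚ s)
        ≤⟨ ℚ.+-monoʳ-≤ (fromℕ n) (ℚ.neg-antimono-≤ (ℚ.+-monoˡ-≤ (rankℚ s) (*-monoˡ 0≤p
             (ℚ.+-monoʳ-≤ 1ℚ (ℚ.neg-antimono-≤ (*-monoʳ 0≤1/n (fromℕ-mono (size-closed≤rank s)))))))) ⟩
      fromℕ n - (p * (1ℚ - rankℚ s * 1/n) + rankℚ s)
        ≡⟨ cong (λ z → fromℕ n - (p * (z - rankℚ s * 1/n) + rankℚ s)) (sym (*-inverse-fromℕ n)) ⟩
      fromℕ n - (p * (fromℕ n * 1/n - rankℚ s * 1/n) + rankℚ s)
        ≡⟨ lemma (fromℕ n) p 1/n (rankℚ s) ⟩
      (1ℚ - p * 1/n) * (fromℕ n - rankℚ s) ∎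
      where
      C = closed s
      lemma : ∀ n p i r → n - (p * (n * i - r * i) + r) ≡ (1ℚ - p * i) * (n - r)
      lemma = solve-∀ ℚ-ring

-- Difference quotients of the rank over a window of random loops

module Window (n : ℕ) {{_ : NonZero n}} where
  open Rank n
  open Process n

  module Draws (U V : Mean (List (Fin n))) {a b : ℚ} (0≤a : 0ℚ ≤ a) (0≤b : 0ℚ ≤ b)
    (hits-U : ∀ C → E U (λ e → fromℕ (leaves e C)) ≡ 1ℚ - coverage C)
    (hits-V : ∀ C → cubic-gain a b (1ℚ - coverage C) ≤ E V (λ e → fromℕ (leaves e C)))
    where

    means : ℕ → ℕ → List (Mean Hyperedge)
    means ℓ m = replicate ℓ U ++ replicate m V

    meanRank : ℕ → ℕ → ℚ
    meanRank ℓ m = E (sequence (means ℓ m)) rankℚ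

    meanRank-suc : ∀ ℓ m → E (sequence (means ℓ m)) (λ s → E V (λ e → rankℚ (e ∷ s))) ≡ meanRank ℓ (suc m)
    meanRank-suc ℓ m = begin
      E (sequence (means ℓ m)) (λ s → E V (λ e → rankℚ (e ∷ s))) ≡⟨ E-swap (sequence (means ℓ m)) V _ ⟩
      E V (λ e → E (sequence (means ℓ m)) (λ s → rankℚ (e ∷ s))) ≡⟨ E-sequence V (means ℓ m) rankℚ ⟨
      E (sequence (V ∷ means ℓ m)) rankℚ                         ≡⟨ E-sequence-shift V (replicate ℓ U) (replicate m V) rank-symmetric ⟩
      meanRank ℓ (suc m)                                         ∎
      where open ≡-Reasoning

    meanRank-mono : ∀ ℓ m → meanRank ℓ m ≤ meanRank ℓ (suc m)
    meanRank-mono ℓ m = subst (meanRank ℓ m ≤_) (meanRank-suc ℓ m)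
      (E-mono (sequence (means ℓ m)) (λ s → E-≥-const V (rankℚ s) (λ e → rank-insert-≥ [] e s)))

    mean-out : ∀ w C → E (sequence (replicate w U)) (λ L → fromℕ (out L C)) ≡ fromℕ w * (1ℚ - coverage C)
    mean-out zero    C = trans (E-pointMean {A = List Hyperedge} [] (λ L → fromℕ (out L C))) (sym (ℚ.*-zeroˡ (1ℚ - coverage C)))
    mean-out (suc w) C = begin
      E (sequence (U ∷ Us)) (λ L → fromℕ (out L C))
        ≡⟨ E-sequence U Us _ ⟩
      E U (λ e → E (sequence Us) (λ L → fromℕ (leaves e C ℕ.+ out L C)))
        ≡⟨ E-cong U (λ e → trans (E-cong (sequence Us) (λ L → fromℕ-+ (leaves e C) (out L C)))
             (trans (E-+ (sequence Us) (const (fromℕ (leaves e C))) (λ L → fromℕ (out L C)))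
               (cong₂ _+_ (E-const (sequence Us) (fromℕ (leaves e C))) (mean-out w C)))) ⟩
      E U (λ e → fromℕ (leaves e C) + fromℕ w * η)
        ≡⟨ trans (E-+ U (λ e → fromℕ (leaves e C)) (const (fromℕ w * η))) (cong₂ _+_ (hits-U C) (E-const U (fromℕ w * η))) ⟩
      η + fromℕ w * η
        ≡⟨ lemma η (fromℕ w) ⟩
      (1ℚ + fromℕ w) * η ∎
      where
      open ≡-Reasoning
      Us = replicate w U
      η = 1ℚ - coverage C
      lemma : ∀ h k → h + k * h ≡ (1ℚ + k) * h
      lemma = solve-∀ ℚ-ring

    module Slopes (w : ℕ) {{_ : NonZero w}} where

      1/w : ℚ
      1/w = + 1 / w

      0≤1/w : 0ℚ ≤ 1/w
      0≤1/w = ℚ.nonNegative⁻¹ 1/w {{ℚ.normalize-nonNeg 1 w}}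

      windowRank : List Hyperedge → ℚ
      windowRank s = E (sequence (replicate w U)) (λ L → rankℚ (L ++ s))

      slope : List Hyperedge → ℚ
      slope s = (windowRank s - rankℚ s) * 1/w

      rank≤rank-++ : ∀ L s → rankℚ s ≤ rankℚ (L ++ s)
      rank≤rank-++ []      s = ℚ.≤-refl
      rank≤rank-++ (e ∷ L) s = ℚ.≤-trans (rank≤rank-++ L s) (rank-insert-≥ [] e (L ++ s))

      0≤slope : ∀ s → 0ℚ ≤ slope s
      0≤slope s = 0≤* (p≤q⇒0≤q-p (E-≥-const (sequence (replicate w U)) (rankℚ s) (λ L → rank≤rank-++ L s))) 0≤1/w

      -- The set `closed s` remains a candidate after the loops are added; it then costs `rank s`
      -- plus the number of loops that leave it, whose mean is known.
      slope≤ : ∀ s → slope s ≤ 1ℚ - coverage (closed s)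
      slope≤ s = begin
        (windowRank s - rankℚ s) * 1/w
          ≤⟨ *-monoʳ 0≤1/w (ℚ.+-monoˡ-≤ (- rankℚ s) bound) ⟩
        ((rankℚ s + fromℕ w * η) - rankℚ s) * 1/w
          ≡⟨ lemma (rankℚ s) (fromℕ w) η 1/w ⟩
        (fromℕ w * 1/w) * η
          ≡⟨ trans (cong (_* η) (*-inverse-fromℕ w)) (ℚ.*-identityˡ η) ⟩
        η ∎
        where
        open ℚ.≤-Reasoning
        C = closed s
        η = 1ℚ - coverage C
        lemma : ∀ r w h i → ((r + w * h) - r) * i ≡ (w * i) * h
        lemma = solve-∀ ℚ-ring
        pointwise : ∀ L → rankℚ (L ++ s) ≤ rankℚ s + fromℕ (out L C)
        pointwise L = subst (rankℚ (L ++ s) ≤_) (fromℕ-+ (rank s) (out L C)) (fromℕ-mono (ℕ.≤-trans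
          (rank≤cost (L ++ s) C) (ℕ.≤-reflexive (trans (cong (size C ℕ.+_) (out-++ L s C)) (rearrange (size C) (out L C) (out s C))))))
          where
          rearrange : ∀ a b c → a ℕ.+ (b ℕ.+ c) ≡ (a ℕ.+ c) ℕ.+ b
          rearrange = ℕ-solve-∀
        bound : windowRank s ≤ rankℚ s + fromℕ w * η
        bound = begin
          windowRank s
            ≤⟨ E-mono (sequence (replicate w U)) pointwise ⟩
          E (sequence (replicate w U)) (λ L → rankℚ s + fromℕ (out L C))
            ≡⟨ E-+ (sequence (replicate w U)) (const (rankℚ s)) (λ L → fromℕ (out L C)) ⟩
          E (sequence (replicate w U)) (const (rankℚ s)) + E (sequence (replicate w U)) (λ L → fromℕ (out L C))
            ≡⟨ cong₂ _+_ (E-const (sequence (replicate w U)) (rankℚ s)) (mean-out w C) ⟩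
          rankℚ s + fromℕ w * η ∎

      slope≤1 : ∀ s → slope s ≤ 1ℚ
      slope≤1 s = ℚ.≤-trans (slope≤ s) (≤-by (coverage (closed s)) (0≤coverage (closed s)) (lemma (coverage (closed s))))
        where
        lemma : ∀ c → (1ℚ - c) + c ≡ 1ℚ
        lemma = solve-∀ ℚ-ring

      -- Exchanging one hyperedge moves `rankℚ` and `windowRank` by at most one each, and the
      -- quotient divides by `w`.
      slope-bounded : BoundedDifferences ((1ℚ + 1ℚ) * 1/w) slope
      slope-bounded r x y s = begin
        slope (r ++ x ∷ s) - slope (r ++ y ∷ s)
          ≡⟨ lemma (windowRank (r ++ x ∷ s)) (rankℚ (r ++ x ∷ s)) (windowRank (r ++ y ∷ s)) (rankℚ (r ++ y ∷ s)) 1/w ⟩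
        ((windowRank (r ++ x ∷ s) - windowRank (r ++ y ∷ s)) + (rankℚ (r ++ y ∷ s) - rankℚ (r ++ x ∷ s))) * 1/w
          ≤⟨ *-monoʳ 0≤1/w (ℚ.+-mono-≤ window-diff (rank-diff r y x s)) ⟩
        (1ℚ + 1ℚ) * 1/w ∎
        where
        open ℚ.≤-Reasoning
        lemma : ∀ p q p′ q′ i → (p - q) * i - (p′ - q′) * i ≡ ((p - p′) + (q′ - q)) * i
        lemma = solve-∀ ℚ-ring
        rank-diff : ∀ r x y s → rankℚ (r ++ x ∷ s) - rankℚ (r ++ y ∷ s) ≤ 1ℚ
        rank-diff r x y s = subst (rankℚ (r ++ x ∷ s) - rankℚ (r ++ y ∷ s) ≤_) (cancel (rankℚ (r ++ s)))
          (ℚ.+-mono-≤ (rank-insert-≤ r x s) (ℚ.neg-antimono-≤ (rank-insert-≥ r y s)))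
          where
          cancel : ∀ q → (1ℚ + q) - q ≡ 1ℚ
          cancel = solve-∀ ℚ-ring
        window-diff : windowRank (r ++ x ∷ s) - windowRank (r ++ y ∷ s) ≤ 1ℚ
        window-diff = subst (_≤ 1ℚ) (E-minus (sequence (replicate w U)) _ _)
          (E-≤-const (sequence (replicate w U)) 1ℚ (λ L → subst₂ (λ u v → rankℚ u - rankℚ v ≤ 1ℚ)
            (List.++-assoc L r (x ∷ s)) (List.++-assoc L r (y ∷ s)) (rank-diff (L ++ r) x y s)))

      meanSlope : ℕ → ℕ → ℚ
      meanSlope ℓ m = (meanRank (w ℕ.+ ℓ) m - meanRank ℓ m) * 1/w

      replicate-+ : ∀ k ℓ → replicate (k ℕ.+ ℓ) U ≡ replicate k U ++ replicate ℓ U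
      replicate-+ zero    ℓ = refl
      replicate-+ (suc k) ℓ = cong (U ∷_) (replicate-+ k ℓ)

      meanRank-window : ∀ ℓ m → E (sequence (means ℓ m)) windowRank ≡ meanRank (w ℕ.+ ℓ) m
      meanRank-window ℓ m = begin
        E (sequence (means ℓ m)) windowRank
          ≡⟨ E-swap (sequence (means ℓ m)) (sequence (replicate w U)) _ ⟩
        E (sequence (replicate w U)) (λ L → E (sequence (means ℓ m)) (λ s → rankℚ (L ++ s)))
          ≡⟨ E-sequence-++ (replicate w U) (means ℓ m) rankℚ ⟨
        E (sequence (replicate w U ++ means ℓ m)) rankℚ
          ≡⟨ cong (λ Ms → E (sequence Ms) rankℚ) (trans (sym (List.++-assoc (replicate w U) (replicate ℓ U) (replicate m V)))
               (cong (_++ replicate m V) (sym (replicate-+ w ℓ)))) ⟩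
        meanRank (w ℕ.+ ℓ) m ∎
        where open ≡-Reasoning

      E-slope : ∀ ℓ m → E (sequence (means ℓ m)) slope ≡ meanSlope ℓ m
      E-slope ℓ m = begin
        E N (λ s → (windowRank s - rankℚ s) * 1/w)    ≡⟨ E-cong N (λ s → ℚ.*-comm (windowRank s - rankℚ s) 1/w) ⟩
        E N (λ s → 1/w * (windowRank s - rankℚ s))    ≡⟨ E-* N 1/w _ ⟩
        1/w * E N (λ s → windowRank s - rankℚ s)      ≡⟨ ℚ.*-comm 1/w _ ⟩
        E N (λ s → windowRank s - rankℚ s) * 1/w      ≡⟨ cong (_* 1/w) (trans (E-minus N windowRank rankℚ) (cong (_- meanRank ℓ m) (meanRank-window ℓ m))) ⟩
        meanSlope ℓ m ∎
        where
        open ≡-Reasoning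
        N = sequence (means ℓ m)

      0≤meanSlope : ∀ ℓ m → 0ℚ ≤ meanSlope ℓ m
      0≤meanSlope ℓ m = subst (0ℚ ≤_) (E-slope ℓ m) (E-≥-const (sequence (means ℓ m)) 0ℚ 0≤slope)

      meanSlope≤1 : ∀ ℓ m → meanSlope ℓ m ≤ 1ℚ
      meanSlope≤1 ℓ m = subst (_≤ 1ℚ) (E-slope ℓ m) (E-≤-const (sequence (means ℓ m)) 1ℚ slope≤1)

      length-means : ∀ ℓ m → length (means ℓ m) ≡ ℓ ℕ.+ m
      length-means ℓ m = trans (List.length-++ (replicate ℓ U)) (cong₂ ℕ._+_ (List.length-replicate ℓ) (List.length-replicate m))

      -- The curvature constant 3b times the variance bound for `k` draws with differences 2/w.
      noise : ℕ → ℚ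
      noise k = (b + b + b) * (fromℕ k * (((1ℚ + 1ℚ) * 1/w) * ((1ℚ + 1ℚ) * 1/w)))

      -- The slope concentrates around its mean, so the concave gain may be evaluated at the mean slope.
      meanRank-growth : ∀ ℓ m → meanRank ℓ m + cubic-gain a b (meanSlope ℓ m) ≤ meanRank ℓ (suc m) + noise (ℓ ℕ.+ m)
      meanRank-growth ℓ m = begin
        -- The linear term of the tangent at `θ` has mean zero and may be inserted freely;
        -- afterwards the comparison is pointwise, with a quadratic error that the variance bounds.
        meanRank ℓ m + g θ
          ≡⟨ +-congˡ (meanRank ℓ m) (sym tangent-mean) ⟩
        meanRank ℓ m + E N (λ s → g θ + σ * (slope s - θ))
          ≡⟨ E-+ N rankℚ (λ s → g θ + σ * (slope s - θ)) ⟨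
        E N (λ s → rankℚ s + (g θ + σ * (slope s - θ)))
          ≤⟨ E-mono N pointwise ⟩
        E N (λ s → E V (λ e → rankℚ (e ∷ s)) + (b + b + b) * ((slope s - θ) * (slope s - θ)))
          ≡⟨ E-+ N (λ s → E V (λ e → rankℚ (e ∷ s))) (λ s → (b + b + b) * ((slope s - θ) * (slope s - θ))) ⟩
        E N (λ s → E V (λ e → rankℚ (e ∷ s))) + E N (λ s → (b + b + b) * ((slope s - θ) * (slope s - θ)))
          ≡⟨ cong₂ _+_ (meanRank-suc ℓ m) (E-* N (b + b + b) (λ s → (slope s - θ) * (slope s - θ))) ⟩
        meanRank ℓ (suc m) + (b + b + b) * E N (λ s → (slope s - θ) * (slope s - θ))
          ≤⟨ ℚ.+-monoʳ-≤ (meanRank ℓ (suc m)) (*-monoˡ (0≤+ (0≤+ 0≤b 0≤b) 0≤b) variance) ⟩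
        meanRank ℓ (suc m) + noise (ℓ ℕ.+ m) ∎
        where
        open ℚ.≤-Reasoning
        N = sequence (means ℓ m)
        θ = meanSlope ℓ m
        g = cubic-gain a b
        σ = gain-slope 0≤a 0≤b θ
        tangent-mean : E N (λ s → g θ + σ * (slope s - θ)) ≡ g θ
        tangent-mean = trans (E-+ N (const (g θ)) (λ s → σ * (slope s - θ))) (trans (cong₂ _+_ (E-const N (g θ))
          (trans (E-* N σ (λ s → slope s - θ)) (*-congˡ σ (trans (E-minus N slope (const θ)) (cong₂ _-_ (E-slope ℓ m) (E-const N θ))))))
          (lemma (g θ) σ θ))
          where
          lemma : ∀ g σ θ → g + σ * (θ - θ) ≡ g
          lemma = solve-∀ ℚ-ring
        variance : E N (λ s → (slope s - θ) * (slope s - θ)) ≤ fromℕ (ℓ ℕ.+ m) * (((1ℚ + 1ℚ) * 1/w) * ((1ℚ + 1ℚ) * 1/w))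
        variance = subst₂ (λ μ k → E N (λ s → (slope s - μ) * (slope s - μ)) ≤ fromℕ k * (((1ℚ + 1ℚ) * 1/w) * ((1ℚ + 1ℚ) * 1/w)))
          (E-slope ℓ m) (length-means ℓ m) (variance-≤ (means ℓ m) {f = slope} slope-bounded)
        gain-step : ∀ s → rankℚ s + g (slope s) ≤ E V (λ e → rankℚ (e ∷ s))
        gain-step s = begin
          rankℚ s + g (slope s)
            ≤⟨ ℚ.+-monoʳ-≤ (rankℚ s) (ℚ.≤-trans (gain-mono 0≤a 0≤b (slope≤ s) η≤1) (hits-V (closed s))) ⟩
          rankℚ s + E V (λ e → fromℕ (leaves e (closed s)))
            ≡⟨ cong₂ _+_ (sym (E-const V (rankℚ s))) refl ⟩
          E V (const (rankℚ s)) + E V (λ e → fromℕ (leaves e (closed s)))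
            ≡⟨ E-+ V (const (rankℚ s)) (λ e → fromℕ (leaves e (closed s))) ⟨
          E V (λ e → rankℚ s + fromℕ (leaves e (closed s)))
            ≤⟨ E-mono V (λ e → subst (_≤ rankℚ (e ∷ s)) (ℚ.+-comm (fromℕ (leaves e (closed s))) (rankℚ s)) (rankℚ-∷ e s)) ⟩
          E V (λ e → rankℚ (e ∷ s)) ∎
          where
          η≤1 : 1ℚ - coverage (closed s) ≤ 1ℚ
          η≤1 = ≤-by (coverage (closed s)) (0≤coverage (closed s)) (lemma (coverage (closed s)))
            where
            lemma : ∀ c → (1ℚ - c) + c ≡ 1ℚ
            lemma = solve-∀ ℚ-ring
        pointwise : ∀ s → rankℚ s + (g θ + σ * (slope s - θ)) ≤
          E V (λ e → rankℚ (e ∷ s)) + (b + b + b) * ((slope s - θ) * (slope s - θ))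
        pointwise s = begin
          rankℚ s + (g θ + σ * (slope s - θ))
            ≤⟨ ℚ.+-monoʳ-≤ (rankℚ s) (gain-≥-tangent 0≤a 0≤b (slope s) θ (0≤slope s) (0≤meanSlope ℓ m)) ⟩
          rankℚ s + (g (slope s) + (b + b + b) * ((slope s - θ) * (slope s - θ)))
            ≡⟨ ℚ.+-assoc (rankℚ s) (g (slope s)) _ ⟨
          (rankℚ s + g (slope s)) + (b + b + b) * ((slope s - θ) * (slope s - θ))
            ≤⟨ ℚ.+-monoˡ-≤ ((b + b + b) * ((slope s - θ) * (slope s - θ))) (gain-step s) ⟩
          E V (λ e → rankℚ (e ∷ s)) + (b + b + b) * ((slope s - θ) * (slope s - θ)) ∎

-- A comparison principle for v k m = n − E (rank), on a grid of window length W in k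

argmaxℚ : ∀ {N} (f : Fin (suc N) → ℚ) → ∃ λ j → ∀ i → f i ≤ f j
argmaxℚ {zero}  f = zero , λ { zero → ℚ.≤-refl }
argmaxℚ {suc N} f with argmaxℚ (f ∘ suc)
... | j , max with ℚ.≤-total (f zero) (f (suc j))
... | inj₁ le = suc j , λ { zero → le ; (suc i) → max i }
... | inj₂ ge = zero , λ { zero → ℚ.≤-refl ; (suc i) → ℚ.≤-trans (max i) ge }

sumTo : ℕ → (ℕ → ℚ) → ℚ
sumTo zero    f = 0ℚ
sumTo (suc Z) f = sumTo Z f + f Z

sumTo-mono : ∀ Z {f g : ℕ → ℚ} → (∀ z → z ℕ.< Z → f z ≤ g z) → sumTo Z f ≤ sumTo Z g
sumTo-mono zero    le = ℚ.≤-refl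
sumTo-mono (suc Z) le = ℚ.+-mono-≤ (sumTo-mono Z (λ z z< → le z (ℕ.m≤n⇒m≤1+n z<))) (le Z ℕ.≤-refl)

sumTo-const : ∀ Z c → sumTo Z (const c) ≡ fromℕ Z * c
sumTo-const zero    c = sym (ℚ.*-zeroˡ c)
sumTo-const (suc Z) c = trans (+-congʳ c (sumTo-const Z c)) (lemma (fromℕ Z) c)
  where
  lemma : ∀ k c → k * c + c ≡ (1ℚ + k) * c
  lemma = solve-∀ ℚ-ring

sumTo-minus : ∀ Z f g → sumTo Z (λ z → f z - g z) ≡ sumTo Z f - sumTo Z g
sumTo-minus zero    f g = refl
sumTo-minus (suc Z) f g = trans (+-congʳ (f Z - g Z) (sumTo-minus Z f g)) (lemma (sumTo Z f) (sumTo Z g) (f Z) (g Z))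
  where
  lemma : ∀ a b c d → (a - b) + (c - d) ≡ (a + c) - (b + d)
  lemma = solve-∀ ℚ-ring

sumTo-+ : ∀ Z f g → sumTo Z (λ z → f z + g z) ≡ sumTo Z f + sumTo Z g
sumTo-+ zero    f g = refl
sumTo-+ (suc Z) f g = trans (+-congʳ (f Z + g Z) (sumTo-+ Z f g)) (lemma (sumTo Z f) (sumTo Z g) (f Z) (g Z))
  where
  lemma : ∀ a b c d → (a + b) + (c + d) ≡ (a + c) + (b + d)
  lemma = solve-∀ ℚ-ring

sumTo-* : ∀ Z f c → sumTo Z (λ z → f z * c) ≡ sumTo Z f * c
sumTo-* zero    f c = sym (ℚ.*-zeroˡ c)
sumTo-* (suc Z) f c = trans (+-congʳ (f Z * c) (sumTo-* Z f c)) (sym (ℚ.*-distribʳ-+ c (sumTo Z f) (f Z)))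

telescope : ∀ Z k (G : ℕ → ℚ) →
  sumTo Z (λ z → G (k ℕ.+ z)) + G (k ℕ.+ Z) ≡ G k + sumTo Z (λ z → G (suc (k ℕ.+ z)))
telescope zero    k G = trans (ℚ.+-identityˡ _) (trans (cong G (ℕ.+-identityʳ k)) (sym (ℚ.+-identityʳ (G k))))
telescope (suc Z) k G = begin
  (sumTo Z (λ z → G (k ℕ.+ z)) + G (k ℕ.+ Z)) + G (k ℕ.+ suc Z)
    ≡⟨ cong₂ _+_ (telescope Z k G) (cong G (ℕ.+-suc k Z)) ⟩
  (G k + sumTo Z (λ z → G (suc (k ℕ.+ z)))) + G (suc (k ℕ.+ Z))
    ≡⟨ ℚ.+-assoc (G k) _ _ ⟩
  G k + (sumTo Z (λ z → G (suc (k ℕ.+ z))) + G (suc (k ℕ.+ Z))) ∎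
  where open ≡-Reasoning

-- `step` is an explicit difference scheme for the Hamilton-Jacobi inequality with error `κ`.
-- `steep` is its stability condition of Courant-Friedrichs-Lewy type: it makes the scheme monotone.
-- `step` covers `k < K`; from `K` on, `far` puts `v` below the constant line `zero`.
module Comparison
  {a b : ℚ} (0≤a : 0ℚ ≤ a) (0≤b : 0ℚ ≤ b) (a+b≤1 : a + b ≤ 1ℚ)
  {W 1/W : ℚ} (0≤W : 0ℚ ≤ W) (0≤1/W : 0ℚ ≤ 1/W) (W*1/W : W * 1/W ≡ 1ℚ)
  (steep : (a + b * (1ℚ + 1ℚ + 1ℚ)) * 1/W ≤ 1ℚ)
  (v : ℕ → ℕ → ℚ) (K M : ℕ) (κ : ℚ)
  (step : ∀ k m → k ℕ.< K → m ℕ.< M → v k (suc m) + cubic-gain a b ((v k m - v (suc k) m) * 1/W) ≤ v k m + κ)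
  (0≤κ : 0ℚ ≤ κ)
  (0≤drop : ∀ k m → 0ℚ ≤ (v k m - v (suc k) m) * 1/W)
  (drop≤1 : ∀ k m → (v k m - v (suc k) m) * 1/W ≤ 1ℚ)
  {N : ℕ} (α h : Fin (suc N) → ℚ) (0≤h : ∀ j → 0ℚ ≤ h j) (h≤1 : ∀ j → h j ≤ 1ℚ)
  (h-zero : h zero ≡ 0ℚ) (far : ∀ k m → K ℕ.≤ k → v k m ≤ α zero)
  (initial : ∀ k → ∃ λ j → v k 0 ≤ α j - h j * (W * fromℕ k))
  (Z : ℕ) {{_ : NonZero Z}}
  where

  private
    g : ℚ → ℚ
    g = cubic-gain a b
    ζ 1/ζ : ℚ
    ζ = fromℕ Z
    1/ζ = + 1 / Z
    0≤ζ : 0ℚ ≤ ζ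
    0≤ζ = 0≤fromℕ Z
    0≤1/ζ : 0ℚ ≤ 1/ζ
    0≤1/ζ = ℚ.nonNegative⁻¹ 1/ζ {{ℚ.normalize-nonNeg 1 Z}}

  line : Fin (suc N) → ℕ → ℕ → ℚ
  line j k m = (α j - h j * (W * fromℕ k)) - fromℕ m * g (h j)

  top : ℕ → ℕ → Fin (suc N)
  top k m = proj₁ (argmaxℚ (λ j → line j k m))

  envelope : ℕ → ℕ → ℚ
  envelope k m = line (top k m) k m

  line≤envelope : ∀ j k m → line j k m ≤ envelope k m
  line≤envelope j k m = proj₂ (argmaxℚ (λ j → line j k m)) j

  line-suc-k : ∀ j k m → line j (suc k) m ≡ line j k m - h j * W
  line-suc-k j k m = lemma (α j) (h j) W (fromℕ k) (fromℕ m * g (h j))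
    where
    lemma : ∀ α h W k x → (α - h * (W * (1ℚ + k))) - x ≡ ((α - h * (W * k)) - x) - h * W
    lemma = solve-∀ ℚ-ring

  line-suc-m : ∀ j k m → line j k (suc m) ≡ line j k m - g (h j)
  line-suc-m j k m = lemma (α j - h j * (W * fromℕ k)) (fromℕ m) (g (h j))
    where
    lemma : ∀ x m y → x - (1ℚ + m) * y ≡ (x - m * y) - y
    lemma = solve-∀ ℚ-ring

  envelopeSlope : ℕ → ℕ → ℚ
  envelopeSlope k m = (envelope k m - envelope (suc k) m) * 1/W

  scale-W : ∀ p → (p * W) * 1/W ≡ p
  scale-W p = trans (ℚ.*-assoc p W 1/W) (trans (*-congˡ p W*1/W) (ℚ.*-identityʳ p))

  -- The line on top at `k` bounds the envelope at `suc k` from below. Together with the mirror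
  -- image `≤envelopeSlope`, the discrete slope lies between the slopes of two successive top lines.
  envelopeSlope≤ : ∀ k m → envelopeSlope k m ≤ h (top k m)
  envelopeSlope≤ k m = begin
    (envelope k m - envelope (suc k) m) * 1/W
      ≤⟨ *-monoʳ 0≤1/W (ℚ.+-monoʳ-≤ (envelope k m) (ℚ.neg-antimono-≤ (line≤envelope (top k m) (suc k) m))) ⟩
    (envelope k m - line (top k m) (suc k) m) * 1/W
      ≡⟨ cong (λ z → (envelope k m - z) * 1/W) (line-suc-k (top k m) k m) ⟩
    (envelope k m - (envelope k m - h (top k m) * W)) * 1/W
      ≡⟨ trans (cong (_* 1/W) (lemma (envelope k m) (h (top k m) * W))) (scale-W (h (top k m))) ⟩
    h (top k m) ∎
    where
    open ℚ.≤-Reasoning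
    lemma : ∀ x y → x - (x - y) ≡ y
    lemma = solve-∀ ℚ-ring

  ≤envelopeSlope : ∀ k m → h (top (suc k) m) ≤ envelopeSlope k m
  ≤envelopeSlope k m = begin
    h j
      ≡⟨ trans (sym (scale-W (h j))) (cong (_* 1/W) (lemma (line j k m) (h j * W))) ⟩
    (line j k m - (line j k m - h j * W)) * 1/W
      ≡⟨ cong (λ z → (line j k m - z) * 1/W) (sym (line-suc-k j k m)) ⟩
    (line j k m - envelope (suc k) m) * 1/W
      ≤⟨ *-monoʳ 0≤1/W (ℚ.+-monoˡ-≤ (- envelope (suc k) m) (line≤envelope j k m)) ⟩
    (envelope k m - envelope (suc k) m) * 1/W ∎
    where
    open ℚ.≤-Reasoning
    j = top (suc k) m
    lemma : ∀ x y → y ≡ x - (x - y)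
    lemma = solve-∀ ℚ-ring

  envelopeSlope≤1 : ∀ k m → envelopeSlope k m ≤ 1ℚ
  envelopeSlope≤1 k m = ℚ.≤-trans (envelopeSlope≤ k m) (h≤1 (top k m))

  -- `Z` times the average of the envelope over the shifts `z < Z`. The division is postponed, so
  -- `v` appears multiplied by `ζ` below.
  total : ℕ → ℕ → ℚ
  total k m = sumTo Z (λ z → envelope (k ℕ.+ z) m)

  meanSlope : ℕ → ℕ → ℚ
  meanSlope k m = (total k m - total (suc k) m) * 1/W * 1/ζ

  ζ*meanSlope : ∀ k m → ζ * meanSlope k m ≡ sumTo Z (λ z → envelopeSlope (k ℕ.+ z) m)
  ζ*meanSlope k m = begin
    ζ * ((total k m - total (suc k) m) * 1/W * 1/ζ) ≡⟨ lemma ζ ((total k m - total (suc k) m) * 1/W) 1/ζ ⟩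
    (ζ * 1/ζ) * ((total k m - total (suc k) m) * 1/W) ≡⟨ trans (cong (_* ((total k m - total (suc k) m) * 1/W)) (*-inverse-fromℕ Z)) (ℚ.*-identityˡ _) ⟩
    (total k m - total (suc k) m) * 1/W ≡⟨ cong (_* 1/W) (sym (sumTo-minus Z (λ z → envelope (k ℕ.+ z) m) (λ z → envelope (suc (k ℕ.+ z)) m))) ⟩
    sumTo Z (λ z → envelope (k ℕ.+ z) m - envelope (suc (k ℕ.+ z)) m) * 1/W ≡⟨ sym (sumTo-* Z _ 1/W) ⟩
    sumTo Z (λ z → envelopeSlope (k ℕ.+ z) m) ∎
    where
    open ≡-Reasoning
    lemma : ∀ z x i → z * (x * i) ≡ (z * i) * x
    lemma = solve-∀ ℚ-ring

  meanSlope≤1 : ∀ k m → meanSlope k m ≤ 1ℚ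
  meanSlope≤1 k m = begin
    meanSlope k m                        ≡⟨ lemma ζ 1/ζ (meanSlope k m) (*-inverse-fromℕ Z) ⟩
    1/ζ * (ζ * meanSlope k m)            ≤⟨ *-monoˡ 0≤1/ζ (ℚ.≤-trans (ℚ.≤-reflexive (ζ*meanSlope k m))
                                              (ℚ.≤-trans (sumTo-mono Z (λ z _ → envelopeSlope≤1 (k ℕ.+ z) m)) (ℚ.≤-reflexive (sumTo-const Z 1ℚ)))) ⟩
    1/ζ * (ζ * 1ℚ)                       ≡⟨ sym (lemma ζ 1/ζ 1ℚ (*-inverse-fromℕ Z)) ⟩
    1ℚ ∎
    where
    open ℚ.≤-Reasoning
    lemma : ∀ z i x → z * i ≡ 1ℚ → x ≡ i * (z * x)
    lemma z i x eq = trans (sym (ℚ.*-identityˡ x)) (trans (cong (_* x) (sym eq)) (rearrange z i x))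
      where
      rearrange : ∀ z i x → (z * i) * x ≡ i * (z * x)
      rearrange = solve-∀ ℚ-ring

  0≤g : ∀ {p} → 0ℚ ≤ p → p ≤ 1ℚ → 0ℚ ≤ g p
  0≤g {p} 0≤p p≤1 = subst (_≤ g p) (lemma a b) (gain-mono 0≤a 0≤b 0≤p p≤1)
    where
    lemma : ∀ a b → a * 0ℚ + b * (1ℚ - (1ℚ - 0ℚ) * (1ℚ - 0ℚ) * (1ℚ - 0ℚ)) ≡ 0ℚ
    lemma = solve-∀ ℚ-ring

  g≤1 : ∀ {p} → p ≤ 1ℚ → g p ≤ 1ℚ
  g≤1 {p} p≤1 = ℚ.≤-trans (gain-mono 0≤a 0≤b p≤1 ℚ.≤-refl) (subst (_≤ 1ℚ) (lemma a b) a+b≤1)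
    where
    lemma : ∀ a b → a + b ≡ a * 1ℚ + b * (1ℚ - (1ℚ - 1ℚ) * (1ℚ - 1ℚ) * (1ℚ - 1ℚ))
    lemma = solve-∀ ℚ-ring

  jensen : ∀ k m → sumTo Z (λ z → g (envelopeSlope (k ℕ.+ z) m)) ≤ ζ * g (meanSlope k m)
  jensen k m = begin
    sumTo Z (λ z → g (θ z))
      ≤⟨ sumTo-mono Z (λ z _ → gain-≤-tangent 0≤a 0≤b (θ z) Θ (envelopeSlope≤1 (k ℕ.+ z) m) (meanSlope≤1 k m)) ⟩
    sumTo Z (λ z → g Θ + σ * (θ z - Θ))
      ≡⟨ sumTo-+ Z (const (g Θ)) (λ z → σ * (θ z - Θ)) ⟩
    sumTo Z (const (g Θ)) + sumTo Z (λ z → σ * (θ z - Θ))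
      ≡⟨ cong₂ _+_ (sumTo-const Z (g Θ)) deviation ⟩
    ζ * g Θ + 0ℚ
      ≡⟨ ℚ.+-identityʳ _ ⟩
    ζ * g Θ ∎
    where
    open ℚ.≤-Reasoning
    θ : ℕ → ℚ
    θ z = envelopeSlope (k ℕ.+ z) m
    Θ = meanSlope k m
    σ = gain-slope 0≤a 0≤b Θ
    sumTo-cong : ∀ Z {f f′ : ℕ → ℚ} → (∀ z → f z ≡ f′ z) → sumTo Z f ≡ sumTo Z f′
    sumTo-cong zero    eq = refl
    sumTo-cong (suc Z) eq = cong₂ _+_ (sumTo-cong Z eq) (eq Z)
    deviation : sumTo Z (λ z → σ * (θ z - Θ)) ≡ 0ℚ
    deviation = trans (sumTo-cong Z (λ z → ℚ.*-comm σ (θ z - Θ))) (trans (sumTo-* Z (λ z → θ z - Θ) σ)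
      (trans (cong (_* σ) (trans (sumTo-minus Z θ (const Θ)) (trans (cong₂ _-_ (sym (ζ*meanSlope k m)) (sumTo-const Z Θ)) (p-p≡0 (ζ * Θ)))))
        (ℚ.*-zeroˡ σ)))

  -- The slopes of successive envelope lines interlace with the discrete slopes, so the
  -- loss at the kinks telescopes.
  total-step : ∀ k m → total k m ≤ total k (suc m) + ζ * g (meanSlope k m) + 1ℚ
  total-step k m = begin
    total k m
      ≤⟨ sumTo-mono Z (λ z _ → advance (k ℕ.+ z)) ⟩
    sumTo Z (λ z → envelope (k ℕ.+ z) (suc m) + G (k ℕ.+ z))
      ≡⟨ sumTo-+ Z (λ z → envelope (k ℕ.+ z) (suc m)) (λ z → G (k ℕ.+ z)) ⟩
    total k (suc m) + ΣG
      ≤⟨ ℚ.+-monoʳ-≤ (total k (suc m)) ΣG≤ ⟩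
    total k (suc m) + (ζ * g (meanSlope k m) + 1ℚ)
      ≡⟨ ℚ.+-assoc (total k (suc m)) _ _ ⟨
    total k (suc m) + ζ * g (meanSlope k m) + 1ℚ ∎
    where
    open ℚ.≤-Reasoning
    G : ℕ → ℚ
    G i = g (h (top i m))
    ΣG = sumTo Z (λ z → G (k ℕ.+ z))
    ΣG⁺ = sumTo Z (λ z → G (suc (k ℕ.+ z)))
    advance : ∀ i → envelope i m ≤ envelope i (suc m) + G i
    advance i = begin
      envelope i m                            ≡⟨ lemma (envelope i m) (G i) ⟩
      (envelope i m - G i) + G i              ≡⟨ cong (_+ G i) (sym (line-suc-m (top i m) i m)) ⟩
      line (top i m) i (suc m) + G i          ≤⟨ ℚ.+-monoˡ-≤ (G i) (line≤envelope (top i m) i (suc m)) ⟩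
      envelope i (suc m) + G i                ∎
      where
      lemma : ∀ x y → x ≡ (x - y) + y
      lemma = solve-∀ ℚ-ring
    0≤G : ∀ i → 0ℚ ≤ G i
    0≤G i = 0≤g (0≤h (top i m)) (h≤1 (top i m))
    ΣG≤ : ΣG ≤ ζ * g (meanSlope k m) + 1ℚ
    ΣG≤ = begin
      ΣG                              ≤⟨ ≤-by (G (k ℕ.+ Z)) (0≤G (k ℕ.+ Z)) (telescope Z k G) ⟩
      G k + ΣG⁺                       ≤⟨ ℚ.+-mono-≤ (g≤1 (h≤1 (top k m))) (sumTo-mono Z (λ z _ →
                                           gain-mono 0≤a 0≤b (≤envelopeSlope (k ℕ.+ z) m) (envelopeSlope≤1 (k ℕ.+ z) m))) ⟩
      1ℚ + sumTo Z (λ z → g (envelopeSlope (k ℕ.+ z) m)) ≤⟨ ℚ.+-monoʳ-≤ 1ℚ (jensen k m) ⟩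
      1ℚ + ζ * g (meanSlope k m)      ≡⟨ ℚ.+-comm 1ℚ (ζ * g (meanSlope k m)) ⟩
      ζ * g (meanSlope k m) + 1ℚ      ∎

  error : ℕ → ℚ
  error m = fromℕ m * (ζ * κ + 1ℚ)

  -- The term `ζ * (ζ * W)` pays for the shifts, over which a line falls by at most `ζ * W`; `error`
  -- adds, per arrival, the noise and one unit for the kinks, a unit that division by `ζ` makes
  -- small.
  bound : ℕ → ℕ → ℚ
  bound k m = (ζ * (ζ * W) + total k m) + error m

  0≤error : ∀ m → 0ℚ ≤ error m
  0≤error m = 0≤* (0≤fromℕ m) (0≤+ (0≤* 0≤ζ 0≤κ) 0≤1)

  initial-bound : ∀ k → ζ * v k 0 ≤ bound k 0
  initial-bound k with initial k
  ... | j , le = begin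
    ζ * v k 0                                            ≡⟨ sumTo-const Z (v k 0) ⟨
    sumTo Z (const (v k 0))                              ≤⟨ sumTo-mono Z shifted ⟩
    sumTo Z (λ z → ζ * W + envelope (k ℕ.+ z) 0)         ≡⟨ trans (sumTo-+ Z (const (ζ * W)) (λ z → envelope (k ℕ.+ z) 0)) (+-congʳ (total k 0) (sumTo-const Z (ζ * W))) ⟩
    ζ * (ζ * W) + total k 0                              ≤⟨ ≤-by (error 0) (0≤error 0) refl ⟩
    bound k 0 ∎
    where
    open ℚ.≤-Reasoning
    shifted : ∀ z → z ℕ.< Z → v k 0 ≤ ζ * W + envelope (k ℕ.+ z) 0
    shifted z z<Z = begin
      v k 0
        ≤⟨ le ⟩
      α j - h j * (W * fromℕ k)
        ≤⟨ ≤-by (W * ((ζ - fromℕ z) + fromℕ z * (1ℚ - h j)))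
             (0≤* 0≤W (0≤+ (p≤q⇒0≤q-p (fromℕ-mono (ℕ.<⇒≤ z<Z))) (0≤* (0≤fromℕ z) (p≤q⇒0≤q-p (h≤1 j)))))
             (lemma (α j) (h j) W (fromℕ k) ζ (fromℕ z) (g (h j))) ⟩
      ζ * W + ((α j - h j * (W * (fromℕ k + fromℕ z))) - 0ℚ * g (h j))
        ≡⟨ cong (λ x → ζ * W + ((α j - h j * (W * x)) - 0ℚ * g (h j))) (sym (fromℕ-+ k z)) ⟩
      ζ * W + line j (k ℕ.+ z) 0
        ≤⟨ ℚ.+-monoʳ-≤ (ζ * W) (line≤envelope j (k ℕ.+ z) 0) ⟩
      ζ * W + envelope (k ℕ.+ z) 0 ∎
      where
      lemma : ∀ α h W k ζ z x → (α - h * (W * k)) + W * ((ζ - z) + z * (1ℚ - h)) ≡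
        ζ * W + ((α - h * (W * (k + z))) - 0ℚ * x)
      lemma = solve-∀ ℚ-ring

  far-bound : ∀ k m → K ℕ.≤ k → ζ * v k m ≤ bound k m
  far-bound k m K≤k = begin
    ζ * v k m                        ≡⟨ sumTo-const Z (v k m) ⟨
    sumTo Z (const (v k m))          ≤⟨ sumTo-mono Z (λ z _ → ℚ.≤-trans (far k m K≤k) (constant z)) ⟩
    total k m                        ≤⟨ ≤-by (ζ * (ζ * W) + error m) (0≤+ (0≤* 0≤ζ (0≤* 0≤ζ 0≤W)) (0≤error m)) (lemma (total k m) (ζ * (ζ * W)) (error m)) ⟩
    bound k m                        ∎
    where
    open ℚ.≤-Reasoning
    lemma : ∀ t x e → t + (x + e) ≡ (x + t) + e
    lemma = solve-∀ ℚ-ring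
    constant : ∀ z → α zero ≤ envelope (k ℕ.+ z) m
    constant z = ℚ.≤-trans (ℚ.≤-reflexive (trans (flat (α zero) (W * fromℕ (k ℕ.+ z)) (fromℕ m) a b)
      (cong (λ x → (α zero - x * (W * fromℕ (k ℕ.+ z))) - fromℕ m * g x) (sym h-zero)))) (line≤envelope zero (k ℕ.+ z) m)
      where
      flat : ∀ α x m a b → α ≡ (α - 0ℚ * x) - m * (a * 0ℚ + b * (1ℚ - (1ℚ - 0ℚ) * (1ℚ - 0ℚ) * (1ℚ - 0ℚ)))
      flat = solve-∀ ℚ-ring

  -- The recursion for v is monotone in v: a larger v k m raises the gain at most at rate 1/W.
  comparison-step : ∀ k m → ζ * v k m ≤ bound k m → ζ * v (suc k) m ≤ bound (suc k) m →
    ζ * v k m + ζ * g (meanSlope k m) ≤ bound k m + ζ * g ((v k m - v (suc k) m) * 1/W)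
  comparison-step k m le₀ le₁ = [ flatter , steeper ]′ (ℚ.≤-total (meanSlope k m) ((v k m - v (suc k) m) * 1/W))
    where
    open ℚ.≤-Reasoning
    Θ d σ τ : ℚ
    Θ = meanSlope k m
    d = (v k m - v (suc k) m) * 1/W
    σ = gain-slope 0≤a 0≤b d
    τ = a + b * (1ℚ + 1ℚ + 1ℚ)
    0≤τ : 0ℚ ≤ τ
    0≤τ = 0≤+ 0≤a (0≤* 0≤b (0≤+ (0≤+ 0≤1 0≤1) 0≤1))
    σ≤ : σ ≤ τ
    σ≤ = ≤-by (b * ((1ℚ + 1ℚ + 1ℚ) * (d * (1ℚ + (1ℚ - d)))))
      (0≤* 0≤b (0≤* (0≤+ (0≤+ 0≤1 0≤1) 0≤1) (0≤* (0≤drop k m) (0≤+ 0≤1 (p≤q⇒0≤q-p (drop≤1 k m)))))) (lemma a b d)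
      where
      lemma : ∀ a b d → (a + b * ((1ℚ + 1ℚ + 1ℚ) * ((1ℚ - d) * (1ℚ - d)))) + b * ((1ℚ + 1ℚ + 1ℚ) * (d * (1ℚ + (1ℚ - d)))) ≡ a + b * (1ℚ + 1ℚ + 1ℚ)
      lemma = solve-∀ ℚ-ring
    expand : ∀ x z g τ Θ d → x + z * (g + τ * (Θ - d)) ≡ (x + z * g) + τ * (z * Θ - z * d)
    expand = solve-∀ ℚ-ring
    rearrange : ∀ τ x i → τ * (x * i) ≡ (τ * i) * x
    rearrange = solve-∀ ℚ-ring
    collect : ∀ x y z → (x + y) + 1ℚ * (z - x) ≡ z + y
    collect = solve-∀ ℚ-ring
    ζΘ : ζ * Θ ≡ (total k m - total (suc k) m) * 1/W
    ζΘ = trans (lemma ζ ((total k m - total (suc k) m) * 1/W) 1/ζ)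
      (trans (cong (_* ((total k m - total (suc k) m) * 1/W)) (*-inverse-fromℕ Z)) (ℚ.*-identityˡ _))
      where
      lemma : ∀ z x i → z * (x * i) ≡ (z * i) * x
      lemma = solve-∀ ℚ-ring
    excess : ζ * Θ - ζ * d ≤ (bound k m - ζ * v k m) * 1/W
    excess = begin
      ζ * Θ - ζ * d
        ≡⟨ trans (cong (_- ζ * d) ζΘ) (lemma (total k m) (total (suc k) m) ζ (v k m) (v (suc k) m) 1/W (ζ * (ζ * W)) (error m)) ⟩
      ((bound k m - ζ * v k m) - (bound (suc k) m - ζ * v (suc k) m)) * 1/W
        ≤⟨ *-monoʳ {(bound k m - ζ * v k m) - (bound (suc k) m - ζ * v (suc k) m)} {bound k m - ζ * v k m} 0≤1/W (≤-by (bound (suc k) m - ζ * v (suc k) m) (p≤q⇒0≤q-p le₁) (cancel (bound k m - ζ * v k m) (bound (suc k) m - ζ * v (suc k) m))) ⟩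
      (bound k m - ζ * v k m) * 1/W ∎
      where
      lemma : ∀ s s′ z v v′ i c e → (s - s′) * i - z * ((v - v′) * i) ≡ ((((c + s) + e) - z * v) - (((c + s′) + e) - z * v′)) * i
      lemma = solve-∀ ℚ-ring
      cancel : ∀ x y → (x - y) + y ≡ x
      cancel = solve-∀ ℚ-ring
    flatter : Θ ≤ d → ζ * v k m + ζ * g Θ ≤ bound k m + ζ * g d
    flatter Θ≤d = ℚ.+-mono-≤ le₀ (*-monoˡ 0≤ζ (gain-mono 0≤a 0≤b Θ≤d (drop≤1 k m)))
    steeper : d ≤ Θ → ζ * v k m + ζ * g Θ ≤ bound k m + ζ * g d
    steeper d≤Θ = begin
      ζ * v k m + ζ * g Θ
        ≤⟨ ℚ.+-monoʳ-≤ (ζ * v k m) (*-monoˡ 0≤ζ (gain-≤-tangent 0≤a 0≤b Θ d (meanSlope≤1 k m) (drop≤1 k m))) ⟩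
      ζ * v k m + ζ * (g d + σ * (Θ - d))
        ≤⟨ ℚ.+-monoʳ-≤ (ζ * v k m) (*-monoˡ 0≤ζ (ℚ.+-monoʳ-≤ (g d) (*-monoʳ (p≤q⇒0≤q-p d≤Θ) σ≤))) ⟩
      ζ * v k m + ζ * (g d + τ * (Θ - d))
        ≡⟨ expand (ζ * v k m) ζ (g d) τ Θ d ⟩
      (ζ * v k m + ζ * g d) + τ * (ζ * Θ - ζ * d)
        ≤⟨ ℚ.+-monoʳ-≤ (ζ * v k m + ζ * g d) (*-monoˡ 0≤τ excess) ⟩
      (ζ * v k m + ζ * g d) + τ * ((bound k m - ζ * v k m) * 1/W)
        ≡⟨ +-congˡ (ζ * v k m + ζ * g d) (rearrange τ (bound k m - ζ * v k m) 1/W) ⟩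
      (ζ * v k m + ζ * g d) + (τ * 1/W) * (bound k m - ζ * v k m)
        ≤⟨ ℚ.+-monoʳ-≤ (ζ * v k m + ζ * g d) (*-monoʳ (p≤q⇒0≤q-p le₀) steep) ⟩
      (ζ * v k m + ζ * g d) + 1ℚ * (bound k m - ζ * v k m)
        ≡⟨ collect (ζ * v k m) (ζ * g d) (bound k m) ⟩
      bound k m + ζ * g d ∎

  comparison : ∀ m → m ℕ.≤ M → ∀ k → ζ * v k m ≤ bound k m
  comparison zero    m≤M k = initial-bound k
  comparison (suc m) m<M k = [ near , far-bound k (suc m) ]′ (ℕ.<-≤-connex k K)
    where
    open ℚ.≤-Reasoning
    Θ d : ℚ
    Θ = meanSlope k m
    d = (v k m - v (suc k) m) * 1/W
    regroup : ∀ z v G g → z * v + (z * G + z * g) ≡ z * (v + g) + z * G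
    regroup = solve-∀ ℚ-ring
    regroup′ : ∀ z v κ G → z * (v + κ) + z * G ≡ (z * v + z * G) + z * κ
    regroup′ = solve-∀ ℚ-ring
    regroup″ : ∀ c t G m g κ → (((c + (t + G + 1ℚ)) + m * (κ + 1ℚ)) + g) + κ ≡ ((c + t) + (1ℚ + m) * (κ + 1ℚ)) + (G + g)
    regroup″ = solve-∀ ℚ-ring
    near : k ℕ.< K → ζ * v k (suc m) ≤ bound k (suc m)
    -- Both gains, at the slope of the envelope and at that of `v`, are added on either side: the
    -- scheme for `v` consumes one, the advance of the envelope the other.
    near k<K = +-cancelʳ (ζ * g Θ + ζ * g d) (begin
      ζ * v k (suc m) + (ζ * g Θ + ζ * g d)
        ≡⟨ regroup ζ (v k (suc m)) (g Θ) (g d) ⟩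
      ζ * (v k (suc m) + g d) + ζ * g Θ
        ≤⟨ ℚ.+-monoˡ-≤ (ζ * g Θ) (*-monoˡ 0≤ζ (step k m k<K m<M)) ⟩
      ζ * (v k m + κ) + ζ * g Θ
        ≡⟨ regroup′ ζ (v k m) κ (g Θ) ⟩
      (ζ * v k m + ζ * g Θ) + ζ * κ
        ≤⟨ ℚ.+-monoˡ-≤ (ζ * κ) (comparison-step k m (comparison m (ℕ.<⇒≤ m<M) k) (comparison m (ℕ.<⇒≤ m<M) (suc k))) ⟩
      (((ζ * (ζ * W) + total k m) + error m) + ζ * g d) + ζ * κ
        ≤⟨ ℚ.+-monoˡ-≤ (ζ * κ) (ℚ.+-monoˡ-≤ (ζ * g d) (ℚ.+-monoˡ-≤ (error m) (ℚ.+-monoʳ-≤ (ζ * (ζ * W)) (total-step k m)))) ⟩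
      (((ζ * (ζ * W) + (total k (suc m) + ζ * g Θ + 1ℚ)) + error m) + ζ * g d) + ζ * κ
        ≡⟨ regroup″ (ζ * (ζ * W)) (total k (suc m)) (ζ * g Θ) (fromℕ m) (ζ * g d) (ζ * κ) ⟩
      bound k (suc m) + (ζ * g Θ + ζ * g d) ∎)

  final-bound : ∀ {u} → (∀ j → α j - fromℕ M * g (h j) ≤ u) →
    ζ * v 0 M ≤ (ζ * (ζ * W) + ζ * u) + error M
  final-bound {u} lines≤u = ℚ.≤-trans (comparison M ℕ.≤-refl 0)
    (ℚ.+-monoˡ-≤ (error M) (ℚ.+-monoʳ-≤ (ζ * (ζ * W)) (begin
      total 0 M               ≤⟨ sumTo-mono Z (λ z _ → at (top z M) z) ⟩
      sumTo Z (const u)       ≡⟨ sumTo-const Z u ⟩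
      ζ * u                   ∎)))
    where
    open ℚ.≤-Reasoning
    at : ∀ j z → line j z M ≤ u
    at j z = ℚ.≤-trans (≤-by (h j * (W * fromℕ z)) (0≤* (0≤h j) (0≤* 0≤W (0≤fromℕ z)))
      (lemma (α j) (h j * (W * fromℕ z)) (fromℕ M * g (h j)))) (lines≤u j)
      where
      lemma : ∀ α x y → ((α - x) - y) + x ≡ α - y
      lemma = solve-∀ ℚ-ring

-- Upper bounds for online algorithms

module Extension {c ℓ₁ ℓ₂} (K : OrderedExtension c ℓ₁ ℓ₂) where
  private module K = OrderedExtension K
  open IsTotalOrder K.isTotalOrder public using ()
    renaming (refl to ≤K-refl; trans to ≤K-trans; reflexive to ≤K-reflexive; antisym to ≤K-antisym)
  open IsRingMonomorphism K.ι-isRingMono public using ()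
    renaming (+-homo to ι-+; *-homo to ι-*; 0#-homo to ι-0; 1#-homo to ι-1; injective to ι-injective)

  ι-cong : ∀ {p q} → p ≡ q → K.ι p K.≈ K.ι q
  ι-cong refl = K.refl

  +K-mono : ∀ {x y z w} → x K.≤ y → z K.≤ w → (x K.+ z) K.≤ (y K.+ w)
  +K-mono {x} {y} {z} {w} x≤y z≤w = ≤K-trans (K.+-mono-≤ z x≤y)
    (≤K-trans (≤K-reflexive (K.+-comm y z)) (≤K-trans (K.+-mono-≤ y z≤w) (≤K-reflexive (K.+-comm w y))))

  *K-monoˡ : ∀ {x y z} → K.0# K.≤ z → x K.≤ y → (z K.* x) K.≤ (z K.* y)
  *K-monoˡ {x} {y} {z} 0≤z x≤y = ≤K-trans (≤K-reflexive (K.sym (K.+-identityˡ (z K.* x))))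
    (≤K-trans (K.+-mono-≤ (z K.* x) (K.*-nonNeg 0≤z 0≤y-x)) (≤K-reflexive (begin
      z K.* (y K.- x) K.+ z K.* x   ≈⟨ K.distribˡ z (y K.- x) x ⟨
      z K.* ((y K.- x) K.+ x)       ≈⟨ K.*-congˡ (K.trans (K.+-assoc y (K.- x) x) (K.trans (K.+-congˡ (K.-‿inverseˡ x)) (K.+-identityʳ y))) ⟩
      z K.* y                       ∎)))
    where
    open SetoidReasoning K.setoid
    0≤y-x : K.0# K.≤ (y K.- x)
    0≤y-x = ≤K-trans (≤K-reflexive (K.sym (K.-‿inverseʳ x))) (K.+-mono-≤ (K.- x) x≤y)

  Σ-cong : ∀ (xs : List A) {f g : A → K.Carrier} → (∀ x → f x K.≈ g x) → K.sumOver xs f K.≈ K.sumOver xs g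
  Σ-cong []       eq = K.refl
  Σ-cong (x ∷ xs) eq = K.+-cong (eq x) (Σ-cong xs eq)

  Σ-mono : ∀ (xs : List A) {f g : A → K.Carrier} → (∀ x → f x K.≤ g x) → K.sumOver xs f K.≤ K.sumOver xs g
  Σ-mono []       le = ≤K-refl
  Σ-mono (x ∷ xs) le = +K-mono (le x) (Σ-mono xs le)

  Σ-* : ∀ (xs : List A) z (f : A → K.Carrier) → K.sumOver xs (λ x → z K.* f x) K.≈ z K.* K.sumOver xs f
  Σ-* []       z f = K.sym (K.zeroʳ z)
  Σ-* (x ∷ xs) z f = K.trans (K.+-congˡ (Σ-* xs z f)) (K.sym (K.distribˡ z (f x) (K.sumOver xs f)))

  Σ-*ʳ : ∀ (xs : List A) z (f : A → K.Carrier) → K.sumOver xs (λ x → f x K.* z) K.≈ K.sumOver xs f K.* z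
  Σ-*ʳ xs z f = K.trans (Σ-cong xs (λ x → K.*-comm (f x) z)) (K.trans (Σ-* xs z f) (K.*-comm z (K.sumOver xs f)))

  Σ-+ : ∀ (xs : List A) (f g : A → K.Carrier) → K.sumOver xs (λ x → f x K.+ g x) K.≈ K.sumOver xs f K.+ K.sumOver xs g
  Σ-+ []       f g = K.sym (K.+-identityˡ K.0#)
  Σ-+ (x ∷ xs) f g = K.trans (K.+-congˡ (Σ-+ xs f g)) (begin
    (f x K.+ g x) K.+ (F K.+ G)  ≈⟨ K.+-assoc (f x) (g x) (F K.+ G) ⟩
    f x K.+ (g x K.+ (F K.+ G))  ≈⟨ K.+-congˡ (K.trans (K.sym (K.+-assoc (g x) F G)) (K.trans (K.+-congʳ (K.+-comm (g x) F)) (K.+-assoc F (g x) G))) ⟩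
    f x K.+ (F K.+ (g x K.+ G))  ≈⟨ K.+-assoc (f x) F (g x K.+ G) ⟨
    (f x K.+ F) K.+ (g x K.+ G)  ∎)
    where
    open SetoidReasoning K.setoid
    F = K.sumOver xs f
    G = K.sumOver xs g

  Σ-0 : ∀ (xs : List A) → K.sumOver xs (const K.0#) K.≈ K.0#
  Σ-0 []       = K.refl
  Σ-0 (x ∷ xs) = K.trans (K.+-identityˡ _) (Σ-0 xs)

  Σ-swap : ∀ (xs : List A) (ys : List B) (f : A → B → K.Carrier) →
    K.sumOver xs (λ x → K.sumOver ys (f x)) K.≈ K.sumOver ys (λ y → K.sumOver xs (λ x → f x y))
  Σ-swap []       ys f = K.sym (Σ-0 ys)
  Σ-swap (x ∷ xs) ys f = K.trans (K.+-congˡ (Σ-swap xs ys f)) (K.sym (Σ-+ ys (f x) (λ y → K.sumOver xs (λ x → f x y))))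

  Σ-++ : ∀ (xs ys : List A) (f : A → K.Carrier) → K.sumOver (xs ++ ys) f K.≈ K.sumOver xs f K.+ K.sumOver ys f
  Σ-++ []       ys f = K.sym (K.+-identityˡ _)
  Σ-++ (x ∷ xs) ys f = K.trans (K.+-congˡ (Σ-++ xs ys f)) (K.sym (K.+-assoc (f x) _ _))

  Σ-map : ∀ (g : A → B) (xs : List A) (f : B → K.Carrier) → K.sumOver (map g xs) f K.≈ K.sumOver xs (f ∘ g)
  Σ-map g []       f = K.refl
  Σ-map g (x ∷ xs) f = K.+-congˡ (Σ-map g xs f)

  Σ-product : ∀ {C : Set} (h : A → B → C) (xs : List A) (ys : List B) (f : C → K.Carrier) →
    K.sumOver (cartesianProductWith h xs ys) f K.≈ K.sumOver xs (λ x → K.sumOver ys (λ y → f (h x y)))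
  Σ-product h []       ys f = K.refl
  Σ-product h (x ∷ xs) ys f = K.trans (Σ-++ (map (h x) ys) _ f) (K.+-cong (Σ-map (h x) ys f) (Σ-product h xs ys f))

  ι-sum : ∀ (xs : List A) (f : A → ℚ) → K.ι (sumℚ xs f) K.≈ K.sumOver xs (K.ι ∘ f)
  ι-sum []       f = ι-0
  ι-sum (x ∷ xs) f = K.trans (ι-+ (f x) (sumℚ xs f)) (K.+-congˡ (ι-sum xs f))

  0≤ι : ∀ {p} → 0ℚ ≤ p → K.0# K.≤ K.ι p
  0≤ι 0≤p = ≤K-trans (≤K-reflexive (K.sym ι-0)) (K.ι-mono-≤ 0≤p)

  -- If `x` were equal to `ι q`, antisymmetry would identify `ι p` with `ι q`, and injectivity `p`
  -- with `q`.
  ≤ι⇒< : ∀ {x p q} → x K.≤ K.ι p → p < q → x K.< K.ι q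
  ≤ι⇒< {x} {p} {q} x≤p p<q = ≤K-trans x≤p (K.ι-mono-≤ (ℚ.<⇒≤ p<q)) , λ x≈q →
    ℚ.<-irrefl (ι-injective (≤K-antisym (K.ι-mono-≤ (ℚ.<⇒≤ p<q)) (≤K-trans (≤K-reflexive (K.sym x≈q)) x≤p))) p<q

-- A potential bound for randomised online algorithms

module Typed (inst : Instance) where
  open Instance inst

  0≤1/Λ : 0ℚ ≤ + 1 / Λ
  0≤1/Λ = ℚ.nonNegative⁻¹ (+ 1 / Λ) {{ℚ.normalize-nonNeg 1 Λ}}

  0≤typeProb : ∀ i → 0ℚ ≤ typeProb i
  0≤typeProb i = 0≤* (rate-nonNeg i) 0≤1/Λ

  sum-typeProb : sumℚ (allFin #I) typeProb ≡ 1ℚ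
  sum-typeProb = begin
    sumℚ (allFin #I) (λ i → rate i * (+ 1 / Λ)) ≡⟨ sum-cong (allFin #I) (λ i → ℚ.*-comm (rate i) (+ 1 / Λ)) ⟩
    sumℚ (allFin #I) (λ i → (+ 1 / Λ) * rate i) ≡⟨ sum-* (allFin #I) (+ 1 / Λ) rate ⟩
    (+ 1 / Λ) * sumℚ (allFin #I) rate           ≡⟨ *-congˡ (+ 1 / Λ) (trans rate-sum (sym (fromℕ≡/1 Λ))) ⟩
    (+ 1 / Λ) * fromℕ Λ                         ≡⟨ trans (ℚ.*-comm (+ 1 / Λ) (fromℕ Λ)) (*-inverse-fromℕ Λ) ⟩
    1ℚ                                          ∎
    where open ≡-Reasoning

  sum-seqProb : ∀ k → sumℚ (allVecs (allFin #I) k) seqProb ≡ 1ℚ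
  sum-seqProb zero    = refl
  sum-seqProb (suc k) = begin
    sumℚ (allVecs (allFin #I) (suc k)) seqProb
      ≡⟨ sum-product _∷_ (allFin #I) (allVecs (allFin #I) k) seqProb ⟩
    sumℚ (allFin #I) (λ i → sumℚ (allVecs (allFin #I) k) (λ t → typeProb i * seqProb t))
      ≡⟨ sum-cong (allFin #I) (λ i → trans (sum-* (allVecs (allFin #I) k) (typeProb i) seqProb)
           (trans (*-congˡ (typeProb i) (sum-seqProb k)) (ℚ.*-identityʳ (typeProb i)))) ⟩
    sumℚ (allFin #I) typeProb
      ≡⟨ sum-typeProb ⟩
    1ℚ ∎
    where open ≡-Reasoning

  available? : ∀ h i j → Dec (Available h i j)
  available? h i j = T? (edge i j) ×-dec ¬? (just j ∈? map proj₂ h)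
    where open DecMembership (Maybe.≡-dec Fin._≟_)

  -- `potential k h` bounds what `k` further arrivals can earn after `h`; `value k h i` bounds it
  -- when a vertex of type `i` has just arrived and `k` more follow. The conditions are rational
  -- inequalities per decision; randomisation only averages over decisions.
  module Potential {c ℓ₁ ℓ₂} (K : OrderedExtension c ℓ₁ ℓ₂) (alg : Algorithm K)
    (potential : ℕ → History → ℚ) (value : ℕ → History → I → ℚ)
    (0≤potential : ∀ h → 0ℚ ≤ potential 0 h)
    (skip : ∀ k h i → potential k ((i , nothing) ∷ h) ≤ value k h i)
    (take : ∀ k h i j → Available h i j → weight i j + potential k ((i , just j) ∷ h) ≤ value k h i)
    (average : ∀ k h → sumℚ (allFin #I) (λ i → typeProb i * value k h i) ≤ potential (suc k) h)
    where
    private module K = OrderedExtension K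
    open Extension K
    open Algorithm alg
    open SetoidReasoning K.setoid

    reward : ℕ → History → K.Carrier
    reward k h = K.sumOver (allVecs (allFin #I) k) (λ t → K.ι (seqProb t) K.* rewardFrom h t)

    branch : ℕ → History → I → K.Carrier
    branch k h i = K.sumOver decisions (λ d → choose h i d K.* (K.ι (gain i d) K.+ reward k ((i , d) ∷ h)))

    -- Here the algorithm being online is used: the probabilities of the decision for the first
    -- vertex are the same for all continuations `t`, so the sums over `t` and over decisions can be
    -- exchanged.
    branch-expand : ∀ k h i →
      K.sumOver (allVecs (allFin #I) k) (λ t → K.ι (seqProb (i ∷ t)) K.* rewardFrom h (i ∷ t)) K.≈ K.ι (typeProb i) K.* branch k h i
    branch-expand k h i = begin
      K.sumOver ts (λ t → K.ι (typeProb i * seqProb t) K.* D t)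
        ≈⟨ Σ-cong ts (λ t → K.trans (K.*-congʳ (ι-* (typeProb i) (seqProb t))) (K.*-assoc p (q t) (D t))) ⟩
      K.sumOver ts (λ t → p K.* (q t K.* D t))
        ≈⟨ Σ-* ts p _ ⟩
      p K.* K.sumOver ts (λ t → q t K.* D t)
        ≈⟨ K.*-congˡ (begin
          K.sumOver ts (λ t → q t K.* K.sumOver decisions (λ d → choose h i d K.* (K.ι (gain i d) K.+ r d t)))
            ≈⟨ Σ-cong ts (λ t → K.sym (Σ-* decisions (q t) _)) ⟩
          K.sumOver ts (λ t → K.sumOver decisions (λ d → q t K.* (choose h i d K.* (K.ι (gain i d) K.+ r d t))))
            ≈⟨ Σ-swap ts decisions _ ⟩
          K.sumOver decisions (λ d → K.sumOver ts (λ t → q t K.* (choose h i d K.* (K.ι (gain i d) K.+ r d t))))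
            ≈⟨ Σ-cong decisions (λ d → begin
              K.sumOver ts (λ t → q t K.* (choose h i d K.* (K.ι (gain i d) K.+ r d t)))
                ≈⟨ Σ-cong ts (λ t → K.trans (K.sym (K.*-assoc (q t) (choose h i d) _))
                     (K.trans (K.*-congʳ (K.*-comm (q t) (choose h i d))) (K.*-assoc (choose h i d) (q t) _))) ⟩
              K.sumOver ts (λ t → choose h i d K.* (q t K.* (K.ι (gain i d) K.+ r d t)))
                ≈⟨ Σ-* ts (choose h i d) _ ⟩
              choose h i d K.* K.sumOver ts (λ t → q t K.* (K.ι (gain i d) K.+ r d t))
                ≈⟨ K.*-congˡ (K.trans (Σ-cong ts (λ t → K.distribˡ (q t) (K.ι (gain i d)) (r d t))) (Σ-+ ts _ _)) ⟩
              choose h i d K.* (K.sumOver ts (λ t → q t K.* K.ι (gain i d)) K.+ reward k ((i , d) ∷ h))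
                ≈⟨ K.*-congˡ (K.+-congʳ (K.trans (Σ-*ʳ ts (K.ι (gain i d)) q) (K.trans (K.*-congʳ total-1) (K.*-identityˡ (K.ι (gain i d)))))) ⟩
              choose h i d K.* (K.ι (gain i d) K.+ reward k ((i , d) ∷ h)) ∎) ⟩
          branch k h i ∎) ⟩
      p K.* branch k h i ∎
      where
      ts = allVecs (allFin #I) k
      p = K.ι (typeProb i)
      q : Vec I k → K.Carrier
      q t = K.ι (seqProb t)
      D : Vec I k → K.Carrier
      D t = rewardFrom h (i ∷ t)
      r : Decision → Vec I k → K.Carrier
      r d t = rewardFrom ((i , d) ∷ h) t
      total-1 : K.sumOver ts q K.≈ K.1#
      total-1 = K.trans (K.sym (ι-sum ts seqProb)) (K.trans (ι-cong (sum-seqProb k)) ι-1)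

    reward-suc : ∀ k h → reward (suc k) h K.≈ K.sumOver (allFin #I) (λ i → K.ι (typeProb i) K.* branch k h i)
    reward-suc k h = K.trans (Σ-product _∷_ (allFin #I) (allVecs (allFin #I) k) _) (Σ-cong (allFin #I) (branch-expand k h))

    reward≤potential : ∀ k h → reward k h K.≤ K.ι (potential k h)
    reward≤potential zero h = ≤K-trans (≤K-reflexive (K.trans (K.+-identityʳ _) (K.zeroʳ _))) (0≤ι (0≤potential h))
    reward≤potential (suc k) h = ≤K-trans (≤K-reflexive (reward-suc k h))
      (≤K-trans (Σ-mono (allFin #I) (λ i → *K-monoˡ (0≤ι (0≤typeProb i)) (branch≤ i)))
      (≤K-trans (≤K-reflexive (K.sym (K.trans (ι-sum (allFin #I) _) (Σ-cong (allFin #I) (λ i → ι-* (typeProb i) (value k h i))))))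
        (K.ι-mono-≤ (average k h))))
      where
      option : ∀ i d → (choose h i d K.* (K.ι (gain i d) K.+ reward k ((i , d) ∷ h))) K.≤ (choose h i d K.* K.ι (value k h i))
      option i nothing = *K-monoˡ (choose-nonNeg h i nothing)
        (≤K-trans (+K-mono (≤K-reflexive ι-0) (reward≤potential k ((i , nothing) ∷ h)))
          (≤K-trans (≤K-reflexive (K.+-identityˡ _)) (K.ι-mono-≤ (skip k h i))))
      option i (just j) with available? h i j
      ... | yes av = *K-monoˡ (choose-nonNeg h i (just j))
        (≤K-trans (+K-mono ≤K-refl (reward≤potential k ((i , just j) ∷ h)))
          (≤K-trans (≤K-reflexive (K.sym (ι-+ _ _))) (K.ι-mono-≤ (take k h i j av))))
      ... | no ¬av = ≤K-reflexive (K.trans (vanish _) (K.sym (vanish _)))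
        where
        vanish : ∀ x → choose h i (just j) K.* x K.≈ K.0#
        vanish x = K.trans (K.*-congʳ (choose-avail h i j ¬av)) (K.zeroˡ x)
      branch≤ : ∀ i → branch k h i K.≤ K.ι (value k h i)
      branch≤ i = ≤K-trans (Σ-mono decisions (option i))
        (≤K-reflexive (K.trans (Σ-*ʳ decisions (K.ι (value k h i)) (choose h i))
          (K.trans (K.*-congʳ (choose-sum h i)) (K.*-identityˡ (K.ι (value k h i))))))

    expectedALG≤potential : expectedALG K.≤ K.ι (potential Λ [])
    expectedALG≤potential = reward≤potential Λ []

-- The hard instance

sum-allFin-+ : ∀ m n (f : Fin (m ℕ.+ n) → ℚ) →
  sumℚ (allFin (m ℕ.+ n)) f ≡ sumℚ (allFin m) (λ x → f (x ↑ˡ n)) + sumℚ (allFin n) (λ y → f (m ↑ʳ y))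
sum-allFin-+ zero    n f = sym (ℚ.+-identityˡ _)
sum-allFin-+ (suc m) n f = begin
  sumℚ (allFin (suc m ℕ.+ n)) f
    ≡⟨ sum-allFin-suc (m ℕ.+ n) f ⟩
  f zero + sumℚ (allFin (m ℕ.+ n)) (f ∘ suc)
    ≡⟨ +-congˡ (f zero) (sum-allFin-+ m n (f ∘ suc)) ⟩
  f zero + (sumℚ (allFin m) (λ x → f (suc (x ↑ˡ n))) + R)
    ≡⟨ ℚ.+-assoc (f zero) _ R ⟨
  (f zero + sumℚ (allFin m) (λ x → f (suc (x ↑ˡ n)))) + R
    ≡⟨ +-congʳ R (sym (sum-allFin-suc m (λ x → f (x ↑ˡ n)))) ⟩
  sumℚ (allFin (suc m)) (λ x → f (x ↑ˡ n)) + R ∎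
  where
  open ≡-Reasoning
  R = sumℚ (allFin n) (λ y → f (suc m ↑ʳ y))

sum-allFin-* : ∀ m n (f : Fin (m ℕ.* n) → ℚ) →
  sumℚ (allFin (m ℕ.* n)) f ≡ sumℚ (allFin m) (λ x → sumℚ (allFin n) (λ y → f (combine x y)))
sum-allFin-* zero    n f = refl
sum-allFin-* (suc m) n f = begin
  sumℚ (allFin (n ℕ.+ m ℕ.* n)) f
    ≡⟨ sum-allFin-+ n (m ℕ.* n) f ⟩
  sumℚ (allFin n) (λ y → f (y ↑ˡ (m ℕ.* n))) + sumℚ (allFin (m ℕ.* n)) (λ z → f (n ↑ʳ z))
    ≡⟨ +-congˡ (sumℚ (allFin n) (λ y → f (y ↑ˡ (m ℕ.* n)))) (sum-allFin-* m n (λ z → f (n ↑ʳ z))) ⟩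
  sumℚ (allFin n) (λ y → f (y ↑ˡ (m ℕ.* n))) + sumℚ (allFin m) (λ x → sumℚ (allFin n) (λ y → f (n ↑ʳ combine x y)))
    ≡⟨ sym (sum-allFin-suc m (λ x → sumℚ (allFin n) (λ y → f (combine x y)))) ⟩
  sumℚ (allFin (suc m)) (λ x → sumℚ (allFin n) (λ y → f (combine x y))) ∎
  where open ≡-Reasoning

uniform : ∀ n {{_ : NonZero n}} → Mean (Fin n)
uniform n = record
  { dist   = map (λ j → + 1 / n , j) (allFin n)
  ; nonNeg = All.map⁺ (nonNegative (allFin n))
  ; total  = trans (sum-map _ (allFin n) proj₁) (trans (sum-const (allFin n) (+ 1 / n))
      (trans (cong (λ k → fromℕ k * (+ 1 / n)) (List.length-tabulate {n = n} id)) (*-inverse-fromℕ n)))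
  }
  where
  nonNegative : (xs : List (Fin n)) → All (λ _ → 0ℚ ≤ + 1 / n) xs
  nonNegative []       = []
  nonNegative (x ∷ xs) = ℚ.nonNegative⁻¹ (+ 1 / n) {{ℚ.normalize-nonNeg 1 n}} ∷ nonNegative xs

E-uniform : ∀ n {{_ : NonZero n}} f → E (uniform n) f ≡ (+ 1 / n) * sumℚ (allFin n) f
E-uniform n f = trans (sum-map _ (allFin n) _) (sum-* (allFin n) (+ 1 / n) f)

-- The kinds are listed by increasing weight, so the index of a kind serves as its level.
Kind : Set
Kind = Fin 4

pattern global = zero
pattern triple = suc zero
pattern single = suc (suc zero)
pattern heavy  = suc (suc (suc zero))

kindWeight : Kind → ℚ
kindWeight global = 1ℚ
kindWeight triple = + 27 / 25
kindWeight single = + 5 / 4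
kindWeight heavy  = + 10000 / 1

-- rate of a kind relative to n / 100
kindRate : Kind → ℚ
kindRate global = + 1699 / 100
kindRate triple = + 66 / 1
kindRate single = + 20 / 1
kindRate heavy  = + 1 / 100

kindProb : Kind → ℚ
kindProb κ = kindRate κ * (+ 1 / 103)

-- n = 100 s and Λ = 103 s are kept abstract because they are astronomically large.
module Hard (s n Λ : ℕ) {{_ : NonZero n}} {{_ : NonZero Λ}}
  (n≡ : fromℕ n ≡ (+ 100 / 1) * fromℕ s) (Λ≡ : fromℕ Λ ≡ (+ 103 / 1) * fromℕ s) where

  1/n : ℚ
  1/n = + 1 / n

  I J : Set
  I = Fin (4 ℕ.* (n ℕ.* (n ℕ.* n)))
  J = Fin n

  Code : Set
  Code = Kind × (J × (J × J))

  -- An online type is a kind together with three offline vertices, of which it uses none, one or all.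
  encode : Code → I
  encode (κ , a , b , c) = combine κ (combine a (combine b c))

  decode₂ : J × Fin (n ℕ.* n) → J × (J × J)
  decode₂ (a , bc) = a , remQuot n bc

  decode₁ : Kind × Fin (n ℕ.* (n ℕ.* n)) → Code
  decode₁ (κ , abc) = κ , decode₂ (remQuot (n ℕ.* n) abc)

  decode : I → Code
  decode i = decode₁ (remQuot (n ℕ.* (n ℕ.* n)) i)

  decode-encode : ∀ x → decode (encode x) ≡ x
  decode-encode (κ , a , b , c) = trans (cong decode₁ (Fin.remQuot-combine κ (combine a (combine b c))))
    (trans (cong (λ z → κ , decode₂ z) (Fin.remQuot-combine a (combine b c)))
      (cong (λ z → κ , a , z) (Fin.remQuot-combine b c)))

  neighbours : Code → List J
  neighbours (global , _)         = allFin n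
  neighbours (triple , a , b , c) = a ∷ b ∷ c ∷ []
  neighbours (single , a , _)     = a ∷ []
  neighbours (heavy  , a , _)     = a ∷ []

  kind : I → Kind
  kind i = proj₁ (decode i)

  nb : I → List J
  nb i = neighbours (decode i)

  lev : I → ℕ
  lev i = toℕ (kind i)

  sum-types : ∀ (f : I → ℚ) → sumℚ (allFin (4 ℕ.* (n ℕ.* (n ℕ.* n)))) f ≡
    sumℚ (allFin 4) (λ κ → sumℚ (allFin n) (λ a → sumℚ (allFin n) (λ b → sumℚ (allFin n) (λ c → f (encode (κ , a , b , c))))))
  sum-types f = trans (sum-allFin-* 4 (n ℕ.* (n ℕ.* n)) f) (sum-cong (allFin 4) {λ κ → sumℚ (allFin (n ℕ.* (n ℕ.* n))) (λ y → f (combine κ y))} (λ κ →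
    trans (sum-allFin-* n (n ℕ.* n) (λ y → f (combine κ y))) (sum-cong (allFin n) (λ a →
      sum-allFin-* n n (λ y → f (combine κ (combine a y)))))))

  scale : Kind → ℚ
  scale κ = kindRate κ * fromℕ s

  -- The rate of a kind is spread evenly over all `n`³ choices of three vertices; coordinates that
  -- the kind ignores are averaged out again.
  rate : I → ℚ
  rate i = scale (kind i) * (1/n * (1/n * 1/n))

  𝒰 : Mean J
  𝒰 = uniform n

  𝒰³ : (J × (J × J) → ℚ) → ℚ
  𝒰³ f = E 𝒰 (λ a → E 𝒰 (λ b → E 𝒰 (λ c → f (a , b , c))))

  0≤1/n : 0ℚ ≤ 1/n
  0≤1/n = ℚ.nonNegative⁻¹ 1/n {{ℚ.normalize-nonNeg 1 n}}

  sum-rate : ∀ (f : Code → ℚ) → sumℚ (allFin (4 ℕ.* (n ℕ.* (n ℕ.* n)))) (λ i → rate i * f (decode i)) ≡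
    sumℚ (allFin 4) (λ κ → scale κ * 𝒰³ (λ abc → f (κ , abc)))
  sum-rate f = trans (sum-types (λ i → rate i * f (decode i))) (sum-cong (allFin 4) {f = λ κ → S (λ a → S (λ b → S (λ c → rate (encode (κ , a , b , c)) * f (decode (encode (κ , a , b , c))))))} each)
    where
    open ≡-Reasoning
    S : (J → ℚ) → ℚ
    S = sumℚ (allFin n)
    pull : ∀ k (g : J → ℚ) → S (λ x → (k * 1/n) * g x) ≡ k * E 𝒰 g
    pull k g = begin
      S (λ x → (k * 1/n) * g x)  ≡⟨ sum-cong (allFin n) (λ x → ℚ.*-assoc k 1/n (g x)) ⟩
      S (λ x → k * (1/n * g x))  ≡⟨ sum-* (allFin n) k (λ x → 1/n * g x) ⟩
      k * S (λ x → 1/n * g x)    ≡⟨ *-congˡ k (trans (sum-* (allFin n) 1/n g) (sym (E-uniform n g))) ⟩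
      k * E 𝒰 g                  ∎
    shuffle : ∀ x i y → (x * (i * (i * i))) * y ≡ (((x * i) * i) * i) * y
    shuffle = solve-∀ ℚ-ring
    each : ∀ κ → S (λ a → S (λ b → S (λ c → rate (encode (κ , a , b , c)) * f (decode (encode (κ , a , b , c)))))) ≡ scale κ * 𝒰³ (λ abc → f (κ , abc))
    each κ = begin
      S (λ a → S (λ b → S (λ c → rate (encode (κ , a , b , c)) * f (decode (encode (κ , a , b , c))))))
        ≡⟨ sum-cong (allFin n) (λ a → sum-cong (allFin n) (λ b → sum-cong (allFin n) (λ c →
             trans (cong (λ x → (scale (proj₁ x) * (1/n * (1/n * 1/n))) * f x) (decode-encode (κ , a , b , c)))
                   (shuffle (scale κ) 1/n (f (κ , a , b , c)))))) ⟩
      S (λ a → S (λ b → S (λ c → (((scale κ * 1/n) * 1/n) * 1/n) * f (κ , a , b , c))))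
        ≡⟨ sum-cong (allFin n) (λ a → sum-cong (allFin n) (λ b → pull ((scale κ * 1/n) * 1/n) (λ c → f (κ , a , b , c)))) ⟩
      S (λ a → S (λ b → ((scale κ * 1/n) * 1/n) * E 𝒰 (λ c → f (κ , a , b , c))))
        ≡⟨ sum-cong (allFin n) (λ a → pull (scale κ * 1/n) (λ b → E 𝒰 (λ c → f (κ , a , b , c)))) ⟩
      S (λ a → (scale κ * 1/n) * E 𝒰 (λ b → E 𝒰 (λ c → f (κ , a , b , c))))
        ≡⟨ pull (scale κ) (λ a → E 𝒰 (λ b → E 𝒰 (λ c → f (κ , a , b , c)))) ⟩
      scale κ * 𝒰³ (λ abc → f (κ , abc)) ∎

  0≤kindRate : ∀ κ → 0ℚ ≤ kindRate κ
  0≤kindRate global = ℚ.nonNegative⁻¹ _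
  0≤kindRate triple = ℚ.nonNegative⁻¹ _
  0≤kindRate single = ℚ.nonNegative⁻¹ _
  0≤kindRate heavy  = ℚ.nonNegative⁻¹ _

  0<kindWeight : ∀ κ → 0ℚ < kindWeight κ
  0<kindWeight global = ℚ.positive⁻¹ _
  0<kindWeight triple = ℚ.positive⁻¹ _
  0<kindWeight single = ℚ.positive⁻¹ _
  0<kindWeight heavy  = ℚ.positive⁻¹ _

  total-rate : sumℚ (allFin (4 ℕ.* (n ℕ.* (n ℕ.* n)))) rate ≡ + Λ / 1
  total-rate = begin
    sumℚ (allFin (4 ℕ.* (n ℕ.* (n ℕ.* n)))) rate
      ≡⟨ sum-cong (allFin (4 ℕ.* (n ℕ.* (n ℕ.* n)))) (λ i → sym (ℚ.*-identityʳ (rate i))) ⟩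
    sumℚ (allFin (4 ℕ.* (n ℕ.* (n ℕ.* n)))) (λ i → rate i * 1ℚ)
      ≡⟨ sum-rate (const 1ℚ) ⟩
    sumℚ (allFin 4) (λ κ → scale κ * 𝒰³ (const 1ℚ))
      ≡⟨ sum-cong (allFin 4) (λ κ → trans (*-congˡ (scale κ) 𝒰³-1) (ℚ.*-identityʳ (scale κ))) ⟩
    kindRate global * fromℕ s + (kindRate triple * fromℕ s + (kindRate single * fromℕ s + (kindRate heavy * fromℕ s + 0ℚ)))
      ≡⟨ collect (fromℕ s) ⟩
    (+ 103 / 1) * fromℕ s
      ≡⟨ trans (sym Λ≡) (fromℕ≡/1 Λ) ⟩
    + Λ / 1 ∎
    where
    open ≡-Reasoning
    𝒰³-1 : 𝒰³ (const 1ℚ) ≡ 1ℚ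
    𝒰³-1 = trans (E-cong 𝒰 (λ a → trans (E-cong 𝒰 (λ b → E-const 𝒰 1ℚ)) (E-const 𝒰 1ℚ))) (E-const 𝒰 1ℚ)
    collect : ∀ x → kindRate global * x + (kindRate triple * x + (kindRate single * x + (kindRate heavy * x + 0ℚ))) ≡ (+ 103 / 1) * x
    collect = solve-∀ ℚ-ring

  inst : Instance
  inst = record
    { #I = 4 ℕ.* (n ℕ.* (n ℕ.* n))
    ; #J = n
    ; edge = λ i j → ⌊ j ∈? nb i ⌋
    ; weight = λ i j → kindWeight (kind i)
    ; weight-pos = λ i j _ → 0<kindWeight (kind i)
    ; Λ = Λ
    ; rate = rate
    ; rate-nonNeg = λ i → 0≤* (0≤* (0≤kindRate (kind i)) (0≤fromℕ s)) (0≤* 0≤1/n (0≤* 0≤1/n 0≤1/n))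
    ; rate-sum = total-rate
    }
    where open DecMembership Fin._≟_ using (_∈?_)

-- Lower bound for the optimum

bit : Bool → ℚ
bit true  = 1ℚ
bit false = 0ℚ

bit-∧ : ∀ x y → bit (x ∧ y) ≡ bit x * bit y
bit-∧ true  y = sym (ℚ.*-identityˡ (bit y))
bit-∧ false y = sym (ℚ.*-zeroˡ (bit y))

sum-bits : ∀ {n} (C : Subset n) → sumℚ (allFin n) (λ j → bit (lookup C j)) ≡ fromℕ (size C)
sum-bits []          = refl
sum-bits (true  ∷ C) = trans (sum-allFin-suc _ (λ j → bit (lookup (true ∷ C) j))) (+-congˡ 1ℚ (sum-bits C))
sum-bits (false ∷ C) = trans (sum-allFin-suc _ (λ j → bit (lookup (false ∷ C) j))) (trans (ℚ.+-identityˡ _) (sum-bits C))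

E-sequence-map : ∀ {A B : Set} (g : A → B) (M : Mean A) k (f : List B → ℚ) →
  E (sequence (replicate k M)) (λ ts → f (map g ts)) ≡ E (sequence (replicate k (mapMean g M))) f
E-sequence-map {A} {B} g M zero f = trans (E-pointMean {A = List A} [] (λ ts → f (map g ts))) (sym (E-pointMean {A = List B} [] f))
E-sequence-map g M (suc k) f = begin
  E (sequence (M ∷ replicate k M)) (λ ts → f (map g ts))
    ≡⟨ E-sequence M (replicate k M) _ ⟩
  E M (λ x → E (sequence (replicate k M)) (λ ts → f (g x ∷ map g ts)))
    ≡⟨ E-cong M (λ x → E-sequence-map g M k (λ us → f (g x ∷ us))) ⟩
  E M (λ x → E (sequence (replicate k (mapMean g M))) (λ us → f (g x ∷ us)))
    ≡⟨ E-mapMean g M (λ y → E (sequence (replicate k (mapMean g M))) (λ us → f (y ∷ us))) ⟨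
  E (mapMean g M) (λ y → E (sequence (replicate k (mapMean g M))) (λ us → f (y ∷ us)))
    ≡⟨ E-sequence (mapMean g M) (replicate k (mapMean g M)) f ⟨
  E (sequence (replicate (suc k) (mapMean g M))) f ∎
  where open ≡-Reasoning

∈⇒≤max : ∀ {A : Set} (f : A → ℚ) {x} {xs : List A} → x ∈ xs → f x ≤ foldr ℚ._⊔_ 0ℚ (map f xs)
∈⇒≤max f {xs = y ∷ xs} (here refl) = ℚ.p≤p⊔q (f y) _
∈⇒≤max f {xs = y ∷ xs} (there p)   = ℚ.≤-trans (∈⇒≤max f p) (ℚ.p≤q⊔p (f y) _)

∈-allVecs : ∀ {A : Set} {xs : List A} → (∀ x → x ∈ xs) → ∀ {k} (v : Vec A k) → v ∈ allVecs xs k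
∈-allVecs all []      = here refl
∈-allVecs all (x ∷ v) = ∈.∈-cartesianProductWith⁺ _∷_ (all x) (∈-allVecs all v)

module Optimum (s n Λ : ℕ) {{_ : NonZero n}} {{_ : NonZero Λ}}
  (n≡ : fromℕ n ≡ (+ 100 / 1) * fromℕ s) (Λ≡ : fromℕ Λ ≡ (+ 103 / 1) * fromℕ s) where
  open Hard s n Λ n≡ Λ≡ public
  open Typed inst public using (0≤typeProb; sum-typeProb)
  open Rank n hiding (J)
  open Process n hiding (0≤1/n)
  open Levels n nb lev
  open Instance inst using (typeProb; seqProb; matchingWeight; maxMatchingWeight; expectedOPT; IsMatching; isMatching?; decisions; gain)

  types : List I
  types = allFin (4 ℕ.* (n ℕ.* (n ℕ.* n)))

  typeMean : Mean I
  typeMean = record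
    { dist   = map (λ i → typeProb i , i) types
    ; nonNeg = All.map⁺ (nonNegative types)
    ; total  = trans (sum-map (λ i → typeProb i , i) types proj₁) sum-typeProb
    }
    where
    nonNegative : (is : List I) → All (λ i → 0ℚ ≤ typeProb i) is
    nonNegative []       = []
    nonNegative (i ∷ is) = 0≤typeProb i ∷ nonNegative is

  scale-Λ : ∀ κ → (+ 1 / Λ) * scale κ ≡ kindProb κ
  scale-Λ κ = begin
    (+ 1 / Λ) * (kindRate κ * fromℕ s)
      ≡⟨ lemma (+ 1 / Λ) (kindRate κ) (fromℕ s) ⟩
    (kindRate κ * (+ 1 / 103)) * (((+ 103 / 1) * fromℕ s) * (+ 1 / Λ))
      ≡⟨ *-congˡ (kindProb κ) (trans (cong (_* (+ 1 / Λ)) (sym Λ≡)) (*-inverse-fromℕ Λ)) ⟩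
    kindProb κ * 1ℚ
      ≡⟨ ℚ.*-identityʳ (kindProb κ) ⟩
    kindProb κ ∎
    where
    open ≡-Reasoning
    lemma : ∀ i x s → i * (x * s) ≡ (x * (+ 1 / 103)) * (((+ 103 / 1) * s) * i)
    lemma = solve-∀ ℚ-ring

  byKind : (Kind → ℚ) → ℚ
  byKind x = kindProb global * x global + (kindProb triple * x triple + (kindProb single * x single + (kindProb heavy * x heavy + 0ℚ)))

  E-typeMean : ∀ f → E typeMean f ≡ sumℚ types (λ i → typeProb i * f i)
  E-typeMean f = sum-map (λ i → typeProb i , i) types _

  E-type : ∀ (f : Code → ℚ) → E typeMean (f ∘ decode) ≡ byKind (λ κ → 𝒰³ (λ abc → f (κ , abc)))
  E-type f = begin
    E typeMean (f ∘ decode)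
      ≡⟨ E-typeMean (f ∘ decode) ⟩
    sumℚ types (λ i → (rate i * (+ 1 / Λ)) * f (decode i))
      ≡⟨ sum-cong types (λ i → lemma (rate i) (+ 1 / Λ) (f (decode i))) ⟩
    sumℚ types (λ i → (+ 1 / Λ) * (rate i * f (decode i)))
      ≡⟨ sum-* types (+ 1 / Λ) (λ i → rate i * f (decode i)) ⟩
    (+ 1 / Λ) * sumℚ types (λ i → rate i * f (decode i))
      ≡⟨ *-congˡ (+ 1 / Λ) (sum-rate f) ⟩
    (+ 1 / Λ) * sumℚ (allFin 4) (λ κ → scale κ * x κ)
      ≡⟨ sym (sum-* (allFin 4) (+ 1 / Λ) (λ κ → scale κ * x κ)) ⟩
    sumℚ (allFin 4) (λ κ → (+ 1 / Λ) * (scale κ * x κ))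
      ≡⟨ sum-cong (allFin 4) {f = λ κ → (+ 1 / Λ) * (scale κ * x κ)} (λ κ → trans (sym (ℚ.*-assoc (+ 1 / Λ) (scale κ) (x κ))) (cong (_* x κ) (scale-Λ κ))) ⟩
    byKind x ∎
    where
    open ≡-Reasoning
    x : Kind → ℚ
    x κ = 𝒰³ (λ abc → f (κ , abc))
    lemma : ∀ r i y → (r * i) * y ≡ i * (r * y)
    lemma = solve-∀ ℚ-ring

  leaf : Hyperedge → Subset n → ℚ
  leaf e C = fromℕ (leaves e C)

  leaf≡ : ∀ e C → leaf e C ≡ 1ℚ - bit (inside e C)
  leaf≡ e C with inside e C
  ... | true  = refl
  ... | false = refl

  E-bit : ∀ C → E 𝒰 (λ j → bit (lookup C j)) ≡ coverage C
  E-bit C = trans (E-uniform n (λ j → bit (lookup C j))) (trans (*-congˡ 1/n (sum-bits C)) (ℚ.*-comm 1/n (fromℕ (size C))))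

  E-one-minus : ∀ {A : Set} (M : Mean A) f → E M (λ x → 1ℚ - f x) ≡ 1ℚ - E M f
  E-one-minus M f = trans (E-minus M (const 1ℚ) f) (cong (_- E M f) (E-const M 1ℚ))

  E-loop : ∀ C → E 𝒰 (λ a → leaf (a ∷ []) C) ≡ 1ℚ - coverage C
  E-loop C = begin
    E 𝒰 (λ a → leaf (a ∷ []) C)         ≡⟨ E-cong 𝒰 (λ a → trans (leaf≡ (a ∷ []) C) (cong (λ z → 1ℚ - z) (trans (bit-∧ (lookup C a) true) (ℚ.*-identityʳ (bit (lookup C a)))))) ⟩
    E 𝒰 (λ a → 1ℚ - bit (lookup C a))   ≡⟨ E-one-minus 𝒰 (λ a → bit (lookup C a)) ⟩
    1ℚ - E 𝒰 (λ a → bit (lookup C a))   ≡⟨ cong (λ z → 1ℚ - z) (E-bit C) ⟩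
    1ℚ - coverage C ∎
    where open ≡-Reasoning

  𝒰³-first : ∀ (f : J → ℚ) → 𝒰³ (λ abc → f (proj₁ abc)) ≡ E 𝒰 f
  𝒰³-first f = E-cong 𝒰 (λ a → trans (E-cong 𝒰 (λ b → E-const 𝒰 (f a))) (E-const 𝒰 (f a)))

  E-triple : ∀ C → 𝒰³ (λ abc → leaf (neighbours (triple , abc)) C) ≡ 1ℚ - coverage C * (coverage C * coverage C)
  E-triple C = begin
    𝒰³ (λ abc → leaf (neighbours (triple , abc)) C)
      ≡⟨ E-cong 𝒰 (λ a → E-cong 𝒰 (λ b → E-cong 𝒰 (λ c → trans (leaf≡ (a ∷ b ∷ c ∷ []) C) (cong (λ z → 1ℚ - z) (product a b c))))) ⟩
    E 𝒰 (λ a → E 𝒰 (λ b → E 𝒰 (λ c → 1ℚ - (β a * β b) * β c)))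
      ≡⟨ E-cong 𝒰 (λ a → E-cong 𝒰 (λ b → trans (E-one-minus 𝒰 _) (cong (λ z → 1ℚ - z) (trans (E-* 𝒰 (β a * β b) β) (*-congˡ (β a * β b) (E-bit C)))))) ⟩
    E 𝒰 (λ a → E 𝒰 (λ b → 1ℚ - (β a * β b) * y))
      ≡⟨ E-cong 𝒰 (λ a → trans (E-one-minus 𝒰 (λ b → (β a * β b) * y)) (cong (λ z → 1ℚ - z) (trans (E-cong 𝒰 (λ b → swap (β a) (β b) y)) (trans (E-* 𝒰 (β a * y) β) (*-congˡ (β a * y) (E-bit C)))))) ⟩
    E 𝒰 (λ a → 1ℚ - (β a * y) * y)
      ≡⟨ trans (E-one-minus 𝒰 (λ a → (β a * y) * y)) (cong (λ z → 1ℚ - z) (trans (E-cong 𝒰 (λ a → turn (β a) y)) (trans (E-* 𝒰 (y * y) β) (*-congˡ (y * y) (E-bit C))))) ⟩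
    1ℚ - (y * y) * y
      ≡⟨ cong (λ z → 1ℚ - z) (ℚ.*-assoc y y y) ⟩
    1ℚ - y * (y * y) ∎
    where
    open ≡-Reasoning
    y = coverage C
    β : J → ℚ
    β j = bit (lookup C j)
    product : ∀ a b c → bit (inside (a ∷ b ∷ c ∷ []) C) ≡ (β a * β b) * β c
    product a b c = trans (bit-∧ (lookup C a) _) (trans (*-congˡ (β a) (trans (bit-∧ (lookup C b) _) (*-congˡ (β b) (trans (bit-∧ (lookup C c) true) (ℚ.*-identityʳ (β c))))))
      (sym (ℚ.*-assoc (β a) (β b) (β c))))
    swap : ∀ a b y → (a * b) * y ≡ (a * y) * b
    swap = solve-∀ ℚ-ring
    turn : ∀ a y → (a * y) * y ≡ (y * y) * a
    turn = solve-∀ ℚ-ring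

  -- The probability that a random arrival of the kind leaves `C`. For globals it is 0 or 1,
  -- according to whether `C` is all of `J`.
  kindLeaf : Subset n → Kind → ℚ
  kindLeaf C global = leaf (allFin n) C
  kindLeaf C triple = 1ℚ - coverage C * (coverage C * coverage C)
  kindLeaf C single = 1ℚ - coverage C
  kindLeaf C heavy  = 1ℚ - coverage C

  𝒰³-leaf : ∀ C κ → 𝒰³ (λ abc → leaf (neighbours (κ , abc)) C) ≡ kindLeaf C κ
  𝒰³-leaf C global = trans (E-cong 𝒰 (λ a → trans (E-cong 𝒰 (λ b → E-const 𝒰 (leaf (allFin n) C))) (E-const 𝒰 (leaf (allFin n) C)))) (E-const 𝒰 (leaf (allFin n) C))
  𝒰³-leaf C triple = E-triple C
  𝒰³-leaf C single = trans (𝒰³-first (λ a → leaf (a ∷ []) C)) (E-loop C)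
  𝒰³-leaf C heavy  = trans (𝒰³-first (λ a → leaf (a ∷ []) C)) (E-loop C)

  byKind-cong : ∀ {x y} → (∀ κ → x κ ≡ y κ) → byKind x ≡ byKind y
  byKind-cong eq = cong₂ _+_ (*-congˡ (kindProb global) (eq global)) (cong₂ _+_ (*-congˡ (kindProb triple) (eq triple))
    (cong₂ _+_ (*-congˡ (kindProb single) (eq single)) (+-congʳ 0ℚ (*-congˡ (kindProb heavy) (eq heavy)))))

  𝒰³-* : ∀ c f → 𝒰³ (λ abc → c * f abc) ≡ c * 𝒰³ f
  𝒰³-* c f = trans (E-cong 𝒰 (λ a → trans (E-cong 𝒰 (λ b → E-* 𝒰 c _)) (E-* 𝒰 c _))) (E-* 𝒰 c _)

  E-weighted-leaf : ∀ (x : Kind → ℚ) C → E typeMean (λ i → x (kind i) * leaf (nb i) C) ≡ byKind (λ κ → x κ * kindLeaf C κ)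
  E-weighted-leaf x C = trans (E-type (λ code → x (proj₁ code) * leaf (neighbours code) C))
    (byKind-cong (λ κ → trans (𝒰³-* (x κ) (λ abc → leaf (neighbours (κ , abc)) C)) (*-congˡ (x κ) (𝒰³-leaf C κ))))

  reaches : ℕ → Kind → ℚ
  reaches l κ = bit (l ℕ.≤ᵇ toℕ κ)

  levelMean : ℕ → Mean Hyperedge
  levelMean l = mapMean (atLevel l) typeMean

  E-levelMean : ∀ l C → E (levelMean l) (λ e → leaf e C) ≡ byKind (λ κ → reaches l κ * kindLeaf C κ)
  E-levelMean l C = trans (E-mapMean (atLevel l) typeMean (λ e → leaf e C)) (trans (E-cong typeMean split) (E-weighted-leaf (reaches l) C))
    where
    split : ∀ i → leaf (atLevel l i) C ≡ reaches l (kind i) * leaf (nb i) C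
    split i with l ℕ.≤ᵇ toℕ (kind i)
    ... | true  = sym (ℚ.*-identityˡ (leaf (nb i) C))
    ... | false = sym (ℚ.*-zeroˡ (leaf (nb i) C))

  1-cov : Subset n → ℚ
  1-cov C = 1ℚ - coverage C

  0≤1-cov : ∀ C → 0ℚ ≤ 1-cov C
  0≤1-cov C = p≤q⇒0≤q-p (coverage≤1 C)

  hits₃ : ∀ C → kindProb heavy * 1-cov C ≤ E (levelMean 3) (λ e → leaf e C)
  hits₃ C = ℚ.≤-reflexive (trans (lemma (kindProb global) (kindProb triple) (kindProb single) (kindProb heavy) (kindLeaf C global) (kindLeaf C triple) (1-cov C)) (sym (E-levelMean 3 C)))
    where
    lemma : ∀ p₀ p₁ p₂ p₃ g t y → p₃ * y ≡ p₀ * (0ℚ * g) + (p₁ * (0ℚ * t) + (p₂ * (0ℚ * y) + (p₃ * (1ℚ * y) + 0ℚ)))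
    lemma = solve-∀ ℚ-ring

  -- Heavy types also reach this level but are dropped, here and in `hits₁`: they are 2000 times
  -- rarer than singles.
  hits₂ : ∀ C → kindProb single * 1-cov C ≤ E (levelMean 2) (λ e → leaf e C)
  hits₂ C = ≤-by (kindProb heavy * 1-cov C) (0≤* (ℚ.nonNegative⁻¹ (kindProb heavy)) (0≤1-cov C))
    (trans (lemma (kindProb global) (kindProb triple) (kindProb single) (kindProb heavy) (kindLeaf C global) (kindLeaf C triple) (1-cov C)) (sym (E-levelMean 2 C)))
    where
    lemma : ∀ p₀ p₁ p₂ p₃ g t y → p₂ * y + p₃ * y ≡ p₀ * (0ℚ * g) + (p₁ * (0ℚ * t) + (p₂ * (1ℚ * y) + (p₃ * (1ℚ * y) + 0ℚ)))
    lemma = solve-∀ ℚ-ring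

  hits₁ : ∀ C → cubic-gain (kindProb single) (kindProb triple) (1-cov C) ≤ E (levelMean 1) (λ e → leaf e C)
  hits₁ C = ≤-by (kindProb heavy * 1-cov C) (0≤* (ℚ.nonNegative⁻¹ (kindProb heavy)) (0≤1-cov C))
    (trans (lemma (kindProb global) (kindProb triple) (kindProb single) (kindProb heavy) (kindLeaf C global) (coverage C)) (sym (E-levelMean 1 C)))
    where
    lemma : ∀ p₀ p₁ p₂ p₃ g y → (p₂ * (1ℚ - y) + p₁ * (1ℚ - (1ℚ - (1ℚ - y)) * (1ℚ - (1ℚ - y)) * (1ℚ - (1ℚ - y)))) + p₃ * (1ℚ - y)
      ≡ p₀ * (0ℚ * g) + (p₁ * (1ℚ * (1ℚ - y * (y * y))) + (p₂ * (1ℚ * (1ℚ - y)) + (p₃ * (1ℚ * (1ℚ - y)) + 0ℚ)))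
    lemma = solve-∀ ℚ-ring

  meanRankAt : ℕ → ℚ
  meanRankAt l = E (sequence (replicate Λ (levelMean l))) rankℚ

  -- successive differences of the weights of the kinds
  Δ₀ Δ₁ Δ₂ Δ₃ : ℚ
  Δ₀ = 1ℚ
  Δ₁ = + 2 / 25
  Δ₂ = + 17 / 100
  Δ₃ = + 39995 / 4

  -- Abel summation: a weight is the sum of the jumps at the levels it reaches, so the same
  -- combination turns level counts of a matching into its weight and level ranks into a lower bound
  -- for the optimum.
  combined : (ℕ → ℚ) → ℚ
  combined r = Δ₀ * r 0 + (Δ₁ * r 1 + (Δ₂ * r 2 + Δ₃ * r 3))

  combined-mono : ∀ {r r′} → (∀ l → r l ≤ r′ l) → combined r ≤ combined r′
  combined-mono le = ℚ.+-mono-≤ (*-monoˡ (ℚ.nonNegative⁻¹ Δ₀) (le 0)) (ℚ.+-mono-≤ (*-monoˡ (ℚ.nonNegative⁻¹ Δ₁) (le 1))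
    (ℚ.+-mono-≤ (*-monoˡ (ℚ.nonNegative⁻¹ Δ₂) (le 2)) (*-monoˡ (ℚ.nonNegative⁻¹ Δ₃) (le 3))))

  kindWeight≡ : ∀ κ → kindWeight κ ≡ combined (λ l → reaches l κ)
  kindWeight≡ global = refl
  kindWeight≡ triple = refl
  kindWeight≡ single = refl
  kindWeight≡ heavy  = refl

  matchingWeight≡ : ∀ {k} (t : Vec I k) M → matchingWeight t M ≡ combined (λ l → fromℕ (matched l t M))
  matchingWeight≡ []      []            = refl
  matchingWeight≡ {suc k} (i ∷ t) (nothing ∷ M) = trans (sum-allFin-suc k (λ a → gain (lookup (i ∷ t) a) (lookup (nothing ∷ M) a)))
    (trans (ℚ.+-identityˡ _) (matchingWeight≡ t M))
  matchingWeight≡ {suc k} (i ∷ t) (just j ∷ M) = begin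
    matchingWeight (i ∷ t) (just j ∷ M)
      ≡⟨ sum-allFin-suc k (λ a → gain (lookup (i ∷ t) a) (lookup (just j ∷ M) a)) ⟩
    kindWeight (kind i) + matchingWeight t M
      ≡⟨ cong₂ _+_ (kindWeight≡ (kind i)) (matchingWeight≡ t M) ⟩
    combined (λ l → reaches l (kind i)) + combined (λ l → fromℕ (matched l t M))
      ≡⟨ lemma Δ₀ Δ₁ Δ₂ Δ₃ (reaches 0 κ) (reaches 1 κ) (reaches 2 κ) (reaches 3 κ) (m 0) (m 1) (m 2) (m 3) ⟩
    combined (λ l → reaches l κ + m l)
      ≡⟨ cong₂ _+_ (*-congˡ Δ₀ (step 0)) (cong₂ _+_ (*-congˡ Δ₁ (step 1)) (cong₂ _+_ (*-congˡ Δ₂ (step 2)) (*-congˡ Δ₃ (step 3)))) ⟩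
    combined (λ l → fromℕ (matched l (i ∷ t) (just j ∷ M))) ∎
    where
    open ≡-Reasoning
    κ = kind i
    m : ℕ → ℚ
    m l = fromℕ (matched l t M)
    step : ∀ l → reaches l κ + m l ≡ fromℕ (matched l (i ∷ t) (just j ∷ M))
    step l with l ℕ.≤ᵇ toℕ κ
    ... | true  = refl
    ... | false = ℚ.+-identityˡ (m l)
    lemma : ∀ x₀ x₁ x₂ x₃ a b c d a′ b′ c′ d′ →
      (x₀ * a + (x₁ * b + (x₂ * c + x₃ * d))) + (x₀ * a′ + (x₁ * b′ + (x₂ * c′ + x₃ * d′)))
      ≡ x₀ * (a + a′) + (x₁ * (b + b′) + (x₂ * (c + c′) + x₃ * (d + d′)))
    lemma = solve-∀ ℚ-ring

  ranks : List I → ℚ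
  ranks ts = combined (λ l → rankℚ (map (atLevel l) ts))

  hyperedges≡map : ∀ {k} l (t : Vec I k) → hyperedges l t ≡ map (atLevel l) (Vec.toList t)
  hyperedges≡map l []      = refl
  hyperedges≡map l (i ∷ t) = cong (atLevel l i ∷_) (hyperedges≡map l t)

  ranks≤maxMatchingWeight : ∀ {k} (t : Vec I k) → ranks (Vec.toList t) ≤ maxMatchingWeight t
  ranks≤maxMatchingWeight {k} t = begin
    ranks (Vec.toList t)                        ≤⟨ combined-mono (λ l → subst (λ s → rankℚ s ≤ fromℕ (matched l t partner)) (hyperedges≡map l t) (fromℕ-mono (maximum l))) ⟩
    combined (λ l → fromℕ (matched l t partner)) ≡⟨ matchingWeight≡ t partner ⟨
    matchingWeight t partner                    ≤⟨ ∈⇒≤max (matchingWeight t) (∈.∈-filter⁺ (isMatching? t) (∈-allVecs ∈-decisions partner) isMatching) ⟩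
    maxMatchingWeight t                         ∎
    where
    open ℚ.≤-Reasoning
    open Matching (matching t [])
    ∈-decisions : ∀ d → d ∈ decisions
    ∈-decisions nothing  = here refl
    ∈-decisions (just j) = there (∈.∈-map⁺ just (∈.∈-allFin j))
    isMatching : IsMatching t partner
    isMatching = (λ a j eq → fromWitness (edges a j eq)) , injective

  sum-arrivals : ∀ k (f : List I → ℚ) →
    sumℚ (allVecs types k) (λ t → seqProb t * f (Vec.toList t)) ≡ E (sequence (replicate k typeMean)) f
  sum-arrivals zero    f = refl
  sum-arrivals (suc k) f = begin
    sumℚ (allVecs types (suc k)) (λ t → seqProb t * f (Vec.toList t))
      ≡⟨ sum-product _∷_ types (allVecs types k) (λ t → seqProb t * f (Vec.toList t)) ⟩
    sumℚ types (λ i → sumℚ (allVecs types k) (λ t → (typeProb i * seqProb t) * f (i ∷ Vec.toList t)))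
      ≡⟨ sum-cong types (λ i → trans (sum-cong (allVecs types k) (λ t → ℚ.*-assoc (typeProb i) (seqProb t) (f (i ∷ Vec.toList t))))
           (trans (sum-* (allVecs types k) (typeProb i) (λ t → seqProb t * f (i ∷ Vec.toList t))) (*-congˡ (typeProb i) (sum-arrivals k (λ ts → f (i ∷ ts)))))) ⟩
    sumℚ types (λ i → typeProb i * E (sequence (replicate k typeMean)) (λ ts → f (i ∷ ts)))
      ≡⟨ E-typeMean (λ i → E (sequence (replicate k typeMean)) (λ ts → f (i ∷ ts))) ⟨
    E typeMean (λ i → E (sequence (replicate k typeMean)) (λ ts → f (i ∷ ts)))
      ≡⟨ E-sequence typeMean (replicate k typeMean) f ⟨
    E (sequence (replicate (suc k) typeMean)) f ∎
    where open ≡-Reasoning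

  0≤seqProb : ∀ {k} (t : Vec I k) → 0ℚ ≤ seqProb t
  0≤seqProb []      = 0≤1
  0≤seqProb (i ∷ t) = 0≤* (0≤typeProb i) (0≤seqProb t)

  arrivalsMean : Mean (List I)
  arrivalsMean = sequence (replicate Λ typeMean)

  E-rank : ∀ l → E arrivalsMean (λ ts → rankℚ (map (atLevel l) ts)) ≡ meanRankAt l
  E-rank l = E-sequence-map (atLevel l) typeMean Λ rankℚ

  combined≤expectedOPT : combined meanRankAt ≤ expectedOPT
  combined≤expectedOPT = begin
    combined meanRankAt
      ≡⟨ cong₂ _+_ (pull Δ₀ 0) (cong₂ _+_ (pull Δ₁ 1) (cong₂ _+_ (pull Δ₂ 2) (pull Δ₃ 3))) ⟩
    E arrivalsMean (r Δ₀ 0) + (E arrivalsMean (r Δ₁ 1) + (E arrivalsMean (r Δ₂ 2) + E arrivalsMean (r Δ₃ 3)))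
      ≡⟨ +-congˡ (E arrivalsMean (r Δ₀ 0)) (+-congˡ (E arrivalsMean (r Δ₁ 1)) (sym (E-+ arrivalsMean (r Δ₂ 2) (r Δ₃ 3)))) ⟩
    E arrivalsMean (r Δ₀ 0) + (E arrivalsMean (r Δ₁ 1) + E arrivalsMean (λ ts → r Δ₂ 2 ts + r Δ₃ 3 ts))
      ≡⟨ +-congˡ (E arrivalsMean (r Δ₀ 0)) (sym (E-+ arrivalsMean (r Δ₁ 1) (λ ts → r Δ₂ 2 ts + r Δ₃ 3 ts))) ⟩
    E arrivalsMean (r Δ₀ 0) + E arrivalsMean (λ ts → r Δ₁ 1 ts + (r Δ₂ 2 ts + r Δ₃ 3 ts))
      ≡⟨ E-+ arrivalsMean (r Δ₀ 0) (λ ts → r Δ₁ 1 ts + (r Δ₂ 2 ts + r Δ₃ 3 ts)) ⟨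
    E arrivalsMean ranks
      ≡⟨ sum-arrivals Λ ranks ⟨
    sumℚ (allVecs types Λ) (λ t → seqProb t * ranks (Vec.toList t))
      ≤⟨ sum-mono (allVecs types Λ) (λ t → *-monoˡ (0≤seqProb t) (ranks≤maxMatchingWeight t)) ⟩
    expectedOPT ∎
    where
    open ℚ.≤-Reasoning
    r : ℚ → ℕ → List I → ℚ
    r c l ts = c * rankℚ (map (atLevel l) ts)
    pull : ∀ c l → c * meanRankAt l ≡ E arrivalsMean (r c l)
    pull c l = trans (*-congˡ c (sym (E-rank l))) (sym (E-* arrivalsMean c (λ ts → rankℚ (map (atLevel l) ts))))

-- The second-order bound for e^(-kq). With (kq)² instead of k(k - 1)q² the induction closes, with
-- slack q²/2 + k²q³/2.
power-≤-quadratic : ∀ {q} → 0ℚ ≤ q → q ≤ 1ℚ → ∀ k →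
  (1ℚ - q) ^ k ≤ (1ℚ - fromℕ k * q) + (+ 1 / 2) * ((fromℕ k * q) * (fromℕ k * q))
power-≤-quadratic {q} 0≤q q≤1 zero = ℚ.≤-reflexive (lemma q)
  where
  lemma : ∀ q → 1ℚ ≡ (1ℚ - 0ℚ * q) + (+ 1 / 2) * ((0ℚ * q) * (0ℚ * q))
  lemma = solve-∀ ℚ-ring
power-≤-quadratic {q} 0≤q q≤1 (suc k) = ℚ.≤-trans (*-monoˡ (p≤q⇒0≤q-p q≤1) (power-≤-quadratic 0≤q q≤1 k))
  (≤-by ((+ 1 / 2) * (q * q) + (+ 1 / 2) * ((x * x) * q))
    (0≤+ (0≤* (ℚ.nonNegative⁻¹ (+ 1 / 2)) (0≤square q)) (0≤* (ℚ.nonNegative⁻¹ (+ 1 / 2)) (0≤* (0≤square x) 0≤q)))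
    (lemma (fromℕ k) q))
  where
  x = fromℕ k * q
  lemma : ∀ k q → (1ℚ - q) * ((1ℚ - k * q) + (+ 1 / 2) * ((k * q) * (k * q))) + ((+ 1 / 2) * (q * q) + (+ 1 / 2) * (((k * q) * (k * q)) * q))
    ≡ (1ℚ - (1ℚ + k) * q) + (+ 1 / 2) * (((1ℚ + k) * q) * ((1ℚ + k) * q))
  lemma = solve-∀ ℚ-ring

-- Lower bounds for the expected ranks at the levels 0, 2 and 3

module Expectations (s n Λ : ℕ) {{_ : NonZero n}} {{_ : NonZero Λ}}
  (n≡ : fromℕ n ≡ (+ 100 / 1) * fromℕ s) (Λ≡ : fromℕ Λ ≡ (+ 103 / 1) * fromℕ s) where
  open Optimum s n Λ n≡ Λ≡ public
  open Rank n hiding (J)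
  open Process n hiding (0≤1/n)
  open Levels n nb lev

  Λ/n : fromℕ Λ * 1/n ≡ + 103 / 100
  Λ/n = begin
    fromℕ Λ * 1/n                                         ≡⟨ cong (_* 1/n) Λ≡ ⟩
    ((+ 103 / 1) * fromℕ s) * 1/n                         ≡⟨ lemma (fromℕ s) 1/n ⟩
    (+ 103 / 100) * (((+ 100 / 1) * fromℕ s) * 1/n)       ≡⟨ *-congˡ (+ 103 / 100) (trans (cong (_* 1/n) (sym n≡)) (*-inverse-fromℕ n)) ⟩
    (+ 103 / 100) * 1ℚ                                    ≡⟨ ℚ.*-identityʳ (+ 103 / 100) ⟩
    + 103 / 100                                           ∎
    where
    open ≡-Reasoning
    lemma : ∀ s i → ((+ 103 / 1) * s) * i ≡ (+ 103 / 100) * (((+ 100 / 1) * s) * i)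
    lemma = solve-∀ ℚ-ring

  1≤n : 1ℚ ≤ fromℕ n
  1≤n = fromℕ-mono (ℕ.>-nonZero⁻¹ n)

  1/n≤1 : 1/n ≤ 1ℚ
  1/n≤1 = subst₂ _≤_ (ℚ.*-identityˡ 1/n) (*-inverse-fromℕ n) (*-monoʳ 0≤1/n 1≤n)

  -- Here `x` is the mean number of hits per offline vertex, Λp/n, and the deficiency n(1 - p/n)^Λ
  -- is replaced by its quadratic bound. As x is small at the levels 2 and 3, this crude estimate
  -- suffices there.
  rank-decay : ∀ l p x → 0ℚ ≤ p → p ≤ 1ℚ → (+ 103 / 100) * p ≡ x →
    (∀ C → p * 1-cov C ≤ E (levelMean l) (λ e → leaf e C)) →
    fromℕ n * (x - (+ 1 / 2) * (x * x)) ≤ meanRankAt l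
  rank-decay l p x 0≤p p≤1 x≡ hits = ≤-by (fromℕ n * Qx - D) (p≤q⇒0≤q-p D≤)
    (trans (+-congˡ (fromℕ n * (x - (+ 1 / 2) * (x * x))) (cong (λ z → fromℕ n * Qx - z) D≡)) (lemma (fromℕ n) x (meanRankAt l)))
    where
    N = sequence (replicate Λ (levelMean l))
    Qx = (1ℚ - x) + (+ 1 / 2) * (x * x)
    D = E N deficiency
    D≡ : D ≡ fromℕ n - meanRankAt l
    D≡ = trans (E-minus N (const (fromℕ n)) rankℚ) (cong (_- meanRankAt l) (E-const N (fromℕ n)))
    p/n≤1 : p * 1/n ≤ 1ℚ
    p/n≤1 = ℚ.≤-trans (*-monoʳ 0≤1/n p≤1) (ℚ.≤-trans (ℚ.≤-reflexive (ℚ.*-identityˡ 1/n)) 1/n≤1)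
    Λq : fromℕ Λ * (p * 1/n) ≡ x
    Λq = trans (swap (fromℕ Λ) p 1/n) (trans (cong (_* p) Λ/n) x≡)
      where
      swap : ∀ a b c → a * (b * c) ≡ (a * c) * b
      swap = solve-∀ ℚ-ring
    D≤ : D ≤ fromℕ n * Qx
    D≤ = ℚ.≤-trans (deficiency-decay (levelMean l) 0≤p p/n≤1 hits Λ) (*-monoˡ (0≤fromℕ n)
      (subst (λ z → (1ℚ - p * 1/n) ^ Λ ≤ (1ℚ - z) + (+ 1 / 2) * (z * z)) Λq (power-≤-quadratic (0≤* 0≤p 0≤1/n) p/n≤1 Λ)))
    lemma : ∀ n x r → n * (x - (+ 1 / 2) * (x * x)) + (n * ((1ℚ - x) + (+ 1 / 2) * (x * x)) - (n - r)) ≡ r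
    lemma = solve-∀ ℚ-ring

  rank₂ : fromℕ n * (+ 9 / 50) ≤ meanRankAt 2
  rank₂ = rank-decay 2 (kindProb single) (+ 1 / 5) (ℚ.nonNegative⁻¹ _) (toWitness {a? = kindProb single ℚ.≤? 1ℚ} _) refl hits₂

  rank₃ : fromℕ n * (+ 19999 / 200000000) ≤ meanRankAt 3
  rank₃ = rank-decay 3 (kindProb heavy) (+ 1 / 10000) (ℚ.nonNegative⁻¹ _) (toWitness {a? = kindProb heavy ℚ.≤? 1ℚ} _) refl hits₃

  isGlobal : Kind → Bool
  isGlobal global  = true
  isGlobal (suc _) = false

  countGlobal : List I → ℕ
  countGlobal []       = 0
  countGlobal (i ∷ ts) = (if isGlobal (kind i) then 1 else 0) ℕ.+ countGlobal ts

  inside⇒lookup : ∀ e C → inside e C ≡ true → ∀ {j} → j ∈ e → lookup C j ≡ true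
  inside⇒lookup (j ∷ e) C eq (here refl) with lookup C j
  ... | true  = refl
  inside⇒lookup (j ∷ e) C eq (there p) with lookup C j
  ... | true  = inside⇒lookup e C eq p

  size-full : ∀ {m} (C : Subset m) → (∀ j → lookup C j ≡ true) → size C ≡ m
  size-full []          all = refl
  size-full (true  ∷ C) all = cong suc (size-full C (all ∘ suc))
  size-full (false ∷ C) all with () ← all zero

  -- A level-0 minimiser that is not all of J is left by every global vertex.
  out-globals : ∀ ts C → inside (allFin n) C ≡ false →
    out (map (atLevel 1) ts) C ℕ.+ countGlobal ts ≡ out (map (atLevel 0) ts) C
  out-globals []       C eq = refl
  out-globals (i ∷ ts) C eq = trans (interchange (leaves (atLevel 1 i) C) (out (map (atLevel 1) ts) C) (if isGlobal (kind i) then 1 else 0) (countGlobal ts))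
    (cong₂ ℕ._+_ (here-eq (decode i)) (out-globals ts C eq))
    where
    interchange : ∀ a b c d → (a ℕ.+ b) ℕ.+ (c ℕ.+ d) ≡ (a ℕ.+ c) ℕ.+ (b ℕ.+ d)
    interchange a b c d = trans (ℕ.+-assoc a b (c ℕ.+ d)) (trans (cong (a ℕ.+_) (trans (sym (ℕ.+-assoc b c d)) (trans (cong (ℕ._+ d) (ℕ.+-comm b c)) (ℕ.+-assoc c b d)))) (sym (ℕ.+-assoc a c (b ℕ.+ d))))
    here-eq : ∀ (code : Code) → leaves (if 1 ℕ.≤ᵇ toℕ (proj₁ code) then neighbours code else []) C ℕ.+ (if isGlobal (proj₁ code) then 1 else 0)
      ≡ leaves (if 0 ℕ.≤ᵇ toℕ (proj₁ code) then neighbours code else []) C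
    here-eq (global , _) rewrite eq = refl
    here-eq (triple , _) = ℕ.+-identityʳ _
    here-eq (single , _) = ℕ.+-identityʳ _
    here-eq (heavy  , _) = ℕ.+-identityʳ _

  -- The level-0 rank is at least this number unless it is `n`. The sum has an explicit mean in
  -- terms of `meanRankAt 1` and differences at most 2.
  covered : List I → ℚ
  covered ts = rankℚ (map (atLevel 1) ts) + fromℕ (countGlobal ts)

  rank₀-cases : ∀ ts → (fromℕ n ≤ rankℚ (map (atLevel 0) ts)) ⊎ (covered ts ≤ rankℚ (map (atLevel 0) ts))
  rank₀-cases ts with inside (allFin n) (closed (map (atLevel 0) ts)) in eq
  ... | true  = inj₁ (fromℕ-mono (ℕ.≤-trans (ℕ.≤-reflexive (sym (size-full C (λ j → inside⇒lookup (allFin n) C eq (∈.∈-allFin j)))))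
                  (size-closed≤rank (map (atLevel 0) ts))))
    where C = closed (map (atLevel 0) ts)
  ... | false = inj₂ (subst (_≤ rankℚ (map (atLevel 0) ts)) (fromℕ-+ (rank (map (atLevel 1) ts)) (countGlobal ts)) (fromℕ-mono (ℕ.≤-trans
                  (ℕ.+-monoˡ-≤ (countGlobal ts) (rank≤cost (map (atLevel 1) ts) C))
                  (ℕ.≤-reflexive (trans (ℕ.+-assoc (size C) _ _) (cong (size C ℕ.+_) (out-globals ts C eq)))))))
    where C = closed (map (atLevel 0) ts)

  countGlobal-++ : ∀ r ts → countGlobal (r ++ ts) ≡ countGlobal r ℕ.+ countGlobal ts
  countGlobal-++ []      ts = refl
  countGlobal-++ (i ∷ r) ts = trans (cong ((if isGlobal (kind i) then 1 else 0) ℕ.+_) (countGlobal-++ r ts)) (sym (ℕ.+-assoc (if isGlobal (kind i) then 1 else 0) _ _))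

  covered-bounded : BoundedDifferences (1ℚ + 1ℚ) covered
  covered-bounded r x y ts = begin
    covered (r ++ x ∷ ts) - covered (r ++ y ∷ ts)
      ≤⟨ ℚ.+-mono-≤ upper (ℚ.neg-antimono-≤ lower) ⟩
    ((1ℚ + ρ) + (γ + 1ℚ)) - (ρ + γ)
      ≡⟨ lemma ρ γ ⟩
    1ℚ + 1ℚ ∎
    where
    open ℚ.≤-Reasoning
    m = map (atLevel 1)
    ρ = rankℚ (m r ++ m ts)
    γ = fromℕ (countGlobal r ℕ.+ countGlobal ts)
    lemma : ∀ ρ γ → ((1ℚ + ρ) + (γ + 1ℚ)) - (ρ + γ) ≡ 1ℚ + 1ℚ
    lemma = solve-∀ ℚ-ring
    one : ∀ i → (if isGlobal (kind i) then 1 else 0) ℕ.≤ 1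
    one i with isGlobal (kind i)
    ... | true  = ℕ.≤-refl
    ... | false = ℕ.z≤n
    count≡ : ∀ i → countGlobal (r ++ i ∷ ts) ≡ (countGlobal r ℕ.+ countGlobal ts) ℕ.+ (if isGlobal (kind i) then 1 else 0)
    count≡ i = trans (countGlobal-++ r (i ∷ ts)) (trans (cong (countGlobal r ℕ.+_) (ℕ.+-comm _ (countGlobal ts))) (sym (ℕ.+-assoc (countGlobal r) _ _)))
    upper : covered (r ++ x ∷ ts) ≤ (1ℚ + ρ) + (γ + 1ℚ)
    upper = ℚ.+-mono-≤ (subst (λ z → rankℚ z ≤ 1ℚ + ρ) (sym (List.map-++ (atLevel 1) r (x ∷ ts))) (rank-insert-≤ (m r) (atLevel 1 x) (m ts)))
      (subst (fromℕ (countGlobal (r ++ x ∷ ts)) ≤_) (fromℕ-+ (countGlobal r ℕ.+ countGlobal ts) 1) (fromℕ-mono (ℕ.≤-trans (ℕ.≤-reflexive (count≡ x)) (ℕ.+-monoʳ-≤ (countGlobal r ℕ.+ countGlobal ts) (one x)))))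
    lower : ρ + γ ≤ covered (r ++ y ∷ ts)
    lower = ℚ.+-mono-≤ (subst (λ z → ρ ≤ rankℚ z) (sym (List.map-++ (atLevel 1) r (y ∷ ts))) (rank-insert-≥ (m r) (atLevel 1 y) (m ts)))
      (fromℕ-mono (ℕ.≤-trans (ℕ.m≤m+n (countGlobal r ℕ.+ countGlobal ts) (if isGlobal (kind y) then 1 else 0)) (ℕ.≤-reflexive (sym (count≡ y)))))

  E-isGlobal : E typeMean (λ i → fromℕ (if isGlobal (kind i) then 1 else 0)) ≡ kindProb global
  E-isGlobal = trans (E-type (λ code → bit₁ (proj₁ code)))
    (byKind-cong {y = bit₁} (λ κ → trans (𝒰³-first (const (bit₁ κ))) (E-const 𝒰 (bit₁ κ))))
    where
    bit₁ : Kind → ℚ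
    bit₁ κ = fromℕ (if isGlobal κ then 1 else 0)

  E-countGlobal : ∀ k → E (sequence (replicate k typeMean)) (λ ts → fromℕ (countGlobal ts)) ≡ fromℕ k * kindProb global
  E-countGlobal zero    = trans (E-pointMean {A = List I} [] (λ ts → fromℕ (countGlobal ts))) (sym (ℚ.*-zeroˡ (kindProb global)))
  E-countGlobal (suc k) = begin
    E (sequence (replicate (suc k) typeMean)) (λ ts → fromℕ (countGlobal ts))
      ≡⟨ E-sequence typeMean (replicate k typeMean) (λ ts → fromℕ (countGlobal ts)) ⟩
    E typeMean (λ i → E N (λ ts → fromℕ (b i ℕ.+ countGlobal ts)))
      ≡⟨ E-cong typeMean (λ i → trans (E-cong N (λ ts → fromℕ-+ (b i) (countGlobal ts)))
           (trans (E-+ N (const (fromℕ (b i))) (λ ts → fromℕ (countGlobal ts))) (cong₂ _+_ (E-const N (fromℕ (b i))) (E-countGlobal k)))) ⟩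
    E typeMean (λ i → fromℕ (b i) + fromℕ k * kindProb global)
      ≡⟨ trans (E-+ typeMean (λ i → fromℕ (b i)) (const (fromℕ k * kindProb global))) (cong₂ _+_ E-isGlobal (E-const typeMean (fromℕ k * kindProb global))) ⟩
    kindProb global + fromℕ k * kindProb global
      ≡⟨ lemma (fromℕ k) (kindProb global) ⟩
    (1ℚ + fromℕ k) * kindProb global ∎
    where
    open ≡-Reasoning
    N = sequence (replicate k typeMean)
    b : I → ℕ
    b i = if isGlobal (kind i) then 1 else 0
    lemma : ∀ k p → p + k * p ≡ (1ℚ + k) * p
    lemma = solve-∀ ℚ-ring

  -- If on average triples, singles and globals cover more than n + d, a deviation of d is needed
  -- to leave a vertex uncovered; x ≤ (x + d)² / 4d.
  rank₀ : ∀ {d} → 0ℚ ≤ d → fromℕ n + d ≤ meanRankAt 1 + fromℕ Λ * kindProb global →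
    ((+ 4 / 1) * d) * (fromℕ n - meanRankAt 0) ≤ (+ 4 / 1) * fromℕ Λ
  rank₀ {d} 0≤d large = begin
    c * (fromℕ n - meanRankAt 0)
      ≡⟨ *-congˡ c (trans (cong₂ _-_ (sym (E-const N (fromℕ n))) (sym (E-rank 0))) (sym (E-minus N (const (fromℕ n)) (λ ts → rankℚ (map (atLevel 0) ts))))) ⟩
    c * E N (λ ts → fromℕ n - rankℚ (map (atLevel 0) ts))
      ≡⟨ E-* N c (λ ts → fromℕ n - rankℚ (map (atLevel 0) ts)) ⟨
    E N (λ ts → c * (fromℕ n - rankℚ (map (atLevel 0) ts)))
      ≤⟨ E-mono N pointwise ⟩
    E N (λ ts → (covered ts - μ) * (covered ts - μ))
      ≤⟨ variance-≤ (replicate Λ typeMean) {f = covered} covered-bounded ⟩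
    fromℕ (length (replicate Λ typeMean)) * ((1ℚ + 1ℚ) * (1ℚ + 1ℚ))
      ≡⟨ trans (cong (λ k → fromℕ k * ((1ℚ + 1ℚ) * (1ℚ + 1ℚ))) (List.length-replicate Λ)) (ℚ.*-comm (fromℕ Λ) _) ⟩
    (+ 4 / 1) * fromℕ Λ ∎
    where
    open ℚ.≤-Reasoning
    N = arrivalsMean
    c = (+ 4 / 1) * d
    0≤c : 0ℚ ≤ c
    0≤c = 0≤* (ℚ.nonNegative⁻¹ (+ 4 / 1)) 0≤d
    μ = E N covered
    μ≡ : μ ≡ meanRankAt 1 + fromℕ Λ * kindProb global
    μ≡ = trans (E-+ N (λ ts → rankℚ (map (atLevel 1) ts)) (λ ts → fromℕ (countGlobal ts))) (cong₂ _+_ (E-rank 1) (E-countGlobal Λ))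
    n+d≤μ : fromℕ n + d ≤ μ
    n+d≤μ = subst (fromℕ n + d ≤_) (sym μ≡) large
    pointwise : ∀ ts → c * (fromℕ n - rankℚ (map (atLevel 0) ts)) ≤ (covered ts - μ) * (covered ts - μ)
    pointwise ts = [ full , partial ]′ (rank₀-cases ts)
      where
      r f : ℚ
      r = rankℚ (map (atLevel 0) ts)
      f = covered ts
      cancel : ∀ c n r → c * (n - r) + c * (r - n) ≡ 0ℚ
      cancel = solve-∀ ℚ-ring
      full : fromℕ n ≤ r → c * (fromℕ n - r) ≤ (f - μ) * (f - μ)
      full n≤ = ℚ.≤-trans (≤-by (c * (r - fromℕ n)) (0≤* 0≤c (p≤q⇒0≤q-p n≤)) (cancel c (fromℕ n) r)) (0≤square (f - μ))
      square : ∀ d n r f μ → ((+ 4 / 1) * d) * (n - r) + (((+ 4 / 1) * d) * (r - f) + (((+ 4 / 1) * d) * (μ - (n + d)) + ((μ - f) - (d + d)) * ((μ - f) - (d + d))))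
        ≡ (f - μ) * (f - μ)
      square = solve-∀ ℚ-ring
      partial : f ≤ r → c * (fromℕ n - r) ≤ (f - μ) * (f - μ)
      -- With t = μ - f the identity is t² = 4d(t - d) + (t - 2d)², and t - d is at least n - r by
      -- the two hypotheses.
      partial f≤ = ≤-by (c * (r - f) + (c * (μ - (fromℕ n + d)) + ((μ - f) - (d + d)) * ((μ - f) - (d + d))))
        (0≤+ (0≤* 0≤c (p≤q⇒0≤q-p f≤)) (0≤+ (0≤* 0≤c (p≤q⇒0≤q-p n+d≤μ)) (0≤square ((μ - f) - (d + d)))))
        (square d (fromℕ n) r f μ)

-- Powers lie below their chords

^-+ : ∀ p j k → p ^ (j ℕ.+ k) ≡ p ^ j * p ^ k
^-+ p zero    k = sym (ℚ.*-identityˡ (p ^ k))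
^-+ p (suc j) k = trans (*-congˡ p (^-+ p j k)) (sym (ℚ.*-assoc p (p ^ j) (p ^ k)))

^-* : ∀ p k w → p ^ (k ℕ.* w) ≡ (p ^ w) ^ k
^-* p zero    w = refl
^-* p (suc k) w = trans (^-+ p w (k ℕ.* w)) (*-congˡ (p ^ w) (^-* p k w))

module Chord {X : ℚ} (0≤X : 0ℚ ≤ X) (X≤1 : X ≤ 1ℚ) where

  ^-≤1 : ∀ k → X ^ k ≤ 1ℚ
  ^-≤1 zero    = ℚ.≤-refl
  ^-≤1 (suc k) = ℚ.≤-trans (*-monoˡ 0≤X (^-≤1 k)) (ℚ.≤-trans (ℚ.≤-reflexive (ℚ.*-identityʳ X)) X≤1)

  ^-antimono : ∀ {j k} → j ℕ.≤ k → X ^ k ≤ X ^ j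
  ^-antimono {j} {k} j≤k with ℕ.m≤n⇒∃[o]m+o≡n j≤k
  ... | o , refl = ℚ.≤-trans (ℚ.≤-reflexive (^-+ X j o)) (ℚ.≤-trans (*-monoˡ (0≤^ 0≤X j) (^-≤1 o)) (ℚ.≤-reflexive (ℚ.*-identityʳ (X ^ j))))

  -- 1 - X^r is (1 - X) times the sum of the `r` lower powers of `X`, each of which is at least X^r.
  secant : ∀ r → (fromℕ r * X ^ r) * (1ℚ - X) ≤ 1ℚ - X ^ r
  secant zero    = ℚ.≤-reflexive (lemma X)
    where
    lemma : ∀ X → (0ℚ * 1ℚ) * (1ℚ - X) ≡ 1ℚ - 1ℚ
    lemma = solve-∀ ℚ-ring
  secant (suc r) = ≤-by (X * ((1ℚ - X ^ r) - (fromℕ r * X ^ r) * (1ℚ - X)) + (1ℚ - X) * (1ℚ - X * X ^ r))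
    (0≤+ (0≤* 0≤X (p≤q⇒0≤q-p (secant r))) (0≤* (p≤q⇒0≤q-p X≤1) (p≤q⇒0≤q-p (^-≤1 (suc r)))))
    (lemma (fromℕ r) X (X ^ r))
    where
    lemma : ∀ r X P → ((1ℚ + r) * (X * P)) * (1ℚ - X) + (X * ((1ℚ - P) - (r * P) * (1ℚ - X)) + (1ℚ - X) * (1ℚ - X * P)) ≡ 1ℚ - X * P
    lemma = solve-∀ ℚ-ring

  -- Convexity of the exponential between the exponents 0 and `r + d`, cleared of the denominator
  -- `r + d`.
  chord : ∀ r d → fromℕ (r ℕ.+ d) * X ^ r ≤ fromℕ d + fromℕ r * X ^ (r ℕ.+ d)
  chord r zero    rewrite ℕ.+-identityʳ r = ℚ.≤-reflexive (sym (ℚ.+-identityˡ _))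
  chord r (suc d) rewrite ℕ.+-suc r d = ≤-by
    (((fromℕ d + fromℕ r * P) - fromℕ (r ℕ.+ d) * X ^ r) + (((1ℚ - X ^ r) - (fromℕ r * X ^ r) * (1ℚ - X)) + (fromℕ r * (1ℚ - X)) * (X ^ r - P)))
    (0≤+ (p≤q⇒0≤q-p (chord r d)) (0≤+ (p≤q⇒0≤q-p (secant r)) (0≤* (0≤* (0≤fromℕ r) (p≤q⇒0≤q-p X≤1)) (p≤q⇒0≤q-p (^-antimono (ℕ.m≤m+n r d))))))
    (lemma (fromℕ (r ℕ.+ d)) (fromℕ d) (fromℕ r) X (X ^ r) P)
    where
    P = X ^ (r ℕ.+ d)
    lemma : ∀ q d r X R P → (1ℚ + q) * R + (((d + r * P) - q * R) + (((1ℚ - R) - (r * R) * (1ℚ - X)) + (r * (1ℚ - X)) * (R - P))) ≡ (1ℚ + d) + r * (X * P)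
    lemma = solve-∀ ℚ-ring

-- The number of vertices not covered by triples and singles

-- knots of a convex polygon above e^(−x) at x = j / 20, rounded up to five decimals
knot : ℕ → ℕ
knot zero    = 100000
knot (suc j) = (knot j ℕ.* 761) ℕ./ 800 ℕ.+ 1

knotValue : ℕ → ℚ
knotValue j = + knot j / 100000

knotDrop : ℕ → ℚ
knotDrop j = knotValue j - knotValue (suc j)

-- A bound for the fraction of `J` left uncovered by singles and triples: divided by `n`, every
-- affine function used is at most this at ℓ = 0 and m = Λ.
ū : ℚ
ū = + 339 / 2000

a₁ b₁ : ℚ
a₁ = kindProb single
b₁ = kindProb triple

0≤a₁ : 0ℚ ≤ a₁
0≤a₁ = ℚ.nonNegative⁻¹ a₁

0≤b₁ : 0ℚ ≤ b₁
0≤b₁ = ℚ.nonNegative⁻¹ b₁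

-- The value at x = 0 of the line through the knots `j` and `suc j`, whose slope is -20
-- `knotDrop j`.
height : ℕ → ℚ
height j = knotValue j + (+ j / 1) * knotDrop j

-- The last condition is the affine solution at ℓ = 0 and m = Λ, divided by `s`: the factors 100 and
-- 103 stand for `n` and `Λ`. All four conditions are decided by evaluation.
KnotConditions : ℕ → Set
KnotConditions j = ((+ 761 / 800) * knotValue j ≤ knotValue (suc j)) × (0ℚ ≤ (+ 20 / 1) * knotDrop j) × ((+ 20 / 1) * knotDrop j ≤ 1ℚ) ×
  ((+ 100 / 1) * height j - (+ 103 / 1) * cubic-gain a₁ b₁ ((+ 20 / 1) * knotDrop j) ≤ (+ 100 / 1) * ū)

knot-conditions : ∀ (j : Fin 40) → KnotConditions (toℕ j)
knot-conditions = toWitness {a? = Fin.all? λ j → (_ ℚ.≤? _) ×-dec ((_ ℚ.≤? _) ×-dec ((_ ℚ.≤? _) ×-dec (_ ℚ.≤? _)))} _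

knot₄₀≤ū : knotValue 40 ≤ ū
knot₄₀≤ū = toWitness {a? = knotValue 40 ℚ.≤? ū} _

module Covering (s n Λ q w : ℕ) {{_ : NonZero n}} {{_ : NonZero Λ}} {{_ : NonZero q}} {{_ : NonZero w}}
  (n≡ : fromℕ n ≡ (+ 100 / 1) * fromℕ s) (Λ≡ : fromℕ Λ ≡ (+ 103 / 1) * fromℕ s)
  (n≡′ : fromℕ n ≡ (+ 20 / 1) * (fromℕ q * fromℕ w)) (3≤w : + 3 / 1 ≤ fromℕ w) where
  open Expectations s n Λ n≡ Λ≡ public
  open Rank n hiding (J)
  open Process n hiding (0≤1/n)

  loopMean : Mean Hyperedge
  loopMean = mapMean (_∷ []) 𝒰

  hits-loop : ∀ C → E loopMean (λ e → leaf e C) ≡ 1ℚ - coverage C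
  hits-loop C = trans (E-mapMean (_∷ []) 𝒰 (λ e → leaf e C)) (E-loop C)

  open Window.Draws n loopMean (levelMean 1) 0≤a₁ 0≤b₁ hits-loop hits₁
  open Slopes w

  v : ℕ → ℕ → ℚ
  v k m = fromℕ n - meanRank (k ℕ.* w) m

  -- Decay of the deficiency bound over one window of `w` loops. Since n = 20qw, `q` windows span
  -- the distance 1/20 between knots.
  X : ℚ
  X = (1ℚ - 1ℚ * 1/n) ^ w

  1*1/n≤1 : 1ℚ * 1/n ≤ 1ℚ
  1*1/n≤1 = ℚ.≤-trans (ℚ.≤-reflexive (ℚ.*-identityˡ 1/n)) 1/n≤1

  0≤base : 0ℚ ≤ 1ℚ - 1ℚ * 1/n
  0≤base = p≤q⇒0≤q-p 1*1/n≤1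

  base≤1 : 1ℚ - 1ℚ * 1/n ≤ 1ℚ
  base≤1 = ≤-by (1ℚ * 1/n) (0≤* 0≤1 0≤1/n) (lemma (1ℚ * 1/n))
    where
    lemma : ∀ x → (1ℚ - x) + x ≡ 1ℚ
    lemma = solve-∀ ℚ-ring

  0≤X : 0ℚ ≤ X
  0≤X = 0≤^ 0≤base w

  X≤1 : X ≤ 1ℚ
  X≤1 = Chord.^-≤1 0≤base base≤1 w

  open Chord 0≤X X≤1

  v-0≤ : ∀ k → v k 0 ≤ fromℕ n * X ^ k
  v-0≤ k = begin
    fromℕ n - E (sequence (replicate (k ℕ.* w) loopMean ++ [])) rankℚ
      ≡⟨ cong (λ Ms → fromℕ n - E (sequence Ms) rankℚ) (List.++-identityʳ (replicate (k ℕ.* w) loopMean)) ⟩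
    fromℕ n - E N rankℚ
      ≡⟨ trans (cong (_- E N rankℚ) (sym (E-const N (fromℕ n)))) (sym (E-minus N (const (fromℕ n)) rankℚ)) ⟩
    E N deficiency
      ≤⟨ deficiency-decay loopMean 0≤1 1*1/n≤1 (λ C → ℚ.≤-reflexive (trans (ℚ.*-identityˡ (1ℚ - coverage C)) (sym (hits-loop C)))) (k ℕ.* w) ⟩
    fromℕ n * (1ℚ - 1ℚ * 1/n) ^ (k ℕ.* w)
      ≡⟨ *-congˡ (fromℕ n) (^-* (1ℚ - 1ℚ * 1/n) k w) ⟩
    fromℕ n * X ^ k ∎
    where
    open ℚ.≤-Reasoning
    N = sequence (replicate (k ℕ.* w) loopMean)

  -- 761/800 is 1 - x + x²/2 at x = 1/20, the quadratic bound for n/20 loops.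
  X^q≤ : X ^ q ≤ + 761 / 800
  X^q≤ = begin
    X ^ q
      ≡⟨ sym (^-* (1ℚ - 1ℚ * 1/n) q w) ⟩
    (1ℚ - 1ℚ * 1/n) ^ (q ℕ.* w)
      ≤⟨ power-≤-quadratic (0≤* 0≤1 0≤1/n) 1*1/n≤1 (q ℕ.* w) ⟩
    (1ℚ - fromℕ (q ℕ.* w) * (1ℚ * 1/n)) + (+ 1 / 2) * ((fromℕ (q ℕ.* w) * (1ℚ * 1/n)) * (fromℕ (q ℕ.* w) * (1ℚ * 1/n)))
      ≡⟨ cong (λ x → (1ℚ - x) + (+ 1 / 2) * (x * x)) fraction ⟩
    + 761 / 800 ∎
    where
    open ℚ.≤-Reasoning
    fraction : fromℕ (q ℕ.* w) * (1ℚ * 1/n) ≡ + 1 / 20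
    fraction = trans (cong (_* (1ℚ * 1/n)) (fromℕ-* q w)) (trans (lemma (fromℕ q * fromℕ w) 1/n)
      (trans (*-congˡ (+ 1 / 20) (trans (cong (_* 1/n) (sym n≡′)) (*-inverse-fromℕ n))) (ℚ.*-identityʳ (+ 1 / 20))))
      where
      lemma : ∀ x i → x * (1ℚ * i) ≡ (+ 1 / 20) * (((+ 20 / 1) * x) * i)
      lemma = solve-∀ ℚ-ring

  conditions : ∀ {j} → j ℕ.< 40 → KnotConditions j
  conditions j<40 = subst KnotConditions (Fin.toℕ-fromℕ< j<40) (knot-conditions (fromℕ< j<40))

  X^≤knot : ∀ j → j ℕ.≤ 40 → X ^ (j ℕ.* q) ≤ knotValue j
  X^≤knot zero    _    = ℚ.≤-reflexive refl
  X^≤knot (suc j) j<40 = begin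
    X ^ (q ℕ.+ j ℕ.* q)    ≡⟨ ^-+ X q (j ℕ.* q) ⟩
    X ^ q * X ^ (j ℕ.* q)  ≤⟨ *-monoʳ (0≤^ 0≤X (j ℕ.* q)) X^q≤ ⟩
    (+ 761 / 800) * X ^ (j ℕ.* q) ≤⟨ *-monoˡ (ℚ.nonNegative⁻¹ (+ 761 / 800)) (X^≤knot j (ℕ.<⇒≤ j<40)) ⟩
    (+ 761 / 800) * knotValue j    ≤⟨ proj₁ (conditions j<40) ⟩
    knotValue (suc j)              ∎
    where open ℚ.≤-Reasoning

  -- Index `zero` is the constant at the last knot, in force from 40q windows, that is 2n loops,
  -- onwards; index `suc j` is the segment that starts at knot `j`.
  α h : Fin 41 → ℚ
  α zero    = fromℕ n * knotValue 40
  α (suc j) = fromℕ n * height (toℕ j)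
  h zero    = 0ℚ
  h (suc j) = (+ 20 / 1) * knotDrop (toℕ j)

  0≤h : ∀ j → 0ℚ ≤ h j
  0≤h zero    = ℚ.≤-refl
  0≤h (suc j) = proj₁ (proj₂ (knot-conditions j))

  h≤1 : ∀ j → h j ≤ 1ℚ
  h≤1 zero    = 0≤1
  h≤1 (suc j) = proj₁ (proj₂ (proj₂ (knot-conditions j)))

  K : ℕ
  K = 40 ℕ.* q

  far-X : ∀ k → K ℕ.≤ k → v k 0 ≤ α zero
  far-X k K≤k = ℚ.≤-trans (v-0≤ k) (*-monoˡ (0≤fromℕ n) (ℚ.≤-trans (^-antimono K≤k) (X^≤knot 40 ℕ.≤-refl)))

  far : ∀ k m → K ℕ.≤ k → v k m ≤ α zero
  far k zero    K≤k = far-X k K≤k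
  far k (suc m) K≤k = ℚ.≤-trans (ℚ.+-monoʳ-≤ (fromℕ n) (ℚ.neg-antimono-≤ (meanRank-mono (k ℕ.* w) m))) (far k m K≤k)

  -- Within a block of `q` windows the power lies below the chord between its end values, and these
  -- lie below the knots; what remains is to rewrite the segment by intercept and slope.
  on-chord : ∀ j r d → r ℕ.+ d ≡ q → (j<40 : j ℕ.< 40) →
    fromℕ n * X ^ (r ℕ.+ j ℕ.* q) ≤ fromℕ n * height j - ((+ 20 / 1) * knotDrop j) * (fromℕ w * fromℕ (r ℕ.+ j ℕ.* q))
  on-chord j r d r+d≡q j<40 = begin
    fromℕ n * X ^ (r ℕ.+ j ℕ.* q)
      ≡⟨ cong₂ _*_ n≡″ (^-+ X r (j ℕ.* q)) ⟩
    ((+ 20 / 1) * (Q * W)) * (X ^ r * P)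
      ≡⟨ assoc Q W (X ^ r) P ⟩
    ((+ 20 / 1) * W) * ((Q * X ^ r) * P)
      ≤⟨ *-monoˡ 0≤20W (*-monoʳ (0≤^ 0≤X (j ℕ.* q)) (chord r d)) ⟩
    ((+ 20 / 1) * W) * ((fromℕ d + fromℕ r * X ^ (r ℕ.+ d)) * P)
      ≡⟨ *-congˡ ((+ 20 / 1) * W) (trans (expand (fromℕ d) (fromℕ r) (X ^ (r ℕ.+ d)) P) (cong (λ z → fromℕ d * P + fromℕ r * z) (trans (cong (λ z → X ^ z * P) r+d≡q) (sym (^-+ X q (j ℕ.* q)))))) ⟩
    ((+ 20 / 1) * W) * (fromℕ d * P + fromℕ r * X ^ (suc j ℕ.* q))
      ≤⟨ *-monoˡ 0≤20W (ℚ.+-mono-≤ (*-monoˡ (0≤fromℕ d) (X^≤knot j (ℕ.<⇒≤ j<40))) (*-monoˡ (0≤fromℕ r) (X^≤knot (suc j) j<40))) ⟩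
    ((+ 20 / 1) * W) * (fromℕ d * knotValue j + fromℕ r * knotValue (suc j))
      ≡⟨ collect W (fromℕ d) (fromℕ r) (knotValue j) (knotValue (suc j)) (fromℕ j) ⟩
    ((+ 20 / 1) * ((fromℕ r + fromℕ d) * W)) * (knotValue j + fromℕ j * (knotValue j - knotValue (suc j))) - ((+ 20 / 1) * (knotValue j - knotValue (suc j))) * (W * (fromℕ r + fromℕ j * (fromℕ r + fromℕ d)))
      ≡⟨ cong₂ (λ z x → ((+ 20 / 1) * (z * W)) * (knotValue j + x * knotDrop j) - ((+ 20 / 1) * knotDrop j) * (W * (fromℕ r + fromℕ j * z))) (sym (fromℕ-+ r d)) (fromℕ≡/1 j) ⟩
    ((+ 20 / 1) * (Q * W)) * height j - ((+ 20 / 1) * knotDrop j) * (W * (fromℕ r + fromℕ j * Q))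
      ≡⟨ cong₂ (λ z x → z * height j - ((+ 20 / 1) * knotDrop j) * (W * x)) (sym n≡″) (trans (cong (λ z → fromℕ r + fromℕ j * fromℕ z) r+d≡q) (trans (+-congˡ (fromℕ r) (sym (fromℕ-* j q))) (sym (fromℕ-+ r (j ℕ.* q))))) ⟩
    fromℕ n * height j - ((+ 20 / 1) * knotDrop j) * (W * fromℕ (r ℕ.+ j ℕ.* q)) ∎
    where
    open ℚ.≤-Reasoning
    Q W P : ℚ
    Q = fromℕ (r ℕ.+ d)
    W = fromℕ w
    P = X ^ (j ℕ.* q)
    n≡″ : fromℕ n ≡ (+ 20 / 1) * (Q * W)
    n≡″ = trans n≡′ (cong (λ z → (+ 20 / 1) * (fromℕ z * W)) (sym r+d≡q))
    0≤20W : 0ℚ ≤ (+ 20 / 1) * W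
    0≤20W = 0≤* (ℚ.nonNegative⁻¹ (+ 20 / 1)) (0≤fromℕ w)
    assoc : ∀ Q W R P → ((+ 20 / 1) * (Q * W)) * (R * P) ≡ ((+ 20 / 1) * W) * ((Q * R) * P)
    assoc = solve-∀ ℚ-ring
    expand : ∀ d r R P → (d + r * R) * P ≡ d * P + r * (R * P)
    expand = solve-∀ ℚ-ring
    collect : ∀ W d r y y′ j → ((+ 20 / 1) * W) * (d * y + r * y′)
      ≡ ((+ 20 / 1) * ((r + d) * W)) * (y + j * (y - y′)) - ((+ 20 / 1) * (y - y′)) * (W * (r + j * (r + d)))
    collect = solve-∀ ℚ-ring

  initial : ∀ k → ∃ λ j → v k 0 ≤ α j - h j * (fromℕ w * fromℕ k)
  initial k with ℕ.<-≤-connex k K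
  ... | inj₂ K≤k = zero , ℚ.≤-trans (far-X k K≤k) (ℚ.≤-reflexive (lemma (α zero) (fromℕ w * fromℕ k)))
    where
    lemma : ∀ a x → a ≡ a - 0ℚ * x
    lemma = solve-∀ ℚ-ring
  ... | inj₁ k<K = suc (fromℕ< j<40) , ℚ.≤-trans (v-0≤ k)
    (subst (λ i → fromℕ n * X ^ k ≤ fromℕ n * height i - ((+ 20 / 1) * knotDrop i) * (fromℕ w * fromℕ k)) (sym (Fin.toℕ-fromℕ< j<40))
      (subst (λ z → fromℕ n * X ^ z ≤ fromℕ n * height (k ℕ./ q) - ((+ 20 / 1) * knotDrop (k ℕ./ q)) * (fromℕ w * fromℕ z)) (sym (m≡m%n+[m/n]*n k q))
        (on-chord (k ℕ./ q) (k % q) (q ℕ.∸ (k % q)) (ℕ.m+[n∸m]≡n (ℕ.<⇒≤ (m%n<n k q))) j<40)))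
    where
    j<40 : k ℕ./ q ℕ.< 40
    j<40 = m<n*o⇒m/o<n k<K

  κ : ℚ
  κ = noise (K ℕ.* w ℕ.+ Λ)

  noise-mono : ∀ {i j} → i ℕ.≤ j → noise i ≤ noise j
  noise-mono i≤j = *-monoˡ (0≤+ (0≤+ 0≤b₁ 0≤b₁) 0≤b₁) (*-monoʳ (0≤square ((1ℚ + 1ℚ) * 1/w)) (fromℕ-mono i≤j))

  0≤κ : 0ℚ ≤ κ
  0≤κ = 0≤* (0≤+ (0≤+ 0≤b₁ 0≤b₁) 0≤b₁) (0≤* (0≤fromℕ (K ℕ.* w ℕ.+ Λ)) (0≤square ((1ℚ + 1ℚ) * 1/w)))

  drop≡ : ∀ k m → (v k m - v (suc k) m) * 1/w ≡ meanSlope (k ℕ.* w) m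
  drop≡ k m = lemma (fromℕ n) (meanRank (k ℕ.* w) m) (meanRank (w ℕ.+ k ℕ.* w) m) 1/w
    where
    lemma : ∀ n r r′ i → ((n - r) - (n - r′)) * i ≡ (r′ - r) * i
    lemma = solve-∀ ℚ-ring

  step : ∀ k m → k ℕ.< K → m ℕ.< Λ → v k (suc m) + cubic-gain a₁ b₁ ((v k m - v (suc k) m) * 1/w) ≤ v k m + κ
  step k m k<K m<Λ = begin
    v k (suc m) + cubic-gain a₁ b₁ ((v k m - v (suc k) m) * 1/w)
      ≡⟨ cong (λ z → v k (suc m) + cubic-gain a₁ b₁ z) (drop≡ k m) ⟩
    (fromℕ n - R′) + G
      ≤⟨ ≤-by ((R′ + noise (k ℕ.* w ℕ.+ m)) - (R + G)) (p≤q⇒0≤q-p (meanRank-growth (k ℕ.* w) m)) (lemma (fromℕ n) R R′ G (noise (k ℕ.* w ℕ.+ m))) ⟩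
    v k m + noise (k ℕ.* w ℕ.+ m)
      ≤⟨ ℚ.+-monoʳ-≤ (v k m) (noise-mono (ℕ.+-mono-≤ (ℕ.*-monoˡ-≤ w (ℕ.<⇒≤ k<K)) (ℕ.<⇒≤ m<Λ))) ⟩
    v k m + κ ∎
    where
    open ℚ.≤-Reasoning
    R R′ G : ℚ
    R = meanRank (k ℕ.* w) m
    R′ = meanRank (k ℕ.* w) (suc m)
    G = cubic-gain a₁ b₁ (meanSlope (k ℕ.* w) m)
    lemma : ∀ n r r′ g e → ((n - r′) + g) + ((r′ + e) - (r + g)) ≡ (n - r) + e
    lemma = solve-∀ ℚ-ring

  steep : (a₁ + b₁ * (1ℚ + 1ℚ + 1ℚ)) * 1/w ≤ 1ℚ
  steep = ℚ.≤-trans (*-monoʳ 0≤1/w (ℚ.≤-trans (toWitness {a? = (a₁ + b₁ * (1ℚ + 1ℚ + 1ℚ)) ℚ.≤? (+ 3 / 1)} _) 3≤w)) (ℚ.≤-reflexive (*-inverse-fromℕ w))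

  lines≤ : ∀ j → α j - fromℕ Λ * cubic-gain a₁ b₁ (h j) ≤ fromℕ n * ū
  lines≤ zero = ℚ.≤-trans (ℚ.≤-reflexive (trans (+-congˡ (α zero) (cong -_ (trans (*-congˡ (fromℕ Λ) flat) (ℚ.*-zeroʳ (fromℕ Λ))))) (ℚ.+-identityʳ (α zero)))) (*-monoˡ (0≤fromℕ n) knot₄₀≤ū)
    where
    flat : cubic-gain a₁ b₁ 0ℚ ≡ 0ℚ
    flat = refl
  lines≤ (suc j) = begin
    fromℕ n * H - fromℕ Λ * G
      ≡⟨ trans (cong₂ (λ x z → x * H - z * G) n≡ Λ≡) (factor (fromℕ s) H G) ⟩
    fromℕ s * ((+ 100 / 1) * H - (+ 103 / 1) * G)
      ≤⟨ *-monoˡ (0≤fromℕ s) (proj₂ (proj₂ (proj₂ (knot-conditions j)))) ⟩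
    fromℕ s * ((+ 100 / 1) * ū)
      ≡⟨ trans (swap (fromℕ s) (+ 100 / 1) ū) (cong (_* ū) (sym n≡)) ⟩
    fromℕ n * ū ∎
    where
    open ℚ.≤-Reasoning
    H G : ℚ
    H = height (toℕ j)
    G = cubic-gain a₁ b₁ ((+ 20 / 1) * knotDrop (toℕ j))
    factor : ∀ s H G → ((+ 100 / 1) * s) * H - ((+ 103 / 1) * s) * G ≡ s * ((+ 100 / 1) * H - (+ 103 / 1) * G)
    factor = solve-∀ ℚ-ring
    swap : ∀ s c u → s * (c * u) ≡ (c * s) * u
    swap = solve-∀ ℚ-ring

  uncovered : ∀ Z {{_ : NonZero Z}} → fromℕ Z * (fromℕ n - meanRankAt 1) ≤
    (fromℕ Z * (fromℕ Z * fromℕ w) + fromℕ Z * (fromℕ n * ū)) + fromℕ Λ * (fromℕ Z * κ + 1ℚ)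
  uncovered Z = Comparison.final-bound 0≤a₁ 0≤b₁ (toWitness {a? = (a₁ + b₁) ℚ.≤? 1ℚ} _) (0≤fromℕ w) 0≤1/w (*-inverse-fromℕ w) steep
    v K Λ κ step 0≤κ (λ k m → subst (0ℚ ≤_) (sym (drop≡ k m)) (0≤meanSlope (k ℕ.* w) m)) (λ k m → subst (_≤ 1ℚ) (sym (drop≡ k m)) (meanSlope≤1 (k ℕ.* w) m))
    α h 0≤h h≤1 refl far initial Z lines≤

-- The potential of the hard instance

pos : ℚ → ℚ
pos p = p ℚ.⊔ 0ℚ

0≤pos : ∀ p → 0ℚ ≤ pos p
0≤pos p = ℚ.p≤q⊔p p 0ℚ

p≤pos : ∀ p → p ≤ pos p
p≤pos p = ℚ.p≤p⊔q p 0ℚ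

pos-mono : ∀ {p q} → p ≤ q → pos p ≤ pos q
pos-mono = ℚ.⊔-monoˡ-≤ 0ℚ

pos-≤ : ∀ {p q} → p ≤ q → 0ℚ ≤ q → pos p ≤ q
pos-≤ = ℚ.⊔-lub

p≤floor+1 : ∀ p → p ≤ (ℚ.floor p ℤ.+ + 1) / 1
p≤floor+1 p@(ℚ.mkℚ a d-1 _) = ℚ.toℚᵘ-cancel-≤ (ℚᵘ.≤-respʳ-≃ (ℚᵘ.≃-sym (ℚ.toℚᵘ-fromℚᵘ (ℚᵘ.mkℚᵘ (f ℤ.+ + 1) 0))) (ℚᵘ.*≤* (begin
  a ℤ.* + 1                    ≡⟨ ℤ.*-identityʳ a ⟩
  a                            ≡⟨ ℤ.a≡a%n+[a/n]*n a (+ d) ⟩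
  + r ℤ.+ f ℤ.* + d            ≤⟨ ℤ.+-monoˡ-≤ (f ℤ.* + d) (ℤ.+≤+ (ℕ.<⇒≤ (ℤ.n%d<d a (+ d)))) ⟩
  + d ℤ.+ f ℤ.* + d            ≡⟨ trans (ℤ.+-comm (+ d) (f ℤ.* + d)) (sym (trans (ℤ.*-distribʳ-+ (+ d) f (+ 1)) (cong (λ x → f ℤ.* + d ℤ.+ x) (ℤ.*-identityˡ (+ d))))) ⟩
  (f ℤ.+ + 1) ℤ.* + d          ∎)))
  where
  open ℤ.≤-Reasoning
  d = suc d-1
  f = a ℤ./ + d
  r = a ℤ.% + d

-- Bounds the denominators by 10⁷, so that 400 steps of the recursion can be evaluated; rounding
-- upwards preserves the inequalities.
roundUp : ℚ → ℚ
roundUp p = ((ℚ.floor (p * (+ 10000000 / 1)) ℤ.+ + 1) / 1) * (+ 1 / 10000000)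

≤roundUp : ∀ p → p ≤ roundUp p
≤roundUp p = subst (_≤ roundUp p) (lemma p) (*-monoʳ (ℚ.nonNegative⁻¹ (+ 1 / 10000000)) (p≤floor+1 (p * (+ 10000000 / 1))))
  where
  lemma : ∀ p → (p * (+ 10000000 / 1)) * (+ 1 / 10000000) ≡ p
  lemma = solve-∀ ℚ-ring

-- the point at which 1 − y³ is linearised when a fraction m / 400 of the arrivals remains:
-- close to the fraction of matched vertices under an optimal algorithm
tangentPoint : ℕ → ℚ
tangentPoint m = pos (+ 7 / 10 - + m / 500)

-- Rates per offline vertex. The 1 stands for heavy types, 10000 · 1/10000, counted at full weight
-- without deducting the price `A`; 1/5 is the rate of singles; 99/50 = 3 · 66/100 combines the rate
-- of triples with the slope 3z² of the tangent.
slopeRate : ℚ → ℚ → ℚ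
slopeRate z A = (1ℚ + (+ 1 / 5) * pos (+ 5 / 4 - A)) + (+ 99 / 50) * ((z * z) * pos (+ 27 / 25 - A))

-- 1699/10000 and 33/50 are the rates of globals and triples; the cubic factor is (1 - z)²(1 + 2z),
-- the constant term of the tangent.
offsetRate : ℚ → ℚ → ℚ
offsetRate z A = (+ 1699 / 10000) * pos (1ℚ - A) + (+ 33 / 50) * ((1ℚ + ((+ 2 / 1) * z - (+ 3 / 1)) * (z * z)) * pos (+ 27 / 25 - A))

-- per offline vertex: the value of an unmatched vertex, and the value of the globals and triples yet to come
next : ℕ → ℚ × ℚ → ℚ × ℚ
next m (A , B) = roundUp (A + (+ 1 / 400) * slopeRate (tangentPoint m) A) , roundUp (B + (+ 1 / 400) * offsetRate (tangentPoint m) A)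

values : ℕ → ℚ × ℚ
values zero    = 0ℚ , 0ℚ
values (suc m) = next m (values m)

values₄₀₀ : proj₁ (values 400) + proj₂ (values 400) ≤ + 1473 / 1000
values₄₀₀ = toWitness {a? = (proj₁ (values 400) + proj₂ (values 400)) ℚ.≤? (+ 1473 / 1000)} _

-- The potential bounds every algorithm on the hard instance

module Bounded (s n Λ L : ℕ) {{_ : NonZero n}} {{_ : NonZero Λ}} {{_ : NonZero L}}
  (n≡ : fromℕ n ≡ (+ 100 / 1) * fromℕ s) (Λ≡ : fromℕ Λ ≡ (+ 103 / 1) * fromℕ s)
  (L≡ : (+ 400 / 1) * fromℕ L ≡ (+ 103 / 1) * fromℕ s) where
  open Expectations s n Λ n≡ Λ≡
  open Rank n hiding (J)
  open Process n hiding (0≤1/n)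
  open Instance inst using (History; Available; typeProb)

  1/L : ℚ
  1/L = + 1 / L

  0≤1/L : 0ℚ ≤ 1/L
  0≤1/L = ℚ.nonNegative⁻¹ 1/L {{ℚ.normalize-nonNeg 1 L}}

  n/L : fromℕ n * 1/L ≡ + 40000 / 103
  n/L = begin
    fromℕ n * 1/L                                              ≡⟨ cong (_* 1/L) n≡ ⟩
    ((+ 100 / 1) * fromℕ s) * 1/L                              ≡⟨ lemma (fromℕ s) 1/L ⟩
    (+ 100 / 103) * (((+ 103 / 1) * fromℕ s) * 1/L)            ≡⟨ cong (λ x → (+ 100 / 103) * (x * 1/L)) (sym L≡) ⟩
    (+ 100 / 103) * (((+ 400 / 1) * fromℕ L) * 1/L)            ≡⟨ lemma′ (fromℕ L) 1/L ⟩
    (+ 40000 / 103) * (fromℕ L * 1/L)                          ≡⟨ trans (*-congˡ (+ 40000 / 103) (*-inverse-fromℕ L)) (ℚ.*-identityʳ (+ 40000 / 103)) ⟩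
    + 40000 / 103 ∎
    where
    open ≡-Reasoning
    lemma : ∀ s i → ((+ 100 / 1) * s) * i ≡ (+ 100 / 103) * (((+ 103 / 1) * s) * i)
    lemma = solve-∀ ℚ-ring
    lemma′ : ∀ l i → (+ 100 / 103) * (((+ 400 / 1) * l) * i) ≡ (+ 40000 / 103) * (l * i)
    lemma′ = solve-∀ ℚ-ring

  -- One step of the table covers L = Λ/400 arrivals; linear interpolation provides a value after
  -- every single arrival.
  module Interpolate (f : ℕ → ℚ) (f-mono : ∀ m → f m ≤ f (suc m)) where

    increment : ℕ → ℚ
    increment m = (f (suc m) - f m) * 1/L

    interpolated : ℕ → ℚ
    interpolated zero    = f 0
    interpolated (suc k) = interpolated k + increment (k ℕ./ L)

    block : ∀ m r → r ℕ.< L → (r ℕ.+ m ℕ.* L) ℕ./ L ≡ m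
    block m r r<L = trans (+-distrib-/-∣ʳ r (n∣m*n m)) (cong₂ ℕ._+_ (m<n⇒m/n≡0 r<L) (m*n/n≡m m L))

    interpolated≡ : ∀ m r → r ℕ.≤ L → interpolated (r ℕ.+ m ℕ.* L) ≡ f m + fromℕ r * increment m
    interpolated≡ zero    zero    _ = lemma (f 0) (increment 0)
      where
      lemma : ∀ x y → x ≡ x + 0ℚ * y
      lemma = solve-∀ ℚ-ring
    interpolated≡ (suc m) zero    _ = begin
      interpolated (L ℕ.+ m ℕ.* L)                    ≡⟨ interpolated≡ m L ℕ.≤-refl ⟩
      f m + fromℕ L * ((f (suc m) - f m) * 1/L)       ≡⟨ lemma (f m) (fromℕ L) (f (suc m)) 1/L ⟩
      f m + (fromℕ L * 1/L) * (f (suc m) - f m)       ≡⟨ cong (λ x → f m + x * (f (suc m) - f m)) (*-inverse-fromℕ L) ⟩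
      f m + 1ℚ * (f (suc m) - f m)                    ≡⟨ lemma′ (f m) (f (suc m)) (increment (suc m)) ⟩
      f (suc m) + 0ℚ * increment (suc m)              ∎
      where
      open ≡-Reasoning
      lemma : ∀ x l y i → x + l * ((y - x) * i) ≡ x + (l * i) * (y - x)
      lemma = solve-∀ ℚ-ring
      lemma′ : ∀ x y z → x + 1ℚ * (y - x) ≡ y + 0ℚ * z
      lemma′ = solve-∀ ℚ-ring
    interpolated≡ m (suc r) r<L = trans (cong₂ (λ x k → x + increment k) (interpolated≡ m r (ℕ.<⇒≤ r<L)) (block m r r<L))
      (lemma (f m) (fromℕ r) (increment m))
      where
      lemma : ∀ x r y → (x + r * y) + y ≡ x + (1ℚ + r) * y
      lemma = solve-∀ ℚ-ring

    interpolated-end : ∀ m → interpolated (m ℕ.* L) ≡ f m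
    interpolated-end m = trans (interpolated≡ m 0 ℕ.z≤n) (trans (+-congˡ (f m) (ℚ.*-zeroˡ (increment m))) (ℚ.+-identityʳ (f m)))

    0≤increment : ∀ m → 0ℚ ≤ increment m
    0≤increment m = 0≤* (p≤q⇒0≤q-p (f-mono m)) 0≤1/L

    -- Lets the surplus over the current price be bounded by the surplus over the price at the start
    -- of the block, which is the one in the recursion.
    interpolated-≥ : ∀ k → f (k ℕ./ L) ≤ interpolated k
    interpolated-≥ k = subst (λ z → f (k ℕ./ L) ≤ interpolated z) (sym (m≡m%n+[m/n]*n k L))
      (≤-by (fromℕ (k % L) * increment (k ℕ./ L)) (0≤* (0≤fromℕ (k % L)) (0≤increment (k ℕ./ L)))
        (sym (interpolated≡ (k ℕ./ L) (k % L) (ℕ.<⇒≤ (m%n<n k L)))))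

  price rest : ℕ → ℚ
  price m = proj₁ (values m)
  rest m = proj₂ (values m)

  z : ℕ → ℚ
  z = tangentPoint

  0≤pattern : ∀ {x} → 0ℚ ≤ x → 0ℚ ≤ 1ℚ + ((+ 2 / 1) * x - (+ 3 / 1)) * (x * x)
  0≤pattern {x} 0≤x = subst (0ℚ ≤_) (lemma x) (0≤* (0≤square (1ℚ - x)) (0≤+ 0≤1 (0≤* (ℚ.nonNegative⁻¹ (+ 2 / 1)) 0≤x)))
    where
    lemma : ∀ x → ((1ℚ - x) * (1ℚ - x)) * (1ℚ + (+ 2 / 1) * x) ≡ 1ℚ + ((+ 2 / 1) * x - (+ 3 / 1)) * (x * x)
    lemma = solve-∀ ℚ-ring

  price-step : ∀ m → price m + (+ 1 / 400) * slopeRate (z m) (price m) ≤ price (suc m)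
  price-step m = ≤roundUp (price m + (+ 1 / 400) * slopeRate (z m) (price m))

  rest-step : ∀ m → rest m + (+ 1 / 400) * offsetRate (z m) (price m) ≤ rest (suc m)
  rest-step m = ≤roundUp (rest m + (+ 1 / 400) * offsetRate (z m) (price m))

  price-mono : ∀ m → price m ≤ price (suc m)
  price-mono m = ℚ.≤-trans (≤-by ((+ 1 / 400) * slopeRate (z m) (price m)) (0≤* (ℚ.nonNegative⁻¹ (+ 1 / 400))
    (0≤+ (0≤+ 0≤1 (0≤* (ℚ.nonNegative⁻¹ (+ 1 / 5)) (0≤pos (+ 5 / 4 - price m)))) (0≤* (ℚ.nonNegative⁻¹ (+ 99 / 50)) (0≤* (0≤square (z m)) (0≤pos (+ 27 / 25 - price m)))))) refl) (price-step m)

  rest-mono : ∀ m → rest m ≤ rest (suc m)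
  rest-mono m = ℚ.≤-trans (≤-by ((+ 1 / 400) * offsetRate (z m) (price m)) (0≤* (ℚ.nonNegative⁻¹ (+ 1 / 400))
    (0≤+ (0≤* (ℚ.nonNegative⁻¹ (+ 1699 / 10000)) (0≤pos (1ℚ - price m))) (0≤* (ℚ.nonNegative⁻¹ (+ 33 / 50)) (0≤* (0≤pattern {z m} (0≤pos (+ 7 / 10 - + m / 500))) (0≤pos (+ 27 / 25 - price m)))))) refl) (rest-step m)

  0≤price : ∀ m → 0ℚ ≤ price m
  0≤price zero    = ℚ.≤-refl
  0≤price (suc m) = ℚ.≤-trans (0≤price m) (price-mono m)

  module 𝒜 = Interpolate price price-mono
  module ℬ = Interpolate rest rest-mono

  matchedSet : History → Subset n
  matchedSet []                 = Vec.replicate n false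
  matchedSet ((i , nothing) ∷ h) = matchedSet h
  matchedSet ((i , just j) ∷ h)  = matchedSet h [ j ]≔ true

  matchedSet-∈ : ∀ h j → lookup (matchedSet h) j ≡ true → just j ∈ map proj₂ h
  matchedSet-∈ []                 j eq with () ← trans (sym (Vec.lookup-replicate j false)) eq
  matchedSet-∈ ((i , nothing) ∷ h) j eq = there (matchedSet-∈ h j eq)
  matchedSet-∈ ((i , just k) ∷ h)  j eq with j Fin.≟ k
  ... | yes refl = here refl
  ... | no  j≢k  = there (matchedSet-∈ h j (trans (sym (Vec.lookup∘update′ j≢k (matchedSet h) true)) eq))

  size-set-new : ∀ {m} (C : Subset m) v → lookup C v ≡ false → size (C [ v ]≔ true) ≡ suc (size C)
  size-set-new (false ∷ C) zero    eq = refl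
  size-set-new (true  ∷ C) (suc v) eq = cong suc (size-set-new C v eq)
  size-set-new (false ∷ C) (suc v) eq = size-set-new C v eq

  coverage-set : ∀ C v → lookup C v ≡ false → coverage (C [ v ]≔ true) ≡ 1/n + coverage C
  coverage-set C v eq = trans (cong (λ k → fromℕ k * 1/n) (size-set-new C v eq)) (lemma (fromℕ (size C)) 1/n)
    where
    lemma : ∀ k i → (1ℚ + k) * i ≡ i + k * i
    lemma = solve-∀ ℚ-ring

  worth : ℕ → Subset n → ℚ
  worth k C = fromℕ n * (1-cov C * 𝒜.interpolated k + ℬ.interpolated k)

  surplus : ℕ → Kind → ℚ
  surplus k κ = pos (kindWeight κ - 𝒜.interpolated k)

  potential : ℕ → History → ℚ
  potential k h = worth k (matchedSet h)

  -- Matching a free vertex lowers `worth` by exactly the interpolated price, so it gains at most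
  -- the surplus; and it is possible only if the neighbourhood leaves the matched set.
  value : ℕ → History → I → ℚ
  value k h i = potential k h + surplus k (kind i) * leaf (nb i) (matchedSet h)

  0≤potential : ∀ h → 0ℚ ≤ potential 0 h
  0≤potential h = 0≤* (0≤fromℕ n) (0≤+ (0≤* (0≤1-cov (matchedSet h)) ℚ.≤-refl) ℚ.≤-refl)

  skip : ∀ k h i → potential k ((i , nothing) ∷ h) ≤ value k h i
  skip k h i = ≤-by (surplus k (kind i) * leaf (nb i) (matchedSet h)) (0≤* (0≤pos (kindWeight (kind i) - 𝒜.interpolated k)) (0≤fromℕ (leaves (nb i) (matchedSet h)))) refl

  take : ∀ k h i j → Available h i j → kindWeight (kind i) + potential k ((i , just j) ∷ h) ≤ value k h i
  take k h i j (edge , free) = begin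
    W + fromℕ n * ((1ℚ - coverage (C [ j ]≔ true)) * a + b)
      ≡⟨ cong (λ x → W + fromℕ n * ((1ℚ - x) * a + b)) (coverage-set C j unmatched) ⟩
    W + fromℕ n * ((1ℚ - (1/n + coverage C)) * a + b)
      ≡⟨ lemma W (fromℕ n) 1/n (coverage C) a b ⟩
    fromℕ n * ((1ℚ - coverage C) * a + b) + (W - (fromℕ n * 1/n) * a)
      ≡⟨ cong (λ x → worth k C + (W - x * a)) (*-inverse-fromℕ n) ⟩
    worth k C + (W - 1ℚ * a)
      ≡⟨ cong (λ x → worth k C + (W - x)) (ℚ.*-identityˡ a) ⟩
    worth k C + (W - a)
      ≤⟨ ℚ.+-monoʳ-≤ (worth k C) (ℚ.≤-trans (p≤pos (W - a)) (ℚ.≤-reflexive (sym (trans (*-congˡ (pos (W - a)) leaves-1) (ℚ.*-identityʳ (pos (W - a))))))) ⟩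
    value k h i ∎
    where
    open ℚ.≤-Reasoning
    C = matchedSet h
    W a b : ℚ
    W = kindWeight (kind i)
    a = 𝒜.interpolated k
    b = ℬ.interpolated k
    unmatched : lookup C j ≡ false
    unmatched with lookup C j in eq
    ... | false = refl
    ... | true  = ⊥-elim (free (matchedSet-∈ h j eq))
    leaves-1 : leaf (nb i) C ≡ 1ℚ
    leaves-1 with inside (nb i) C in eq
    ... | false = refl
    ... | true with () ← trans (sym unmatched) (inside⇒lookup (nb i) C eq (toWitness edge))
    lemma : ∀ W n i c a b → W + n * ((1ℚ - (i + c)) * a + b) ≡ n * ((1ℚ - c) * a + b) + (W - (n * i) * a)
    lemma = solve-∀ ℚ-ring

  -- the linearisation 1 − y³ ≤ (1 − z)² (1 + 2 z) + 3 z² (1 − y)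
  tangent : ∀ {y x} → 0ℚ ≤ y → 0ℚ ≤ x → 1ℚ - y * (y * y) ≤ (1ℚ + ((+ 2 / 1) * x - (+ 3 / 1)) * (x * x)) + ((+ 3 / 1) * (x * x)) * (1ℚ - y)
  tangent {y} {x} 0≤y 0≤x = ≤-by (((y - x) * (y - x)) * (y + (+ 2 / 1) * x)) (0≤* (0≤square (y - x)) (0≤+ 0≤y (0≤* (ℚ.nonNegative⁻¹ (+ 2 / 1)) 0≤x))) (lemma y x)
    where
    lemma : ∀ y x → (1ℚ - y * (y * y)) + ((y - x) * (y - x)) * (y + (+ 2 / 1) * x) ≡ (1ℚ + ((+ 2 / 1) * x - (+ 3 / 1)) * (x * x)) + ((+ 3 / 1) * (x * x)) * (1ℚ - y)
    lemma = solve-∀ ℚ-ring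

  -- A table step advances time by 1/400 and is shared by `L` arrivals; n/L = 40000/103 turns it
  -- into the factor n/Λ = 100/103 per arrival.
  spread : ∀ r a a′ → a + (+ 1 / 400) * r ≤ a′ → (+ 100 / 103) * r ≤ fromℕ n * ((a′ - a) * 1/L)
  spread r a a′ le = begin
    (+ 100 / 103) * r                    ≡⟨ lemma r ⟩
    (+ 40000 / 103) * ((+ 1 / 400) * r)  ≤⟨ *-monoˡ (ℚ.nonNegative⁻¹ (+ 40000 / 103)) difference ⟩
    (+ 40000 / 103) * (a′ - a)           ≡⟨ cong (_* (a′ - a)) (sym n/L) ⟩
    (fromℕ n * 1/L) * (a′ - a)           ≡⟨ assoc (fromℕ n) 1/L (a′ - a) ⟩
    fromℕ n * ((a′ - a) * 1/L)           ∎
    where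
    open ℚ.≤-Reasoning
    lemma : ∀ x → (+ 100 / 103) * x ≡ (+ 40000 / 103) * ((+ 1 / 400) * x)
    lemma = solve-∀ ℚ-ring
    cancel : ∀ x a a′ → x + (a′ - (a + x)) ≡ a′ - a
    cancel = solve-∀ ℚ-ring
    difference : (+ 1 / 400) * r ≤ a′ - a
    difference = ≤-by (a′ - (a + (+ 1 / 400) * r)) (p≤q⇒0≤q-p le) (cancel ((+ 1 / 400) * r) a a′)
    assoc : ∀ n i x → (n * i) * x ≡ n * (x * i)
    assoc = solve-∀ ℚ-ring

  leaf≤1 : ∀ e C → leaf e C ≤ 1ℚ
  leaf≤1 e C = fromℕ-mono (leaves-≤1 e C)

  -- After bounding the leaving probability by 1 for globals and by the tangent for triples, the
  -- expression is affine in the free fraction of `J`; its two coefficients are what the recursions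
  -- for `price` and `rest` provide.
  kind-average : ∀ k C → byKind (λ κ → surplus k κ * kindLeaf C κ) ≤ fromℕ n * (1-cov C * 𝒜.increment (k ℕ./ L) + ℬ.increment (k ℕ./ L))
  kind-average k C = begin
    kindProb global * (surplus k global * leaf (allFin n) C) + (kindProb triple * (surplus k triple * (1ℚ - cov * (cov * cov))) + (kindProb single * (surplus k single * (1ℚ - cov)) + (kindProb heavy * (surplus k heavy * (1ℚ - cov)) + 0ℚ)))
      ≤⟨ ℚ.+-mono-≤ (*-monoˡ (ℚ.nonNegative⁻¹ (kindProb global)) (product≤ (0≤pos (1ℚ - a)) (0≤fromℕ (leaves (allFin n) C)) (below 1ℚ) (leaf≤1 (allFin n) C)))
        (ℚ.+-mono-≤ (*-monoˡ (ℚ.nonNegative⁻¹ (kindProb triple)) (product≤ (0≤pos (+ 27 / 25 - a)) 0≤cubic (below (+ 27 / 25)) (tangent 0≤cov 0≤x)))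
          (ℚ.+-mono-≤ (*-monoˡ (ℚ.nonNegative⁻¹ (kindProb single)) (*-monoʳ (0≤1-cov C) (below (+ 5 / 4))))
            (ℚ.+-monoˡ-≤ 0ℚ (*-monoˡ (ℚ.nonNegative⁻¹ (kindProb heavy)) (*-monoʳ (0≤1-cov C) heavy≤))))) ⟩
    kindProb global * (p₀ * 1ℚ) + (kindProb triple * (p₁ * (ψ + ((+ 3 / 1) * (x * x)) * (1ℚ - cov))) + (kindProb single * (p₂ * (1ℚ - cov)) + (kindProb heavy * ((+ 10000 / 1) * (1ℚ - cov)) + 0ℚ)))
      ≡⟨ collect p₀ p₁ p₂ ψ x cov ⟩
    (1ℚ - cov) * ((+ 100 / 103) * slopeRate x (price m)) + (+ 100 / 103) * offsetRate x (price m)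
      ≤⟨ ℚ.+-mono-≤ (*-monoˡ (0≤1-cov C) (spread (slopeRate x (price m)) (price m) (price (suc m)) (price-step m))) (spread (offsetRate x (price m)) (rest m) (rest (suc m)) (rest-step m)) ⟩
    (1ℚ - cov) * (fromℕ n * 𝒜.increment m) + fromℕ n * ℬ.increment m
      ≡⟨ factor (fromℕ n) (1ℚ - cov) (𝒜.increment m) (ℬ.increment m) ⟩
    fromℕ n * (1-cov C * 𝒜.increment m + ℬ.increment m) ∎
    where
    open ℚ.≤-Reasoning
    m = k ℕ./ L
    cov x a p₀ p₁ p₂ ψ : ℚ
    cov = coverage C
    x = z m
    a = 𝒜.interpolated k
    p₀ = pos (1ℚ - price m)
    p₁ = pos (+ 27 / 25 - price m)
    p₂ = pos (+ 5 / 4 - price m)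
    ψ = 1ℚ + ((+ 2 / 1) * x - (+ 3 / 1)) * (x * x)
    0≤cov : 0ℚ ≤ cov
    0≤cov = 0≤coverage C
    0≤x : 0ℚ ≤ x
    0≤x = 0≤pos (+ 7 / 10 - + m / 500)
    below : ∀ W → pos (W - a) ≤ pos (W - price m)
    below W = pos-mono (ℚ.+-monoʳ-≤ W (ℚ.neg-antimono-≤ (𝒜.interpolated-≥ k)))
    0≤a : 0ℚ ≤ a
    0≤a = ℚ.≤-trans (0≤price m) (𝒜.interpolated-≥ k)
    heavy≤ : surplus k heavy ≤ + 10000 / 1
    heavy≤ = pos-≤ {+ 10000 / 1 - a} (≤-by a 0≤a (cancel (+ 10000 / 1) a)) (ℚ.nonNegative⁻¹ (+ 10000 / 1))
      where
      cancel : ∀ w a → (w - a) + a ≡ w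
      cancel = solve-∀ ℚ-ring
    0≤cubic : 0ℚ ≤ 1ℚ - cov * (cov * cov)
    0≤cubic = subst (0ℚ ≤_) (cube cov) (0≤* (0≤1-cov C) (0≤+ (0≤+ 0≤1 0≤cov) (0≤square cov)))
      where
      cube : ∀ y → (1ℚ - y) * ((1ℚ + y) + y * y) ≡ 1ℚ - y * (y * y)
      cube = solve-∀ ℚ-ring
    product≤ : ∀ {p q r t} → 0ℚ ≤ p → 0ℚ ≤ r → p ≤ q → r ≤ t → p * r ≤ q * t
    product≤ 0≤p 0≤r p≤q r≤t = ℚ.≤-trans (*-monoʳ 0≤r p≤q) (*-monoˡ (ℚ.≤-trans 0≤p p≤q) r≤t)
    collect : ∀ p₀ p₁ p₂ ψ x y →
      ((+ 1699 / 100) * (+ 1 / 103)) * (p₀ * 1ℚ) + (((+ 66 / 1) * (+ 1 / 103)) * (p₁ * (ψ + ((+ 3 / 1) * (x * x)) * (1ℚ - y))) + (((+ 20 / 1) * (+ 1 / 103)) * (p₂ * (1ℚ - y)) + (((+ 1 / 100) * (+ 1 / 103)) * ((+ 10000 / 1) * (1ℚ - y)) + 0ℚ)))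
      ≡ (1ℚ - y) * ((+ 100 / 103) * ((1ℚ + (+ 1 / 5) * p₂) + (+ 99 / 50) * ((x * x) * p₁))) + (+ 100 / 103) * ((+ 1699 / 10000) * p₀ + (+ 33 / 50) * (ψ * p₁))
    collect = solve-∀ ℚ-ring
    factor : ∀ n y a b → y * (n * a) + n * b ≡ n * (y * a + b)
    factor = solve-∀ ℚ-ring

  average : ∀ k h → sumℚ types (λ i → typeProb i * value k h i) ≤ potential (suc k) h
  average k h = begin
    sumℚ types (λ i → typeProb i * value k h i)
      ≡⟨ E-typeMean (value k h) ⟨
    E typeMean (value k h)
      ≡⟨ trans (E-+ typeMean (const (worth k C)) (λ i → surplus k (kind i) * leaf (nb i) C)) (cong₂ _+_ (E-const typeMean (worth k C)) (E-weighted-leaf (surplus k) C)) ⟩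
    worth k C + byKind (λ κ → surplus k κ * kindLeaf C κ)
      ≤⟨ ℚ.+-monoʳ-≤ (worth k C) (kind-average k C) ⟩
    worth k C + fromℕ n * (1-cov C * 𝒜.increment (k ℕ./ L) + ℬ.increment (k ℕ./ L))
      ≡⟨ lemma (fromℕ n) (1-cov C) (𝒜.interpolated k) (ℬ.interpolated k) (𝒜.increment (k ℕ./ L)) (ℬ.increment (k ℕ./ L)) ⟩
    potential (suc k) h ∎
    where
    open ℚ.≤-Reasoning
    C = matchedSet h
    lemma : ∀ n y a b a′ b′ → n * (y * a + b) + n * (y * a′ + b′) ≡ n * (y * (a + a′) + (b + b′))
    lemma = solve-∀ ℚ-ring

  potential-Λ : Λ ≡ 400 ℕ.* L → potential Λ [] ≤ fromℕ n * (+ 1473 / 1000)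
  potential-Λ Λ≡400L = *-monoˡ (0≤fromℕ n) (begin
    1-cov ∅ * 𝒜.interpolated Λ + ℬ.interpolated Λ
      ≡⟨ cong₂ (λ u t → 1-cov ∅ * u + t) (trans (cong 𝒜.interpolated Λ≡400L) (𝒜.interpolated-end 400)) (trans (cong ℬ.interpolated Λ≡400L) (ℬ.interpolated-end 400)) ⟩
    1-cov ∅ * price 400 + rest 400
      ≤⟨ ℚ.+-monoˡ-≤ (rest 400) (ℚ.≤-trans (*-monoʳ (0≤price 400) 1-cov≤1) (ℚ.≤-reflexive (ℚ.*-identityˡ (price 400)))) ⟩
    price 400 + rest 400
      ≤⟨ values₄₀₀ ⟩
    + 1473 / 1000 ∎)
    where
    open ℚ.≤-Reasoning
    ∅ = matchedSet []
    1-cov≤1 : 1-cov ∅ ≤ 1ℚ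
    1-cov≤1 = ≤-by (coverage ∅) (0≤coverage ∅) (lemma (coverage ∅))
      where
      lemma : ∀ c → (1ℚ - c) + c ≡ 1ℚ
      lemma = solve-∀ ℚ-ring

  open Typed inst using (module Potential)

  expectedALG≤ : Λ ≡ 400 ℕ.* L → ∀ {c ℓ₁ ℓ₂} (K : OrderedExtension c ℓ₁ ℓ₂) (alg : Instance.Algorithm inst K) →
    OrderedExtension._≤_ K (Instance.Algorithm.expectedALG alg) (OrderedExtension.ι K (fromℕ n * (+ 1473 / 1000)))
  expectedALG≤ Λ≡400L K alg = ≤K-trans (Potential.expectedALG≤potential K alg potential value 0≤potential skip take average)
    (OrderedExtension.ι-mono-≤ K (potential-Λ Λ≡400L))
    where open Extension K

-- The final comparison

-- n, Λ and the window w are multiples of q u; large q and u/q make all error terms negligible.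
module Conclusion (q u Z s n Λ L w : ℕ)
  {{_ : NonZero q}} {{_ : NonZero Z}} {{_ : NonZero n}} {{_ : NonZero Λ}} {{_ : NonZero L}} {{_ : NonZero w}}
  (s≡ : fromℕ s ≡ (+ 400 / 1) * (fromℕ q * fromℕ u))
  (n≡ : fromℕ n ≡ (+ 40000 / 1) * (fromℕ q * fromℕ u))
  (Λ≡ : fromℕ Λ ≡ (+ 41200 / 1) * (fromℕ q * fromℕ u))
  (L≡ : fromℕ L ≡ (+ 103 / 1) * (fromℕ q * fromℕ u))
  (w≡ : fromℕ w ≡ (+ 2000 / 1) * fromℕ u)
  (Z≡ : fromℕ Z ≡ + 100000 / 1)
  (q≥ : + 10000000000 / 1 ≤ fromℕ q)
  (u≥ : (+ 1000000 / 1) * fromℕ q ≤ fromℕ u)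
  (Λ≡400L : Λ ≡ 400 ℕ.* L)
  where

  private
    x y N : ℚ
    x = fromℕ q
    y = fromℕ u
    N = x * y

    0≤x : 0ℚ ≤ x
    0≤x = 0≤fromℕ q

    0≤y : 0ℚ ≤ y
    0≤y = 0≤fromℕ u

    0≤N : 0ℚ ≤ N
    0≤N = 0≤* 0≤x 0≤y

    1≤y : 1ℚ ≤ y
    1≤y = ℚ.≤-trans (ℚ.≤-trans (toWitness {a? = 1ℚ ℚ.≤? ((+ 1000000 / 1) * (+ 10000000000 / 1))} _) (*-monoˡ (ℚ.nonNegative⁻¹ (+ 1000000 / 1)) q≥)) u≥

    n≡s : fromℕ n ≡ (+ 100 / 1) * fromℕ s
    n≡s = trans n≡ (trans (lemma N) (*-congˡ (+ 100 / 1) (sym s≡)))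
      where
      lemma : ∀ N → (+ 40000 / 1) * N ≡ (+ 100 / 1) * ((+ 400 / 1) * N)
      lemma = solve-∀ ℚ-ring

    Λ≡s : fromℕ Λ ≡ (+ 103 / 1) * fromℕ s
    Λ≡s = trans Λ≡ (trans (lemma N) (*-congˡ (+ 103 / 1) (sym s≡)))
      where
      lemma : ∀ N → (+ 41200 / 1) * N ≡ (+ 103 / 1) * ((+ 400 / 1) * N)
      lemma = solve-∀ ℚ-ring

    L≡s : (+ 400 / 1) * fromℕ L ≡ (+ 103 / 1) * fromℕ s
    L≡s = trans (*-congˡ (+ 400 / 1) L≡) (trans (lemma N) (*-congˡ (+ 103 / 1) (sym s≡)))
      where
      lemma : ∀ N → (+ 400 / 1) * ((+ 103 / 1) * N) ≡ (+ 103 / 1) * ((+ 400 / 1) * N)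
      lemma = solve-∀ ℚ-ring

    n≡qw : fromℕ n ≡ (+ 20 / 1) * (x * fromℕ w)
    n≡qw = trans n≡ (trans (lemma x y) (cong (λ z → (+ 20 / 1) * (x * z)) (sym w≡)))
      where
      lemma : ∀ x y → (+ 40000 / 1) * (x * y) ≡ (+ 20 / 1) * (x * ((+ 2000 / 1) * y))
      lemma = solve-∀ ℚ-ring

    3≤w : + 3 / 1 ≤ fromℕ w
    3≤w = ℚ.≤-trans (ℚ.≤-trans (toWitness {a? = (+ 3 / 1) ℚ.≤? ((+ 2000 / 1) * 1ℚ)} _) (*-monoˡ (ℚ.nonNegative⁻¹ (+ 2000 / 1)) 1≤y)) (ℚ.≤-reflexive (sym w≡))

  open Covering s n Λ q w n≡s Λ≡s n≡qw 3≤w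
  open Instance inst using (expectedOPT)

  private
    1/w : ℚ
    1/w = + 1 / w

    Λκ : fromℕ Λ * κ ≡ (+ 239976 / 25) * (x * x)
    Λκ = begin
      fromℕ Λ * ((b₁ + b₁ + b₁) * (fromℕ (K ℕ.* w ℕ.+ Λ) * (((1ℚ + 1ℚ) * 1/w) * ((1ℚ + 1ℚ) * 1/w))))
        ≡⟨ cong₂ (λ l k → l * ((b₁ + b₁ + b₁) * (k * (((1ℚ + 1ℚ) * 1/w) * ((1ℚ + 1ℚ) * 1/w))))) Λ≡ count ⟩
      ((+ 41200 / 1) * (x * y)) * ((b₁ + b₁ + b₁) * ((((+ 40 / 1) * x) * ((+ 2000 / 1) * y) + (+ 41200 / 1) * (x * y)) * (((1ℚ + 1ℚ) * 1/w) * ((1ℚ + 1ℚ) * 1/w))))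
        ≡⟨ lemma x y 1/w ⟩
      (+ 239976 / 25) * ((x * (((+ 2000 / 1) * y) * 1/w)) * (x * (((+ 2000 / 1) * y) * 1/w)))
        ≡⟨ cong (λ z → (+ 239976 / 25) * ((x * z) * (x * z))) (trans (cong (_* 1/w) (sym w≡)) (*-inverse-fromℕ w)) ⟩
      (+ 239976 / 25) * ((x * 1ℚ) * (x * 1ℚ))
        ≡⟨ cong (λ z → (+ 239976 / 25) * (z * z)) (ℚ.*-identityʳ x) ⟩
      (+ 239976 / 25) * (x * x) ∎
      where
      open ≡-Reasoning
      count : fromℕ (K ℕ.* w ℕ.+ Λ) ≡ ((+ 40 / 1) * x) * ((+ 2000 / 1) * y) + (+ 41200 / 1) * (x * y)
      count = trans (fromℕ-+ (K ℕ.* w) Λ) (cong₂ _+_ (trans (fromℕ-* K w) (cong₂ _*_ (trans (fromℕ-* 40 q) refl) w≡)) Λ≡)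
      lemma : ∀ x y i → ((+ 41200 / 1) * (x * y)) * ((((+ 66 / 1) * (+ 1 / 103)) + ((+ 66 / 1) * (+ 1 / 103)) + ((+ 66 / 1) * (+ 1 / 103))) * ((((+ 40 / 1) * x) * ((+ 2000 / 1) * y) + (+ 41200 / 1) * (x * y)) * (((1ℚ + 1ℚ) * i) * ((1ℚ + 1ℚ) * i))))
        ≡ (+ 239976 / 25) * ((x * (((+ 2000 / 1) * y) * i)) * (x * (((+ 2000 / 1) * y) * i)))
      lemma = solve-∀ ℚ-ring

  rank₁ : fromℕ n * (+ 10381 / 12500) ≤ meanRankAt 1
  rank₁ = ≤-by (fromℕ n * (+ 2119 / 12500) - (fromℕ n - meanRankAt 1)) (p≤q⇒0≤q-p (*-cancel-≤ {fromℕ n - meanRankAt 1} {fromℕ n * (+ 2119 / 12500)} {+ 100000 / 1} (ℚ.positive⁻¹ (+ 100000 / 1)) (begin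
    (+ 100000 / 1) * (fromℕ n - meanRankAt 1)
      ≡⟨ cong (_* (fromℕ n - meanRankAt 1)) (sym Z≡) ⟩
    fromℕ Z * (fromℕ n - meanRankAt 1)
      ≤⟨ uncovered Z ⟩
    (fromℕ Z * (fromℕ Z * fromℕ w) + fromℕ Z * (fromℕ n * ū)) + fromℕ Λ * (fromℕ Z * κ + 1ℚ)
      ≡⟨ cong (λ z → (z * (z * fromℕ w) + z * (fromℕ n * ū)) + fromℕ Λ * (z * κ + 1ℚ)) Z≡ ⟩
    ((+ 100000 / 1) * ((+ 100000 / 1) * fromℕ w) + (+ 100000 / 1) * (fromℕ n * ū)) + fromℕ Λ * ((+ 100000 / 1) * κ + 1ℚ)
      ≡⟨ separate (fromℕ w) (fromℕ n) (fromℕ Λ) κ ⟩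
    ((+ 100000 / 1) * ((+ 100000 / 1) * fromℕ w) + (+ 100000 / 1) * (fromℕ n * (+ 339 / 2000))) + ((+ 100000 / 1) * (fromℕ Λ * κ) + fromℕ Λ)
      ≡⟨ cong₂ (λ a b → ((+ 100000 / 1) * ((+ 100000 / 1) * a) + (+ 100000 / 1) * (b * (+ 339 / 2000))) + ((+ 100000 / 1) * (fromℕ Λ * κ) + fromℕ Λ)) w≡ n≡ ⟩
    ((+ 100000 / 1) * ((+ 100000 / 1) * ((+ 2000 / 1) * y)) + (+ 100000 / 1) * (((+ 40000 / 1) * N) * (+ 339 / 2000))) + ((+ 100000 / 1) * (fromℕ Λ * κ) + fromℕ Λ)
      ≡⟨ cong₂ (λ a b → ((+ 100000 / 1) * ((+ 100000 / 1) * ((+ 2000 / 1) * y)) + (+ 100000 / 1) * (((+ 40000 / 1) * N) * (+ 339 / 2000))) + ((+ 100000 / 1) * a + b)) Λκ Λ≡ ⟩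
    ((+ 100000 / 1) * ((+ 100000 / 1) * ((+ 2000 / 1) * y)) + (+ 100000 / 1) * (((+ 40000 / 1) * N) * (+ 339 / 2000))) + ((+ 100000 / 1) * ((+ 239976 / 25) * (x * x)) + (+ 41200 / 1) * N)
      -- Relative to `n`, the shifts cost Zw/n ≤ 5·10⁻⁷, the noise Λκ/n ≤ 2.4·10⁻⁷ and the kinks
      -- Λ/(Zn) = 1.03·10⁻⁵. The gap between 339/2000 and 2119/12500 is 2·10⁻⁵.
      ≤⟨ ≤-by ((+ 2000 / 1) * ((x - (+ 10000000000 / 1)) * y) + ((+ 119988 / 125) * (x * (y - (+ 1000000 / 1) * x)) + (+ 4480012 / 125) * (x * y)))
           (0≤+ (0≤* (ℚ.nonNegative⁻¹ (+ 2000 / 1)) (0≤* (p≤q⇒0≤q-p q≥) 0≤y))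
             (0≤+ (0≤* (ℚ.nonNegative⁻¹ (+ 119988 / 125)) (0≤* 0≤x (p≤q⇒0≤q-p u≥))) (0≤* (ℚ.nonNegative⁻¹ (+ 4480012 / 125)) 0≤N)))
           (estimate x y) ⟩
    (+ 100000 / 1) * (((+ 40000 / 1) * N) * (+ 2119 / 12500))
      ≡⟨ cong (λ z → (+ 100000 / 1) * (z * (+ 2119 / 12500))) (sym n≡) ⟩
    (+ 100000 / 1) * (fromℕ n * (+ 2119 / 12500)) ∎)))
    (finish (fromℕ n) (meanRankAt 1))
    where
    open ℚ.≤-Reasoning
    separate : ∀ w n l k → ((+ 100000 / 1) * ((+ 100000 / 1) * w) + (+ 100000 / 1) * (n * (+ 339 / 2000))) + l * ((+ 100000 / 1) * k + 1ℚ)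
      ≡ ((+ 100000 / 1) * ((+ 100000 / 1) * w) + (+ 100000 / 1) * (n * (+ 339 / 2000))) + ((+ 100000 / 1) * (l * k) + l)
    separate = solve-∀ ℚ-ring
    estimate : ∀ x y → (((+ 100000 / 1) * ((+ 100000 / 1) * ((+ 2000 / 1) * y)) + (+ 100000 / 1) * (((+ 40000 / 1) * (x * y)) * (+ 339 / 2000))) + ((+ 100000 / 1) * ((+ 239976 / 25) * (x * x)) + (+ 41200 / 1) * (x * y)))
      + ((+ 2000 / 1) * ((x - (+ 10000000000 / 1)) * y) + ((+ 119988 / 125) * (x * (y - (+ 1000000 / 1) * x)) + (+ 4480012 / 125) * (x * y)))
      ≡ (+ 100000 / 1) * (((+ 40000 / 1) * (x * y)) * (+ 2119 / 12500))
    estimate = solve-∀ ℚ-ring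
    finish : ∀ n r → n * (+ 10381 / 12500) + (n * (+ 2119 / 12500) - (n - r)) ≡ r
    finish = solve-∀ ℚ-ring

  private
    n≥ : + 10000000000 / 1 ≤ fromℕ n
    n≥ = subst (+ 10000000000 / 1 ≤_) (sym n≡) (≤-by
      ((+ 39999 / 1) * (x * y) + ((x - (+ 10000000000 / 1)) * y + (+ 10000000000 / 1) * (y - 1ℚ)))
      (0≤+ (0≤* (ℚ.nonNegative⁻¹ (+ 39999 / 1)) 0≤N) (0≤+ (0≤* (p≤q⇒0≤q-p q≥) 0≤y) (0≤* (ℚ.nonNegative⁻¹ (+ 10000000000 / 1)) (p≤q⇒0≤q-p 1≤y))))
      (lemma x y))
      where
      lemma : ∀ x y → (+ 10000000000 / 1) + ((+ 39999 / 1) * (x * y) + ((x - (+ 10000000000 / 1)) * y + (+ 10000000000 / 1) * (y - 1ℚ))) ≡ (+ 40000 / 1) * (x * y)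
      lemma = solve-∀ ℚ-ring

    0<n : 0ℚ < fromℕ n
    0<n = ℚ.<-≤-trans (ℚ.positive⁻¹ (+ 10000000000 / 1)) n≥

    Λ≡n : fromℕ Λ ≡ (+ 103 / 100) * fromℕ n
    Λ≡n = trans Λ≡ (trans (lemma N) (*-congˡ (+ 103 / 100) (sym n≡)))
      where
      lemma : ∀ N → (+ 41200 / 1) * N ≡ (+ 103 / 100) * ((+ 40000 / 1) * N)
      lemma = solve-∀ ℚ-ring

  rank₀-≥ : fromℕ n * (+ 999999 / 1000000) ≤ meanRankAt 0
  rank₀-≥ = ≤-by (fromℕ n * (+ 1 / 1000000) - (fromℕ n - meanRankAt 0)) (p≤q⇒0≤q-p (*-cancel-≤ {fromℕ n - meanRankAt 0} {fromℕ n * (+ 1 / 1000000)} {(+ 4 / 1) * d} 0<4d (begin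
    ((+ 4 / 1) * d) * (fromℕ n - meanRankAt 0)
      ≤⟨ rank₀ (0≤* (0≤fromℕ n) (ℚ.nonNegative⁻¹ (+ 3 / 10000))) large ⟩
    (+ 4 / 1) * fromℕ Λ
      ≡⟨ *-congˡ (+ 4 / 1) Λ≡n ⟩
    (+ 4 / 1) * ((+ 103 / 100) * fromℕ n)
      ≤⟨ ≤-by ((+ 12 / 10000000000) * (fromℕ n * (fromℕ n - (+ 10000000000 / 1))) + (+ 197 / 25) * fromℕ n)
           (0≤+ (0≤* (ℚ.nonNegative⁻¹ (+ 12 / 10000000000)) (0≤* (0≤fromℕ n) (p≤q⇒0≤q-p n≥))) (0≤* (ℚ.nonNegative⁻¹ (+ 197 / 25)) (0≤fromℕ n)))
           (estimate (fromℕ n)) ⟩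
    ((+ 4 / 1) * d) * (fromℕ n * (+ 1 / 1000000)) ∎)))
    (finish (fromℕ n) (meanRankAt 0))
    where
    open ℚ.≤-Reasoning
    -- Level 1 and the globals amount to at least (0.83048 + 0.1699)n = 1.00038n on average, which
    -- leaves room for this excess over `n`.
    d = fromℕ n * (+ 3 / 10000)
    0<4d : 0ℚ < (+ 4 / 1) * d
    0<4d = subst (0ℚ <_) (lemma (fromℕ n)) (subst (_< (+ 12 / 10000) * fromℕ n) (ℚ.*-zeroʳ (+ 12 / 10000)) (ℚ.*-monoʳ-<-pos (+ 12 / 10000) 0<n))
      where
      lemma : ∀ n → (+ 12 / 10000) * n ≡ (+ 4 / 1) * (n * (+ 3 / 10000))
      lemma = solve-∀ ℚ-ring
    large : fromℕ n + d ≤ meanRankAt 1 + fromℕ Λ * kindProb global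
    large = ℚ.≤-trans (≤-by (fromℕ n * (+ 1 / 12500)) (0≤* (0≤fromℕ n) (ℚ.nonNegative⁻¹ (+ 1 / 12500)))
        (trans (lemma (fromℕ n)) (cong (λ l → fromℕ n * (+ 10381 / 12500) + l * kindProb global) (sym Λ≡n))))
      (ℚ.+-monoˡ-≤ (fromℕ Λ * kindProb global) rank₁)
      where
      lemma : ∀ n → (n + n * (+ 3 / 10000)) + n * (+ 1 / 12500) ≡ n * (+ 10381 / 12500) + ((+ 103 / 100) * n) * ((+ 1699 / 100) * (+ 1 / 103))
      lemma = solve-∀ ℚ-ring
    estimate : ∀ n → (+ 4 / 1) * ((+ 103 / 100) * n) + ((+ 12 / 10000000000) * (n * (n - (+ 10000000000 / 1))) + (+ 197 / 25) * n) ≡ ((+ 4 / 1) * (n * (+ 3 / 10000))) * (n * (+ 1 / 1000000))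
    estimate = solve-∀ ℚ-ring
    finish : ∀ n r → n * (+ 999999 / 1000000) + (n * (+ 1 / 1000000) - (n - r)) ≡ r
    finish = solve-∀ ℚ-ring

  -- Per offline vertex, the levels 0 to 3 contribute about 1, 0.0664, 0.0306 and 0.9998.
  optimum≥ : fromℕ n * (+ 2096 / 1000) ≤ expectedOPT
  optimum≥ = begin
    fromℕ n * (+ 2096 / 1000)
      ≤⟨ *-monoˡ (0≤fromℕ n) (toWitness {a? = (+ 2096 / 1000) ℚ.≤? total} _) ⟩
    fromℕ n * total
      ≡⟨ lemma (fromℕ n) (+ 999999 / 1000000) (+ 10381 / 12500) (+ 9 / 50) (+ 19999 / 200000000) Δ₀ Δ₁ Δ₂ Δ₃ ⟩
    combined lower
      ≤⟨ combined-mono lower≤ ⟩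
    combined meanRankAt
      ≤⟨ combined≤expectedOPT ⟩
    expectedOPT ∎
    where
    open ℚ.≤-Reasoning
    total : ℚ
    total = Δ₀ * (+ 999999 / 1000000) + (Δ₁ * (+ 10381 / 12500) + (Δ₂ * (+ 9 / 50) + Δ₃ * (+ 19999 / 200000000)))
    lower : ℕ → ℚ
    lower 0 = fromℕ n * (+ 999999 / 1000000)
    lower 1 = fromℕ n * (+ 10381 / 12500)
    lower 2 = fromℕ n * (+ 9 / 50)
    lower 3 = fromℕ n * (+ 19999 / 200000000)
    -- A default value: `combined` reads the entries 0 to 3, and this choice makes the bound at all
    -- further levels reflexive.
    lower (suc (suc (suc (suc l)))) = meanRankAt (suc (suc (suc (suc l))))
    lower≤ : ∀ l → lower l ≤ meanRankAt l
    lower≤ 0 = rank₀-≥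
    lower≤ 1 = rank₁
    lower≤ 2 = rank₂
    lower≤ 3 = rank₃
    lower≤ (suc (suc (suc (suc l)))) = ℚ.≤-refl
    lemma : ∀ n a b c d p q r t → n * (p * a + (q * b + (r * c + t * d))) ≡ p * (n * a) + (q * (n * b) + (r * (n * c) + t * (n * d)))
    lemma = solve-∀ ℚ-ring

  -- The quotient 1.473/2.096 is about 0.7028.
  strict : fromℕ n * (+ 1473 / 1000) < (+ 703 / 1000) * expectedOPT
  strict = ℚ.<-≤-trans (ℚ.*-monoʳ-<-pos (fromℕ n) {{ℚ.positive 0<n}} (toWitness {a? = (+ 1473 / 1000) ℚ.<? ((+ 703 / 1000) * (+ 2096 / 1000))} _))
    (ℚ.≤-trans (ℚ.≤-reflexive (lemma (fromℕ n) (+ 703 / 1000) (+ 2096 / 1000))) (*-monoˡ (ℚ.nonNegative⁻¹ (+ 703 / 1000)) optimum≥))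
    where
    lemma : ∀ n a b → n * (a * b) ≡ a * (n * b)
    lemma = solve-∀ ℚ-ring

  hardInstance : Instance
  hardInstance = inst

  hard : ∀ {c ℓ₁ ℓ₂} (K : OrderedExtension c ℓ₁ ℓ₂) (alg : Instance.Algorithm hardInstance K) →
    OrderedExtension._<_ K (Instance.Algorithm.expectedALG alg) (OrderedExtension.ι K ((+ 703 / 1000) * Instance.expectedOPT hardInstance))
  hard K alg = Extension.≤ι⇒< K (Bounded.expectedALG≤ s n Λ L n≡s Λ≡s L≡s Λ≡400L K alg) strict

-- Abstract multiplication keeps the huge parameters from being unfolded.
abstract
  times : ℕ → ℕ → ℕ
  times = ℕ._*_

  times≡* : ∀ c k → times c k ≡ c ℕ.* k
  times≡* c k = refl

  instance
    times-nonZero : ∀ {c k} {{_ : NonZero c}} {{_ : NonZero k}} → NonZero (times c k)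
    times-nonZero {c} {k} = ℕ.m*n≢0 c k

fromℕ-times : ∀ c k → fromℕ (times c k) ≡ (+ c / 1) * fromℕ k
fromℕ-times c k = trans (cong fromℕ (times≡* c k)) (trans (fromℕ-* c k) (cong (_* fromℕ k) (fromℕ≡/1 c)))

q₀ u₀ Z₀ qu s₀ n₀ L₀ Λ₀ w₀ : ℕ
q₀ = times 10000000000 1
u₀ = times 1000000 q₀
Z₀ = times 100000 1
qu = times q₀ u₀
s₀ = times 400 qu
n₀ = times 40000 qu
L₀ = times 103 qu
Λ₀ = times 400 L₀
w₀ = times 2000 u₀

fromℕ-qu : ∀ c → fromℕ (times c qu) ≡ (+ c / 1) * (fromℕ q₀ * fromℕ u₀)
fromℕ-qu c = trans (fromℕ-times c qu) (*-congˡ (+ c / 1) (trans (cong fromℕ (times≡* q₀ u₀)) (fromℕ-* q₀ u₀)))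

open Conclusion q₀ u₀ Z₀ s₀ n₀ Λ₀ L₀ w₀
  (fromℕ-qu 400) (fromℕ-qu 40000)
  (trans (fromℕ-times 400 L₀) (trans (*-congˡ (+ 400 / 1) (fromℕ-qu 103)) (sym (ℚ.*-assoc (+ 400 / 1) (+ 103 / 1) (fromℕ q₀ * fromℕ u₀)))))
  (fromℕ-qu 103) (fromℕ-times 2000 u₀) (fromℕ-times 100000 1)
  (ℚ.≤-reflexive (sym (fromℕ-times 10000000000 1))) (ℚ.≤-reflexive (sym (fromℕ-times 1000000 q₀)))
  (times≡* 400 L₀)
  using (hardInstance; hard)

mainTheorem17 : (c ℓ₁ ℓ₂ : Level) →
    Σ Instance λ inst →
    (K : OrderedExtension c ℓ₁ ℓ₂) (alg : Instance.Algorithm inst K) →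
    OrderedExtension._<_ K
    (Instance.Algorithm.expectedALG alg)
    (OrderedExtension.ι K ((+ 703 / 1000) * Instance.expectedOPT inst))
mainTheorem17 c ℓ₁ ℓ₂ = hardInstance , hard
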